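{- Let $0<\varepsilon\le\frac1{8d}$, $k\ge 2d$ and $\Delta\ge\big((2k+z)(\frac{1}{4\varepsilon}+d)\big)^2$. Any deterministic fully dynamic streaming algorithm that maintains a weight-restricted $(\varepsilon,k,z)$-coreset for the $k$-center problem with $z$ outliers in a $d$-dimensional discrete Euclidean space $[\Delta]^d=\{1,2,3,\dots,\Delta\}^d$ must use $\Omega((k/\varepsilon^d)\log\Delta+z)$ space.
   Context: Problem. $k,z\in\mathbb{N}$; $d$ is a constant. For a point set $P\subseteq[\Delta]^d$ with positive integer weights (unweighted points have weight $1$), $\mathrm{opt}_{k,z}(P)$ is the minimum radius of $k$ congruent (equal-sized) Euclidean balls that together cover all points of $P$ except for outliers of total weight at most $z$; $b(c,r)$ is the closed ball of radius $r$ around $c$. The total weight of a weighted set $Q$ is denoted $w(Q)$. Coreset. A weighted subset $P^*\subseteq P$ (with positive integer weights that may differ from those in $P$) is an $(\varepsilon,k,z)$-coreset of $P$ if (1) $(1-\varepsilon)\,\mathrm{opt}_{k,z}(P)\le \mathrm{opt}_{k,z}(P^*)\le(1+\varepsilon)\,\mathrm{opt}_{k,z}(P)$; and (2) for any set $\{b(c_1,r),\dots,b(c_k,r)\}$ of congruent balls such that the total weight of the points of $P^*$ not covered by them is at most $z$, the total weight of the points of $P$ not covered by $b(c_1,r'),\dots,b(c_k,r')$, with $r'=r+\varepsilon\cdot\mathrm{opt}_{k,z}(P)$, is at most $z$. Streaming setting. In the fully dynamic streaming model the stream consists of insertions and deletions of points; $P(t)$ is the set of points present at time $t$ (inserted and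 not deleted). The algorithm maintains an $(\varepsilon,k,z)$-coreset $P^*(t)\subseteq P(t)$ of $P(t)$. The coreset $P^*(t)$ is weight-restricted if $w(P^*(t))\le w(P(t))$. -}

module Defs where

open import Data.Bool using (Bool; false)
open import Data.Fin using (Fin; toℕ)
import Data.Integer as ℤ
open import Data.List using (List; []; _∷_; map; filter; filterᵇ)
open import Data.List.Membership.Propositional using (_∈_; _∉_)
open import Data.List.Relation.Binary.Subset.Propositional using (_⊆_)
open import Data.List.Relation.Unary.All using (All)
open import Data.List.Relation.Unary.Unique.Propositional using (Unique)
open import Data.Nat as ℕ using (ℕ; zero; suc)
open import Data.Nat.ListAction using (sum)
import Data.Nat.Properties as ℕ
open import Data.Product using (_×_; _,_; proj₁; proj₂; ∃-syntax; Σ-syntax)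
open import Data.Rational as ℚ using (ℚ; 0ℚ; 1ℚ; ½)
import Data.Rational.Properties as ℚ
open import Data.Rational.Solver using (module +-*-Solver)
open import Data.Vec as Vec using (Vec)
import Data.Fin.Properties as Fin
import Data.Vec.Functional as VecF
import Data.Vec.Properties as Vec
open import Function using (_∘_)
open import Relation.Binary using (DecidableEquality)
open import Relation.Binary.PropositionalEquality
  using (_≡_; refl; sym; trans; cong; cong₂; subst)
open import Relation.Nullary using (¬?)

------------------------------------------------------------------------
-- Real numbers: Cauchy sequences of rationals, compared by _≃ℝ_

Eventually : (ℕ → Set) → Set
Eventually P = ∃[ N ] (∀ n → N ℕ.≤ n → P n)

IsCauchy : (ℕ → ℚ) → Set
IsCauchy x = ∀ e → 0ℚ ℚ.< e →
  ∃[ N ] (∀ m n → N ℕ.≤ m → N ℕ.≤ n → ℚ.∣ x m ℚ.- x n ∣ ℚ.< e)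

record ℝ : Set where
  constructor mkℝ
  field
    seq    : ℕ → ℚ
    cauchy : IsCauchy seq

open ℝ public

infix 4 _≤ℝ_ _<ℝ_ _≃ℝ_

_≤ℝ_ : ℝ → ℝ → Set
x ≤ℝ y = ∀ e → 0ℚ ℚ.< e → Eventually λ n → seq x n ℚ.≤ seq y n ℚ.+ e

_<ℝ_ : ℝ → ℝ → Set
x <ℝ y = ∃[ e ] (0ℚ ℚ.< e × Eventually λ n → seq x n ℚ.+ e ℚ.≤ seq y n)

_≃ℝ_ : ℝ → ℝ → Set
x ≃ℝ y = x ≤ℝ y × y ≤ℝ x

private
  open ℚ.≤-Reasoning

  abstract
    half-pos : ∀ {e} → 0ℚ ℚ.< e → 0ℚ ℚ.< ½ ℚ.* e
    half-pos {e} 0<e = subst (ℚ._< ½ ℚ.* e) (ℚ.*-zeroʳ ½) (ℚ.*-monoʳ-<-pos ½ 0<e)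

    halves : ∀ e → ½ ℚ.* e ℚ.+ ½ ℚ.* e ≡ e
    halves e = trans (sym (ℚ.*-distribʳ-+ e ½ ½)) (ℚ.*-identityˡ e)

    -- If |a| , |b| are bounded by B then |ab − a′b′| is controlled by the
    -- differences of the factors.
    productDifference : ∀ B e → 0ℚ ℚ.≤ B → ∀ a a′ b b′ →
      ℚ.∣ a ∣ ℚ.≤ B → ℚ.∣ b′ ∣ ℚ.≤ B →
      ℚ.∣ a ℚ.- a′ ∣ ℚ.≤ e → ℚ.∣ b ℚ.- b′ ∣ ℚ.≤ e →
      ℚ.∣ a ℚ.* b ℚ.- a′ ℚ.* b′ ∣ ℚ.≤ B ℚ.* e ℚ.+ B ℚ.* e
    productDifference B e 0≤B a a′ b b′ a≤B b′≤B a-a′≤e b-b′≤e = begin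
      ℚ.∣ a ℚ.* b ℚ.- a′ ℚ.* b′ ∣
        ≡⟨ cong ℚ.∣_∣ (solve 4 (λ a a′ b b′ →
              a :* b :- a′ :* b′ := a :* (b :- b′) :+ b′ :* (a :- a′)) refl a a′ b b′) ⟩
      ℚ.∣ a ℚ.* (b ℚ.- b′) ℚ.+ b′ ℚ.* (a ℚ.- a′) ∣
        ≤⟨ ℚ.∣p+q∣≤∣p∣+∣q∣ (a ℚ.* (b ℚ.- b′)) (b′ ℚ.* (a ℚ.- a′)) ⟩
      ℚ.∣ a ℚ.* (b ℚ.- b′) ∣ ℚ.+ ℚ.∣ b′ ℚ.* (a ℚ.- a′) ∣
        ≤⟨ ℚ.+-mono-≤ (bound a (b ℚ.- b′) a≤B b-b′≤e) (bound b′ (a ℚ.- a′) b′≤B a-a′≤e) ⟩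
      B ℚ.* e ℚ.+ B ℚ.* e ∎
      where
      open +-*-Solver
      bound : ∀ p q → ℚ.∣ p ∣ ℚ.≤ B → ℚ.∣ q ∣ ℚ.≤ e → ℚ.∣ p ℚ.* q ∣ ℚ.≤ B ℚ.* e
      bound p q p≤B q≤e = begin
        ℚ.∣ p ℚ.* q ∣       ≡⟨ ℚ.∣p*q∣≡∣p∣*∣q∣ p q ⟩
        ℚ.∣ p ∣ ℚ.* ℚ.∣ q ∣ ≤⟨ ℚ.*-monoʳ-≤-nonNeg ℚ.∣ q ∣ {{ℚ.∣-∣-nonNeg q}} p≤B ⟩
        B ℚ.* ℚ.∣ q ∣       ≤⟨ ℚ.*-monoˡ-≤-nonNeg B {{ℚ.nonNegative 0≤B}} q≤e ⟩
        B ℚ.* e             ∎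

    eventuallyBounded : ∀ x → IsCauchy x →
      Σ[ B ∈ ℚ ] (1ℚ ℚ.≤ B × Eventually λ n → ℚ.∣ x n ∣ ℚ.≤ B)
    eventuallyBounded x xC with xC 1ℚ (ℚ.positive⁻¹ 1ℚ)
    ... | N , close = 1ℚ ℚ.+ ℚ.∣ x N ∣
        , subst (ℚ._≤ 1ℚ ℚ.+ ℚ.∣ x N ∣) (ℚ.+-identityʳ 1ℚ) (ℚ.+-monoʳ-≤ 1ℚ (ℚ.0≤∣p∣ (x N)))
        , N , λ n N≤n → begin
            ℚ.∣ x n ∣
              ≡⟨ cong ℚ.∣_∣ (solve 2 (λ a b → a := (a :- b) :+ b) refl (x n) (x N)) ⟩
            ℚ.∣ (x n ℚ.- x N) ℚ.+ x N ∣
              ≤⟨ ℚ.∣p+q∣≤∣p∣+∣q∣ (x n ℚ.- x N) (x N) ⟩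
            ℚ.∣ x n ℚ.- x N ∣ ℚ.+ ℚ.∣ x N ∣
              ≤⟨ ℚ.+-monoˡ-≤ ℚ.∣ x N ∣ (ℚ.<⇒≤ (close n N N≤n ℕ.≤-refl)) ⟩
            1ℚ ℚ.+ ℚ.∣ x N ∣ ∎
      where open +-*-Solver

    +-cauchy : ∀ x y → IsCauchy x → IsCauchy y → IsCauchy (λ n → x n ℚ.+ y n)
    +-cauchy x y xC yC e 0<e with xC (½ ℚ.* e) (half-pos 0<e) | yC (½ ℚ.* e) (half-pos 0<e)
    ... | M , xM | N , yN = M ℕ.⊔ N , λ m n p q → begin-strict
      ℚ.∣ (x m ℚ.+ y m) ℚ.- (x n ℚ.+ y n) ∣
        ≡⟨ cong ℚ.∣_∣ (solve 4 (λ a b c d → (a :+ b) :- (c :+ d) := (a :- c) :+ (b :- d))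
             refl (x m) (y m) (x n) (y n)) ⟩
      ℚ.∣ (x m ℚ.- x n) ℚ.+ (y m ℚ.- y n) ∣
        ≤⟨ ℚ.∣p+q∣≤∣p∣+∣q∣ (x m ℚ.- x n) (y m ℚ.- y n) ⟩
      ℚ.∣ x m ℚ.- x n ∣ ℚ.+ ℚ.∣ y m ℚ.- y n ∣
        <⟨ ℚ.+-mono-< (xM m n (ℕ.m⊔n≤o⇒m≤o M N p) (ℕ.m⊔n≤o⇒m≤o M N q))
                      (yN m n (ℕ.m⊔n≤o⇒n≤o M N p) (ℕ.m⊔n≤o⇒n≤o M N q)) ⟩
      ½ ℚ.* e ℚ.+ ½ ℚ.* e ≡⟨ halves e ⟩
      e ∎
      where open +-*-Solver

    neg-cauchy : ∀ x → IsCauchy x → IsCauchy (λ n → ℚ.- x n)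
    neg-cauchy x xC e 0<e with xC e 0<e
    ... | N , xN = N , λ m n p q → subst (ℚ._< e)
      (trans (sym (ℚ.∣-p∣≡∣p∣ (x m ℚ.- x n)))
             (cong ℚ.∣_∣ (solve 2 (λ a b → :- (a :- b) := :- a :- (:- b)) refl (x m) (x n))))
      (xN m n p q)
      where open +-*-Solver

    smallFactor : ∀ D e → 0ℚ ℚ.< D → 0ℚ ℚ.< e →
      ∃[ g ] (0ℚ ℚ.< g × D ℚ.* g ℚ.+ D ℚ.* g ℚ.< e)
    smallFactor D e 0<D 0<e = g , 0<g , (begin-strict
      D ℚ.* g ℚ.+ D ℚ.* g     ≡⟨ cong₂ ℚ._+_ Dg≡f Dg≡f ⟩
      f ℚ.+ f                 ≡⟨ halves (½ ℚ.* e) ⟩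
      ½ ℚ.* e                 ≡⟨ sym (ℚ.+-identityʳ (½ ℚ.* e)) ⟩
      ½ ℚ.* e ℚ.+ 0ℚ          <⟨ ℚ.+-monoʳ-< (½ ℚ.* e) (half-pos 0<e) ⟩
      ½ ℚ.* e ℚ.+ ½ ℚ.* e     ≡⟨ halves e ⟩
      e                       ∎)
      where
      instance
        posD : ℚ.Positive D
        posD = ℚ.positive 0<D
        nzD : ℚ.NonZero D
        nzD = ℚ.pos⇒nonZero D
      f g : ℚ
      f = ½ ℚ.* (½ ℚ.* e)
      g = (ℚ.1/ D) ℚ.* f
      0<g : 0ℚ ℚ.< g
      0<g = ℚ.positive⁻¹ g
        {{ℚ.pos*pos⇒pos (ℚ.1/ D) {{ℚ.1/pos⇒pos D}} f {{ℚ.positive (half-pos (half-pos 0<e))}}}}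
      Dg≡f : D ℚ.* g ≡ f
      Dg≡f = trans (sym (ℚ.*-assoc D (ℚ.1/ D) f))
               (trans (cong (ℚ._* f) (ℚ.*-inverseʳ D)) (ℚ.*-identityˡ f))

    *-cauchy : ∀ x y → IsCauchy x → IsCauchy y → IsCauchy (λ n → x n ℚ.* y n)
    *-cauchy x y xC yC e 0<e =
      let A , 1≤A , I , x≤A = eventuallyBounded x xC
          B , 1≤B , J , y≤B = eventuallyBounded y yC
          0≤A = ℚ.≤-trans (ℚ.<⇒≤ (ℚ.positive⁻¹ 1ℚ)) 1≤A
          0≤B = ℚ.≤-trans (ℚ.<⇒≤ (ℚ.positive⁻¹ 1ℚ)) 1≤B
          D = A ℚ.+ B
          A≤D = subst (ℚ._≤ D) (ℚ.+-identityʳ A) (ℚ.+-monoʳ-≤ A 0≤B)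
          B≤D = subst (ℚ._≤ D) (ℚ.+-identityˡ B) (ℚ.+-monoˡ-≤ B 0≤A)
          1≤D = ℚ.≤-trans 1≤A A≤D
          0<D = ℚ.<-≤-trans (ℚ.positive⁻¹ 1ℚ) 1≤D
          g , 0<g , small = smallFactor D e 0<D 0<e
          M , xM = xC g 0<g
          N , yN = yC g 0<g
      in (I ℕ.⊔ J) ℕ.⊔ (M ℕ.⊔ N) , λ m n p q →
        let p₁ = ℕ.m⊔n≤o⇒m≤o (I ℕ.⊔ J) (M ℕ.⊔ N) p
            p₂ = ℕ.m⊔n≤o⇒n≤o (I ℕ.⊔ J) (M ℕ.⊔ N) p
            q₁ = ℕ.m⊔n≤o⇒m≤o (I ℕ.⊔ J) (M ℕ.⊔ N) q
            q₂ = ℕ.m⊔n≤o⇒n≤o (I ℕ.⊔ J) (M ℕ.⊔ N) q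
        in ℚ.≤-<-trans
          (productDifference D g (ℚ.<⇒≤ 0<D) (x m) (x n) (y m) (y n)
            (ℚ.≤-trans (x≤A m (ℕ.m⊔n≤o⇒m≤o I J p₁)) A≤D)
            (ℚ.≤-trans (y≤B n (ℕ.m⊔n≤o⇒n≤o I J q₁)) B≤D)
            (ℚ.<⇒≤ (xM m n (ℕ.m⊔n≤o⇒m≤o M N p₂) (ℕ.m⊔n≤o⇒m≤o M N q₂)))
            (ℚ.<⇒≤ (yN m n (ℕ.m⊔n≤o⇒n≤o M N p₂) (ℕ.m⊔n≤o⇒n≤o M N q₂))))
          small

infixl 6 _+ℝ_ _-ℝ_
infixl 7 _*ℝ_
infixr 8 _^ℝ_
infix  8 -ℝ_

fromℚ : ℚ → ℝ
fromℚ q = mkℝ (λ _ → q) λ e 0<e → 0 , λ _ _ _ _ →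
  subst (ℚ._< e) (sym (cong ℚ.∣_∣ (ℚ.+-inverseʳ q))) 0<e

fromℕ : ℕ → ℝ
fromℕ n = fromℚ (ℤ.+ n ℚ./ 1)

0ℝ 1ℝ : ℝ
0ℝ = fromℕ 0
1ℝ = fromℕ 1

_+ℝ_ : ℝ → ℝ → ℝ
x +ℝ y = mkℝ (λ n → seq x n ℚ.+ seq y n) (+-cauchy (seq x) (seq y) (cauchy x) (cauchy y))

-ℝ_ : ℝ → ℝ
-ℝ x = mkℝ (λ n → ℚ.- seq x n) (neg-cauchy (seq x) (cauchy x))

_-ℝ_ : ℝ → ℝ → ℝ
x -ℝ y = x +ℝ (-ℝ y)

_*ℝ_ : ℝ → ℝ → ℝ
x *ℝ y = mkℝ (λ n → seq x n ℚ.* seq y n) (*-cauchy (seq x) (seq y) (cauchy x) (cauchy y))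

_^ℝ_ : ℝ → ℕ → ℝ
x ^ℝ zero  = 1ℝ
x ^ℝ suc n = x *ℝ (x ^ℝ n)

------------------------------------------------------------------------
-- Points and balls

-- The point v has coordinates 1 + toℕ vᵢ ∈ {1,…,Δ}.
Point : ℕ → ℕ → Set
Point d Δ = Vec (Fin Δ) d

_≟ᴾ_ : ∀ {d Δ} → DecidableEquality (Point d Δ)
_≟ᴾ_ = Vec.≡-dec Fin._≟_

ℝ^ : ℕ → Set
ℝ^ d = Fin d → ℝ

embed : ∀ {d Δ} → Point d Δ → ℝ^ d
embed p i = fromℕ (suc (toℕ (Vec.lookup p i)))

sqDist : ∀ {d} → ℝ^ d → ℝ^ d → ℝ
sqDist x y = VecF.foldr _+ℝ_ 0ℝ (λ i → (x i -ℝ y i) ^ℝ 2)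

-- x lies in the closed Euclidean ball b(c,r).
_∈b⟨_,_⟩ : ∀ {d} → ℝ^ d → ℝ^ d → ℝ → Set
x ∈b⟨ c , r ⟩ = 0ℝ ≤ℝ r × sqDist x c ≤ℝ r ^ℝ 2

------------------------------------------------------------------------
-- Weighted point sets

Weighted : ℕ → ℕ → Set
Weighted d Δ = List (Point d Δ × ℕ)

points : ∀ {d Δ} → Weighted d Δ → List (Point d Δ)
points = map proj₁

weight : ∀ {d Δ} → Weighted d Δ → ℕ
weight Q = sum (map proj₂ Q)

unweighted : ∀ {d Δ} → List (Point d Δ) → Weighted d Δ
unweighted = map (_, 1)

IsWeightedSet : ∀ {d Δ} → Weighted d Δ → Set
IsWeightedSet Q = Unique (points Q) × All (λ (_ , w) → 0 ℕ.< w) Q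

-- The points of Q not covered by b(c₁,r),…,b(c_k,r) have total weight at most
-- z.  Membership in a ball is not decidable, so the uncovered points are
-- enclosed in a decidable set `out` of outliers of total weight at most z.
UncoveredWeight≤ : ∀ {d Δ k} → ℕ → Weighted d Δ → (Fin k → ℝ^ d) → ℝ → Set
UncoveredWeight≤ {d} {Δ} z Q c r = Σ[ out ∈ (Point d Δ → Bool) ]
  weight (filterᵇ (out ∘ proj₁) Q) ℕ.≤ z ×
  (∀ p → p ∈ points Q → out p ≡ false → ∃[ j ] embed p ∈b⟨ c j , r ⟩)

Feasible : ∀ {d Δ} → ℕ → ℕ → Weighted d Δ → ℝ → Set
Feasible {d} k z Q r = 0ℝ ≤ℝ r × ∃[ c ] UncoveredWeight≤ {k = k} z Q c r

-- ρ = opt_{k,z}(Q).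
IsOpt : ∀ {d Δ} → ℕ → ℕ → Weighted d Δ → ℝ → Set
IsOpt k z Q ρ = Feasible k z Q ρ × (∀ r → Feasible k z Q r → ρ ≤ℝ r)

-- P* is an (ε,k,z)-coreset of P.
IsCoreset : ∀ {d Δ} → ℝ → ℕ → ℕ → Weighted d Δ → Weighted d Δ → Set
IsCoreset {d} ε k z P P* =
  IsWeightedSet P* × points P* ⊆ points P ×
  ∃[ opt ] ∃[ opt* ] (IsOpt k z P opt × IsOpt k z P* opt* ×
    (1ℝ -ℝ ε) *ℝ opt ≤ℝ opt* × opt* ≤ℝ (1ℝ +ℝ ε) *ℝ opt ×
    (∀ (c : Fin k → ℝ^ d) r → 0ℝ ≤ℝ r →
      UncoveredWeight≤ z P* c r → UncoveredWeight≤ z P c (r +ℝ ε *ℝ opt)))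

------------------------------------------------------------------------
-- Fully dynamic streams and algorithms

-- A stream whose set of points currently present is P.  Only absent points
-- are inserted and only present points are deleted.
data Stream {d Δ} : List (Point d Δ) → Set where
  empty  : Stream []
  insert : ∀ {P} → Stream P → ∀ p → p ∉ P → Stream (p ∷ P)
  delete : ∀ {P} → Stream P → ∀ p → p ∈ P → Stream (filter (λ q → ¬? (q ≟ᴾ p)) P)

data Update (d Δ : ℕ) : Set where
  ins del : Point d Δ → Update d Δ

-- Memory of s words of b bits each.
Memory : ℕ → ℕ → Set
Memory b s = Vec (Vec Bool b) s

-- A deterministic algorithm whose only information about the past of the
-- stream is the content of its memory.  The maps are arbitrary functions, so
-- no bound is put on running time or on scratch space used within an update.
record Algorithm (d Δ b s : ℕ) : Set where
  field
    init    : Memory b s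
    update  : Update d Δ → Memory b s → Memory b s
    coreset : Memory b s → Weighted d Δ

  run : ∀ {P} → Stream P → Memory b s
  run empty          = init
  run (insert σ p _) = update (ins p) (run σ)
  run (delete σ p _) = update (del p) (run σ)

MaintainsWeightRestrictedCoreset : ∀ {d Δ b s} → ℝ → ℕ → ℕ → Algorithm d Δ b s → Set
MaintainsWeightRestrictedCoreset {d} {Δ} ε k z A =
  ∀ {P : List (Point d Δ)} (σ : Stream P) →
    IsCoreset ε k z (unweighted P) (coreset (run σ)) ×
    weight (coreset (run σ)) ℕ.≤ weight (unweighted P)
  where open Algorithm A

{-# OPTIONS --safe #-}

-- An instance is encoded by one grid point for each of n slots, each with L
-- possible positions.  If different instances lead to different memories, then
-- L ^ n ≤ 2 ^ (b s).  Two families of instances give the two terms of the bound.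
--
-- For z, take k + z points, one in each of k + z blocks of the grid.  Then
-- opt = 0, and a coreset of weight at most k + z contains all points: otherwise
-- k − 1 of its points carry all its weight but z (one of them may have weight
-- at least 2), while they leave z + 1 points of the instance uncovered.
--
-- For k / ε ^ d · log Δ, there are k − 2d + 1 clusters, Θ(log Δ) scales v that
-- grow geometrically, and at each scale and cluster N ^ d cells, N = Θ(1 / ε),
-- which surround the cells of smaller scales.  Suppose that two instances lead
-- to the same memory.  Deleting the common points of the largest slots leaves
-- two sets that differ in a point p of the largest remaining slot.  After
-- further common insertions, the coreset is a subset of both sets, so it misses
-- p.  Put h = 64 d N v.  The 2d balls b(p ± h eᵢ, h) cover the cluster of p, and
-- the balls with radius r = h − 12 v cover all of it but p, because other cells
-- are 24 v away from p.  One ball covers each other cluster.  Hence opt ≤ h, and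
-- as r + ε opt < h, the small balls together with z inserted isolated points as
-- outliers contradict the coreset property, provided that the isolated points
-- have weight at most z in the coreset.  This is enforced by inserting two
-- beacons into each of the k balls such that points of different balls are more
-- than 2 (1 + 2ε) h apart: an optimal solution for the coreset that spends a ball
-- on an isolated point would leave more than z points uncovered.

module Submission where

open import Defs
open import Data.Bool as Bool using (Bool; true; false; not)
import Data.Bool.Properties as Bool
open import Data.Empty using (⊥; ⊥-elim)
open import Data.Fin as Fin using (Fin; toℕ; punchIn)
import Data.Fin.Properties as Fin
import Data.Integer as ℤ
import Data.Integer.Properties as ℤ
open import Data.List as List using (List; []; _∷_; _++_; length; filter; filterᵇ)
import Data.List.Membership.DecPropositional as DecMembership
open import Data.List.Membership.Propositional using (_∈_; _∉_)
open import Data.List.Membership.Propositional.Properties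
  using (∈-lookup; ∈-++⁺ˡ; ∈-++⁺ʳ; ∈-++⁻; ∈-tabulate⁺; ∈-tabulate⁻)
import Data.List.Membership.Setoid.Properties as Membershipₛ
open import Data.List.Properties using (filter-all; filter-reject; length-map; length-++)
open import Data.List.Relation.Unary.All as All using (All; []; _∷_)
open import Data.List.Relation.Unary.All.Properties using (¬Any⇒All¬; All¬⇒¬Any)
open import Data.List.Relation.Unary.AllPairs using ([]; _∷_)
open import Data.List.Relation.Unary.Any as Any using (Any; here; there)
open import Data.List.Relation.Unary.Unique.Propositional using (Unique)
import Data.List.Relation.Unary.Unique.Propositional.Properties as Unique
open import Data.Nat as ℕ using (ℕ; zero; suc)
import Data.Nat.DivMod as ℕ
import Data.Nat.Properties as ℕ
open import Data.Nat.Induction using (<-rec)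
open import Data.Nat.Tactic.RingSolver using (solve-∀)
open import Data.Product using (_×_; _,_; proj₁; proj₂; ∃-syntax; Σ-syntax; uncurry)
open import Data.Product.Function.NonDependent.Propositional using (_×-↔_)
import Data.Product.Properties as Product
open import Data.Rational as ℚ using (ℚ; 0ℚ; 1ℚ; ½)
import Data.Rational.Properties as ℚ
open import Data.Rational.Solver using (module +-*-Solver)
import Data.Rational.Unnormalised as ℚᵘ
import Data.Rational.Unnormalised.Properties as ℚᵘ
open import Data.Sum as Sum using (_⊎_; inj₁; inj₂; [_,_]′)
open import Data.Sum.Function.Propositional using (_⊎-↔_)
import Data.Sum.Properties as Sum
open import Data.Sum.Properties using (inj₁-injective; inj₂-injective)
open import Data.Unit using (⊤)
open import Data.Vec as Vec using (Vec; []; _∷_)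
import Data.Vec.Functional as VecF
import Data.Vec.Functional.Properties as VecF
import Data.Vec.Properties as Vec
open import Function using (_∘_; Injective; _↔_; Inverse; mk↔ₛ′)
open import Function.Construct.Composition using (_↔-∘_)
open import Function.Construct.Identity using (↔-id)
open import Relation.Binary using (DecidableEquality; Tri; tri<; tri≈; tri>)
open import Relation.Binary.PropositionalEquality hiding ([_])
open import Relation.Nullary using (¬_; Dec; yes; no; contradiction; does; ¬?)
open import Relation.Nullary.Decidable using (dec-true; from-no; from-yes)

-- Order and intervals of real numbers

-- A word has up to `κ * ⌈log₂ Δ ⌉` bits, so the first term of the bound on words asks for order
-- log² Δ bits per cell position: one logarithm is the number of scales, the other is the length `ℓ`
-- of an offset of the point inside its cell. A block only has to store one logarithm.
--
-- The lengths 64, 24, 12 and 9 form one budget. A cluster has side 64 N v, and h is d times that. A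
-- displacement of 24 v allows the radius h to shrink by 12 v, because h (h - 24 v) ≤ (h - 12 v)². N
-- is chosen so that ε ≤ 9 / (64 d N); the enlargement ε opt ≤ ε h is then at most 9 v and does not
-- regain the 12 v.
--
-- The hypothesis on Δ gives d N (2 k + z) ≤ √Δ. Both families occupy 2 ^ m · x grid positions on
-- the first axis with x ≤ d N (2 k + z), so that 2 ^ m may use up the other √Δ.
--
-- Geometry is done with squared distances of integer points. Unknown ball centres are eliminated by
-- the parallelogram law, and the radii and ε are only located in intervals from 0 to a rational
-- number.

ι : ℕ → ℚ
ι n = ℤ.+ n ℚ./ 1

private
  ιᵘ : ∀ n → ℚ.toℚᵘ (ι n) ℚᵘ.≃ ℚᵘ.mkℚᵘ (ℤ.+ n) 0
  ιᵘ n = ℚ.toℚᵘ-fromℚᵘ (ℚᵘ.mkℚᵘ (ℤ.+ n) 0)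

ι-+ : ∀ m n → ι (m ℕ.+ n) ≡ ι m ℚ.+ ι n
ι-+ m n = ℚ.toℚᵘ-injective (ℚᵘ.≃-trans (ιᵘ (m ℕ.+ n)) (ℚᵘ.≃-trans
  (ℚᵘ.*≡* (cong (ℤ._* (ℤ.+ 1)) (cong₂ ℤ._+_ (sym (ℤ.*-identityʳ (ℤ.+ m))) (sym (ℤ.*-identityʳ (ℤ.+ n))))))
  (ℚᵘ.≃-sym (ℚᵘ.≃-trans (ℚ.toℚᵘ-homo-+ (ι m) (ι n)) (ℚᵘ.+-cong (ιᵘ m) (ιᵘ n))))))

ι-* : ∀ m n → ι (m ℕ.* n) ≡ ι m ℚ.* ι n
ι-* m n = ℚ.toℚᵘ-injective (ℚᵘ.≃-trans (ιᵘ (m ℕ.* n)) (ℚᵘ.≃-trans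
  (ℚᵘ.*≡* (cong (ℤ._* (ℤ.+ 1)) (ℤ.pos-* m n)))
  (ℚᵘ.≃-sym (ℚᵘ.≃-trans (ℚ.toℚᵘ-homo-* (ι m) (ι n)) (ℚᵘ.*-cong (ιᵘ m) (ιᵘ n))))))

ι-mono-≤ : ∀ {m n} → m ℕ.≤ n → ι m ℚ.≤ ι n
ι-mono-≤ {m} {n} m≤n = ℚ.toℚᵘ-cancel-≤
  (ℚᵘ.≤-respʳ-≃ (ℚᵘ.≃-sym (ιᵘ n)) (ℚᵘ.≤-respˡ-≃ (ℚᵘ.≃-sym (ιᵘ m))
    (ℚᵘ.*≤* (ℤ.*-monoʳ-≤-nonNeg (ℤ.+ 1) (ℤ.+≤+ m≤n)))))

ι-cancel-≤ : ∀ {m n} → ι m ℚ.≤ ι n → m ℕ.≤ n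
ι-cancel-≤ {m} {n} le = ℤ.drop‿+≤+ (subst₂ ℤ._≤_ (ℤ.*-identityʳ _) (ℤ.*-identityʳ _)
  (ℚᵘ.drop-*≤* (ℚᵘ.≤-respʳ-≃ (ιᵘ n) (ℚᵘ.≤-respˡ-≃ (ιᵘ m) (ℚ.toℚᵘ-mono-≤ le)))))

0≤ι : ∀ n → 0ℚ ℚ.≤ ι n
0≤ι n = ι-mono-≤ {0} {n} ℕ.z≤n

module _ where
  open import Data.Rational using (_+_; _*_; _-_; _≤_; _<_)
  open ℚ.≤-Reasoning
  open +-*-Solver

  0≤q-p⇒p≤q : ∀ {p q} → 0ℚ ≤ q - p → p ≤ q
  0≤q-p⇒p≤q {p} {q} le = subst₂ _≤_ (ℚ.+-identityʳ p)
    (solve 2 (λ p q → p :+ (q :- p) := q) refl p q) (ℚ.+-monoʳ-≤ p le)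

  0≤* : ∀ {p q} → 0ℚ ≤ p → 0ℚ ≤ q → 0ℚ ≤ p * q
  0≤* {p} {q} 0≤p 0≤q = ℚ.nonNegative⁻¹ (p * q)
    {{ℚ.nonNeg*nonNeg⇒nonNeg p {{ℚ.nonNegative 0≤p}} q {{ℚ.nonNegative 0≤q}}}}

  0≤+ : ∀ {p q} → 0ℚ ≤ p → 0ℚ ≤ q → 0ℚ ≤ p + q
  0≤+ {p} {q} 0≤p 0≤q = subst (_≤ p + q) (ℚ.+-identityʳ 0ℚ) (ℚ.+-mono-≤ 0≤p 0≤q)

  0≤p² : ∀ p → 0ℚ ≤ p * p
  0≤p² p with ℚ.≤-total 0ℚ p
  ... | inj₁ 0≤p = 0≤* 0≤p 0≤p
  ... | inj₂ p≤0 = subst (0ℚ ≤_) (solve 1 (λ p → (:- p) :* (:- p) := p :* p) refl p)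
    (0≤* (ℚ.neg-antimono-≤ p≤0) (ℚ.neg-antimono-≤ p≤0))

  *-mono-≤-nonNeg : ∀ {p q r s} → 0ℚ ≤ p → 0ℚ ≤ s → p ≤ q → r ≤ s → p * r ≤ q * s
  *-mono-≤-nonNeg {p} {q} {r} {s} 0≤p 0≤s p≤q r≤s = begin
    p * r ≤⟨ ℚ.*-monoˡ-≤-nonNeg p {{ℚ.nonNegative 0≤p}} r≤s ⟩
    p * s ≤⟨ ℚ.*-monoʳ-≤-nonNeg s {{ℚ.nonNegative 0≤s}} p≤q ⟩
    q * s ∎

  ≤-by : ∀ {p q} c → 0ℚ ≤ c → c ≡ q - p → p ≤ q
  ≤-by c 0≤c eq = 0≤q-p⇒p≤q (subst (0ℚ ≤_) eq 0≤c)

  0≤1 : 0ℚ ≤ 1ℚ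
  0≤1 = ℚ.nonNegative⁻¹ 1ℚ

  -- The witness `e / (1 + e + c)` serves both bounds without a case distinction on `c`. It turns an
  -- error proportional to δ into a prescribed error `e`.
  smallFactor : ∀ c e → 0ℚ ≤ c → 0ℚ < e → ∃[ δ ] (0ℚ < δ × δ ≤ 1ℚ × c * δ ≤ e)
  smallFactor c e 0≤c 0<e = divide (1ℚ + e + c) refl
    (ℚ.pos+nonNeg⇒pos (1ℚ + e) {{ℚ.pos+pos⇒pos 1ℚ e {{ℚ.positive 0<e}}}} c {{ℚ.nonNegative 0≤c}})
    where
    0≤e = ℚ.<⇒≤ 0<e
    divide : ∀ D → D ≡ 1ℚ + e + c → ℚ.Positive D → ∃[ δ ] (0ℚ < δ × δ ≤ 1ℚ × c * δ ≤ e)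
    divide D D≡ posD = e * i , 0<δ , δ≤1 , cδ≤e
      where
      i : ℚ
      i = (ℚ.1/ D) {{ℚ.pos⇒nonZero D {{posD}}}}
      0<δ : 0ℚ < e * i
      0<δ = ℚ.positive⁻¹ (e * i) {{ℚ.pos*pos⇒pos e {{ℚ.positive 0<e}} i {{ℚ.1/pos⇒pos D {{posD}}}}}}
      0≤i : 0ℚ ≤ i
      0≤i = ℚ.nonNegative⁻¹ i {{ℚ.pos⇒nonNeg i {{ℚ.1/pos⇒pos D {{posD}}}}}}
      D*i≡1 : (1ℚ + e + c) * i ≡ 1ℚ
      D*i≡1 = trans (cong (_* i) (sym D≡)) (ℚ.*-inverseʳ D {{ℚ.pos⇒nonZero D {{posD}}}})
      cδ≤e : c * (e * i) ≤ e
      cδ≤e = ≤-by ((1ℚ + e) * (e * i)) (0≤* {1ℚ + e} {e * i} (0≤+ {1ℚ} {e} 0≤1 0≤e) (0≤* {e} {i} 0≤e 0≤i))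
        (trans (solve 3 (λ c e i → (con 1ℚ :+ e) :* (e :* i)
            := (con 1ℚ :+ e :+ c) :* i :* e :- c :* (e :* i)) refl c e i)
          (cong (_- c * (e * i)) (trans (cong (_* e) D*i≡1) (ℚ.*-identityˡ e))))
      δ≤1 : e * i ≤ 1ℚ
      δ≤1 = ≤-by ((1ℚ + c) * i) (0≤* {1ℚ + c} {i} (0≤+ {1ℚ} {c} 0≤1 0≤c) 0≤i)
        (trans (solve 3 (λ c e i → (con 1ℚ :+ c) :* i := (con 1ℚ :+ e :+ c) :* i :- e :* i) refl c e i)
          (cong (_- e * i) D*i≡1))

  -- If `q < p`, an error of half the gap contradicts the hypothesis. This is the way back from
  -- `_≤ℝ_` to rationals.
  ≤+e⇒≤ : ∀ {p q} c → 0ℚ ≤ c → (∀ e → 0ℚ < e → p ≤ q + c * e) → p ≤ q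
  ≤+e⇒≤ {p} {q} c 0≤c le with p ℚ.≤? q
  ... | yes p≤q = p≤q
  ... | no p≰q = contradiction refl
    (ℚ.<⇒≢ (ℚ.≤-<-trans (ℚ.≤-trans (le δ 0<δ) (ℚ.+-monoʳ-≤ q cδ≤g)) q+g<p))
    where
    q<p = ℚ.≰⇒> p≰q
    0<p-q : 0ℚ < p - q
    0<p-q = subst (_< p - q) (ℚ.+-inverseʳ q) (ℚ.+-monoˡ-< (ℚ.- q) q<p)
    g = ½ * (p - q)
    0<g : 0ℚ < g
    0<g = ℚ.positive⁻¹ g {{ℚ.pos*pos⇒pos ½ (p - q) {{ℚ.positive 0<p-q}}}}
    q+g<p : q + g < p
    q+g<p = begin-strict
      q + g        ≡⟨ solve 2 (λ q g → q :+ g := q :+ g :+ con 0ℚ) refl q g ⟩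
      q + g + 0ℚ   <⟨ ℚ.+-monoʳ-< (q + g) 0<g ⟩
      q + g + g    ≡⟨ solve 2 (λ p q → q :+ con ½ :* (p :- q) :+ con ½ :* (p :- q) := p) refl p q ⟩
      p            ∎
    sf = smallFactor c g 0≤c 0<g
    δ = proj₁ sf
    0<δ = proj₁ (proj₂ sf)
    cδ≤g = proj₂ (proj₂ (proj₂ sf))

eventually-× : ∀ {P Q : ℕ → Set} → Eventually P → Eventually Q → Eventually (λ n → P n × Q n)
eventually-× (M , p) (N , q) = M ℕ.⊔ N , λ n le →
  p n (ℕ.m⊔n≤o⇒m≤o M N le) , q n (ℕ.m⊔n≤o⇒n≤o M N le)

eventually-map : ∀ {P Q : ℕ → Set} → (∀ n → P n → Q n) → Eventually P → Eventually Q
eventually-map f (M , p) = M , λ n le → f n (p n le)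

eventually-const : ∀ {P : Set} → Eventually (λ _ → P) → P
eventually-const (M , p) = p M ℕ.≤-refl

module _ where
  open import Data.Rational using (_+_; _*_; _-_; _≤_; _<_)
  open ℚ.≤-Reasoning
  open +-*-Solver

  private
    halve : ∀ {e} → 0ℚ < e → 0ℚ < ½ * e
    halve {e} 0<e = ℚ.positive⁻¹ (½ * e) {{ℚ.pos*pos⇒pos ½ e {{ℚ.positive 0<e}}}}

  ≤ℝ-trans : ∀ {x y z} → x ≤ℝ y → y ≤ℝ z → x ≤ℝ z
  ≤ℝ-trans {x} {y} {z} x≤y y≤z e 0<e =
    eventually-map (λ n (p , q) → begin
      seq x n                       ≤⟨ p ⟩
      seq y n + ½ * e               ≤⟨ ℚ.+-monoˡ-≤ (½ * e) q ⟩
      seq z n + ½ * e + ½ * e       ≡⟨ solve 2 (λ z e → z :+ con ½ :* e :+ con ½ :* e := z :+ e) refl (seq z n) e ⟩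
      seq z n + e                   ∎)
      (eventually-× (x≤y (½ * e) (halve 0<e)) (y≤z (½ * e) (halve 0<e)))

  pointwise⇒≤ℝ : ∀ {x y} → Eventually (λ n → seq x n ≤ seq y n) → x ≤ℝ y
  pointwise⇒≤ℝ {x} {y} le e 0<e = eventually-map (λ n p → begin
    seq x n      ≡⟨ sym (ℚ.+-identityʳ (seq x n)) ⟩
    seq x n + 0ℚ ≤⟨ ℚ.+-mono-≤ p (ℚ.<⇒≤ 0<e) ⟩
    seq y n + e  ∎) le

  fromℚ-cancel-≤ : ∀ {p q} → fromℚ p ≤ℝ fromℚ q → p ≤ q
  fromℚ-cancel-≤ {p} {q} le = ≤+e⇒≤ 1ℚ (ℚ.nonNegative⁻¹ 1ℚ) λ e 0<e →
    subst (p ≤_) (cong (q +_) (sym (ℚ.*-identityˡ e))) (eventually-const (le e 0<e))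

  +ℝ-mono-≤ : ∀ {x y u v} → x ≤ℝ y → u ≤ℝ v → x +ℝ u ≤ℝ y +ℝ v
  +ℝ-mono-≤ {x} {y} {u} {v} x≤y u≤v e 0<e =
    eventually-map (λ n (p , q) → begin
      seq x n + seq u n                         ≤⟨ ℚ.+-mono-≤ p q ⟩
      (seq y n + ½ * e) + (seq v n + ½ * e)     ≡⟨ solve 3 (λ y v e → (y :+ con ½ :* e) :+ (v :+ con ½ :* e) := y :+ v :+ e) refl (seq y n) (seq v n) e ⟩
      seq y n + seq v n + e                     ∎)
      (eventually-× (x≤y (½ * e) (halve 0<e)) (u≤v (½ * e) (halve 0<e)))

  infix 4 _∈[0,_]

  -- Two-sided, because upper bounds multiply only for nonnegative factors. The radii and ε enter
  -- the geometry only through such bounds.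
  _∈[0,_] : ℝ → ℚ → Set
  x ∈[0, a ] = 0ℝ ≤ℝ x × x ≤ℝ fromℚ a

  ∈[0,]⇒0≤ : ∀ {x a} → x ∈[0, a ] → 0ℚ ≤ a
  ∈[0,]⇒0≤ {x} {a} (0≤x , x≤a) = fromℚ-cancel-≤ (≤ℝ-trans {0ℝ} {x} {fromℚ a} 0≤x x≤a)

  fromℚ-∈[0,] : ∀ {a} → 0ℚ ≤ a → fromℚ a ∈[0, a ]
  fromℚ-∈[0,] {a} 0≤a = pointwise⇒≤ℝ {0ℝ} {fromℚ a} (0 , λ _ _ → 0≤a)
                      , pointwise⇒≤ℝ {fromℚ a} {fromℚ a} (0 , λ _ _ → ℚ.≤-refl)

  weaken : ∀ {x a b} → a ≤ b → x ∈[0, a ] → x ∈[0, b ]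
  weaken {x} {a} {b} a≤b (0≤x , x≤a) =
    0≤x , ≤ℝ-trans {x} {fromℚ a} {fromℚ b} x≤a (pointwise⇒≤ℝ {fromℚ a} {fromℚ b} (0 , λ _ _ → a≤b))

  +-∈[0,] : ∀ {x y a b} → x ∈[0, a ] → y ∈[0, b ] → x +ℝ y ∈[0, a + b ]
  +-∈[0,] {x} {y} {a} {b} (0≤x , x≤a) (0≤y , y≤b) =
    +ℝ-mono-≤ {0ℝ} {x} {0ℝ} {y} 0≤x 0≤y , +ℝ-mono-≤ {x} {fromℚ a} {y} {fromℚ b} x≤a y≤b

  -- With slack δ in all bounds, both estimates come from
  -- 0 ≤ (x + δ)(y + δ) ≤ (a + 2δ)(b + 2δ).
  private
    nonneg : ∀ a b p q δ → 0ℚ ≤ δ → δ ≤ 1ℚ →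
      0ℚ ≤ p + δ → p ≤ a + δ → 0ℚ ≤ q + δ → q ≤ b + δ → 0ℚ ≤ p * q + (a + b + ι 3) * δ
    nonneg a b p q δ 0≤δ δ≤1 0≤p p≤a 0≤q q≤b = begin
      0ℚ                                 ≤⟨ 0≤* {p + δ} {q + δ} 0≤p 0≤q ⟩
      (p + δ) * (q + δ)                  ≡⟨ solve 3 (λ p q δ → (p :+ δ) :* (q :+ δ) := p :* q :+ (p :+ q :+ δ) :* δ) refl p q δ ⟩
      p * q + (p + q + δ) * δ            ≤⟨ ℚ.+-monoʳ-≤ (p * q) (ℚ.*-monoʳ-≤-nonNeg δ {{ℚ.nonNegative 0≤δ}} (begin
        p + q + δ                          ≤⟨ ℚ.+-monoˡ-≤ δ (ℚ.+-mono-≤ p≤a q≤b) ⟩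
        a + δ + (b + δ) + δ                ≡⟨ solve 3 (λ a b δ → a :+ δ :+ (b :+ δ) :+ δ := a :+ b :+ (δ :+ δ :+ δ)) refl a b δ ⟩
        a + b + (δ + δ + δ)                ≤⟨ ℚ.+-monoʳ-≤ (a + b) (ℚ.+-mono-≤ (ℚ.+-mono-≤ δ≤1 δ≤1) δ≤1) ⟩
        a + b + ι 3                        ∎)) ⟩
      p * q + (a + b + ι 3) * δ          ∎

    bounded : ∀ a b p q δ → 0ℚ ≤ b → 0ℚ ≤ δ → δ ≤ 1ℚ →
      0ℚ ≤ p + δ → p ≤ a + δ → 0ℚ ≤ q + δ → q ≤ b + δ →
      p * q ≤ a * b + ((a + b + ι 3) + (a + b + ι 3)) * δ
    bounded a b p q δ 0≤b 0≤δ δ≤1 0≤p p≤a 0≤q q≤b = begin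
      p * q                                       ≡⟨ sym (ℚ.+-identityʳ (p * q)) ⟩
      p * q + 0ℚ                                  ≤⟨ ℚ.+-monoʳ-≤ (p * q) (0≤* {δ} {(p + δ) + (q + δ)} 0≤δ (0≤+ {p + δ} {q + δ} 0≤p 0≤q)) ⟩
      p * q + δ * ((p + δ) + (q + δ))             ≡⟨ solve 3 (λ p q δ → p :* q :+ δ :* ((p :+ δ) :+ (q :+ δ)) := (p :+ δ) :* (q :+ δ) :+ δ :* δ) refl p q δ ⟩
      (p + δ) * (q + δ) + δ * δ                   ≤⟨ ℚ.+-monoˡ-≤ (δ * δ) (*-mono-≤-nonNeg 0≤p (0≤+ {b + δ} {δ} (0≤+ {b} {δ} 0≤b 0≤δ) 0≤δ)
                                                       (ℚ.+-monoˡ-≤ δ p≤a) (ℚ.+-monoˡ-≤ δ q≤b)) ⟩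
      (a + δ + δ) * (b + δ + δ) + δ * δ           ≡⟨ solve 3 (λ a b δ → (a :+ δ :+ δ) :* (b :+ δ :+ δ) :+ δ :* δ
                                                       := a :* b :+ ((a :+ b) :+ (a :+ b) :+ (δ :+ δ :+ δ :+ δ :+ δ)) :* δ) refl a b δ ⟩
      a * b + ((a + b) + (a + b) + (δ + δ + δ + δ + δ)) * δ
        ≤⟨ ℚ.+-monoʳ-≤ (a * b) (ℚ.*-monoʳ-≤-nonNeg δ {{ℚ.nonNegative 0≤δ}} (ℚ.+-monoʳ-≤ ((a + b) + (a + b)) (begin
          δ + δ + δ + δ + δ   ≤⟨ ℚ.+-mono-≤ (ℚ.+-mono-≤ (ℚ.+-mono-≤ (ℚ.+-mono-≤ δ≤1 δ≤1) δ≤1) δ≤1) δ≤1 ⟩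
          ι 5                 ≤⟨ ι-mono-≤ (ℕ.n≤1+n 5) ⟩
          ι 6                 ∎))) ⟩
      a * b + ((a + b) + (a + b) + ι 6) * δ
        ≡⟨ cong (λ c → a * b + c * δ) (solve 2 (λ c t → c :+ c :+ (t :+ t) := (c :+ t) :+ (c :+ t)) refl (a + b) (ι 3)) ⟩
      a * b + ((a + b + ι 3) + (a + b + ι 3)) * δ ∎

  *-∈[0,] : ∀ {x y a b} → x ∈[0, a ] → y ∈[0, b ] → x *ℝ y ∈[0, a * b ]
  *-∈[0,] {x} {y} {a} {b} x∈@(0≤x , x≤a) y∈@(0≤y , y≤b) = lower , upper
    where
    0≤a = ∈[0,]⇒0≤ {x} x∈
    0≤b = ∈[0,]⇒0≤ {y} y∈
    c = a + b + ι 3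
    0≤c : 0ℚ ≤ c
    0≤c = 0≤+ {a + b} {ι 3} (0≤+ {a} {b} 0≤a 0≤b) (0≤ι 3)
    slack : ∀ δ → 0ℚ < δ → Eventually λ n →
      (0ℚ ≤ seq x n + δ × seq x n ≤ a + δ) × (0ℚ ≤ seq y n + δ × seq y n ≤ b + δ)
    slack δ 0<δ = eventually-× (eventually-× (0≤x δ 0<δ) (x≤a δ 0<δ))
                               (eventually-× (0≤y δ 0<δ) (y≤b δ 0<δ))
    lower : 0ℝ ≤ℝ x *ℝ y
    lower e 0<e = let δ , 0<δ , δ≤1 , cδ≤e = smallFactor c e 0≤c 0<e in
      eventually-map (λ n ((p , q) , (r , s)) →
        ℚ.≤-trans (nonneg a b (seq x n) (seq y n) δ (ℚ.<⇒≤ 0<δ) δ≤1 p q r s)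
          (ℚ.+-monoʳ-≤ (seq x n * seq y n) cδ≤e)) (slack δ 0<δ)
    upper : x *ℝ y ≤ℝ fromℚ (a * b)
    upper e 0<e = let δ , 0<δ , δ≤1 , cδ≤e = smallFactor (c + c) e (0≤+ {c} {c} 0≤c 0≤c) 0<e in
      eventually-map (λ n ((p , q) , (r , s)) →
        ℚ.≤-trans (bounded a b (seq x n) (seq y n) δ 0≤b (ℚ.<⇒≤ 0<δ) δ≤1 p q r s)
          (ℚ.+-monoʳ-≤ (a * b) cδ≤e)) (slack δ 0<δ)

-- Squared distances of integer points

Coord : ℕ → Set
Coord d = Fin d → ℕ

coord : ∀ {d Δ} → Point d Δ → Coord d
coord p i = toℕ (Vec.lookup p i)

-- Shifted like embed, so that embed p is embedCoord (coord p).
embedCoord : ∀ {d} → Coord d → ℝ^ d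
embedCoord x i = fromℕ (suc (x i))

D : ∀ {d} → Coord d → Coord d → ℕ
D x y = VecF.foldr ℕ._+_ 0 (λ i → ℕ.∣ x i - y i ∣ ℕ.^ 2)

module _ where
  open import Data.Rational using (_+_; _*_; _-_; _≤_; _<_)
  open ℚ.≤-Reasoning
  open +-*-Solver

  private
    sq : ℚ → ℚ
    sq p = p * (p * 1ℚ)

    ι-^2 : ∀ n → ι (n ℕ.^ 2) ≡ sq (ι n)
    ι-^2 n = trans (ι-* n (n ℕ.* 1)) (cong (ι n *_) (ι-* n 1))

    ι-difference : ∀ m n → sq (ι m - ι n) ≡ ι (ℕ.∣ m - n ∣ ℕ.^ 2)
    ι-difference m n with ℕ.≤-total m n
    ... | inj₁ m≤n with a , refl ← ℕ.m≤n⇒∃[o]m+o≡n m≤n = begin-equality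
      sq (ι m - ι (m ℕ.+ a))   ≡⟨ cong (λ p → sq (ι m - p)) (ι-+ m a) ⟩
      sq (ι m - (ι m + ι a))   ≡⟨ solve 2 (λ m a → (m :- (m :+ a)) :* ((m :- (m :+ a)) :* con 1ℚ)
                                    := a :* (a :* con 1ℚ)) refl (ι m) (ι a) ⟩
      sq (ι a)                 ≡⟨ sym (ι-^2 a) ⟩
      ι (a ℕ.^ 2)              ≡⟨ cong (λ k → ι (k ℕ.^ 2)) (sym (ℕ.∣m-m+n∣≡n m a)) ⟩
      ι (ℕ.∣ m - m ℕ.+ a ∣ ℕ.^ 2) ∎
    ... | inj₂ n≤m with a , refl ← ℕ.m≤n⇒∃[o]m+o≡n n≤m = begin-equality
      sq (ι (n ℕ.+ a) - ι n)   ≡⟨ cong (λ p → sq (p - ι n)) (ι-+ n a) ⟩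
      sq ((ι n + ι a) - ι n)   ≡⟨ solve 2 (λ n a → ((n :+ a) :- n) :* (((n :+ a) :- n) :* con 1ℚ)
                                    := a :* (a :* con 1ℚ)) refl (ι n) (ι a) ⟩
      sq (ι a)                 ≡⟨ sym (ι-^2 a) ⟩
      ι (a ℕ.^ 2)              ≡⟨ cong (λ k → ι (k ℕ.^ 2)) (sym (trans (ℕ.∣-∣-comm (n ℕ.+ a) n) (ℕ.∣m-m+n∣≡n n a))) ⟩
      ι (ℕ.∣ n ℕ.+ a - n ∣ ℕ.^ 2) ∎

  seq-sqDist : ∀ {d} (x y : Coord d) n → seq (sqDist (embedCoord x) (embedCoord y)) n ≡ ι (D x y)
  seq-sqDist {zero}  x y n = refl
  seq-sqDist {suc d} x y n = trans
    (cong₂ _+_ (ι-difference (suc (x Fin.zero)) (suc (y Fin.zero))) (seq-sqDist (x ∘ Fin.suc) (y ∘ Fin.suc) n))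
    (sym (ι-+ (ℕ.∣ x Fin.zero - y Fin.zero ∣ ℕ.^ 2) (D (x ∘ Fin.suc) (y ∘ Fin.suc))))

  D≤r²⇒∈b : ∀ {d} (x c : Coord d) r → D x c ℕ.≤ r ℕ.^ 2 → embedCoord x ∈b⟨ embedCoord c , fromℕ r ⟩
  D≤r²⇒∈b x c r D≤r² = proj₁ (fromℚ-∈[0,] {ι r} (0≤ι r))
    , pointwise⇒≤ℝ {sqDist (embedCoord x) (embedCoord c)} {fromℕ r ^ℝ 2} (0 , λ n _ → begin
        seq (sqDist (embedCoord x) (embedCoord c)) n ≡⟨ seq-sqDist x c n ⟩
        ι (D x c)   ≤⟨ ι-mono-≤ D≤r² ⟩
        ι (r ℕ.^ 2) ≡⟨ ι-^2 r ⟩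
        sq (ι r)    ∎)

  private
    fromℚ-D≤ℝ : ∀ {d} (x y : Coord d) → fromℚ (ι (D x y)) ≤ℝ sqDist (embedCoord x) (embedCoord y)
    fromℚ-D≤ℝ x y = pointwise⇒≤ℝ {fromℚ (ι (D x y))} {sqDist (embedCoord x) (embedCoord y)}
      (0 , λ n _ → ℚ.≤-reflexive (sym (seq-sqDist x y n)))

    ρ²≤ : ∀ {ρ g} → ρ ∈[0, ι g ] → ρ ^ℝ 2 ≤ℝ fromℚ (ι (g ℕ.^ 2))
    ρ²≤ {ρ} {g} ρ∈ = subst (λ q → ρ ^ℝ 2 ≤ℝ fromℚ q) (sym (ι-^2 g))
      (proj₂ (*-∈[0,] {ρ} {ρ *ℝ 1ℝ} {ι g} {ι g * 1ℚ} ρ∈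
        (*-∈[0,] {ρ} {1ℝ} {ι g} {1ℚ} ρ∈ (fromℚ-∈[0,] {1ℚ} 0≤1))))

    -- In each coordinate the difference of the two sides is the square of x + y - 2c. This replaces
    -- the triangle inequality, which would need square roots of reals.
    parallelogram : ∀ {d} (x y c : ℝ^ d) n → let s = seq (sqDist x c) n + seq (sqDist y c) n in
      seq (sqDist x y) n ≤ s + s
    parallelogram {zero}  x y c n = ℚ.≤-refl
    parallelogram {suc d} x y c n = begin
      sq (p - q) + seq (sqDist (x ∘ Fin.suc) (y ∘ Fin.suc)) n
        ≤⟨ ℚ.+-mono-≤ one (parallelogram (x ∘ Fin.suc) (y ∘ Fin.suc) (c ∘ Fin.suc) n) ⟩
      ((a + b) + (a + b)) + ((A + B) + (A + B))
        ≡⟨ solve 4 (λ a b A B → ((a :+ b) :+ (a :+ b)) :+ ((A :+ B) :+ (A :+ B))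
             := ((a :+ A) :+ (b :+ B)) :+ ((a :+ A) :+ (b :+ B))) refl a b A B ⟩
      ((a + A) + (b + B)) + ((a + A) + (b + B)) ∎
      where
      p = seq (x Fin.zero) n
      q = seq (y Fin.zero) n
      r = seq (c Fin.zero) n
      a = sq (p - r)
      b = sq (q - r)
      A = seq (sqDist (x ∘ Fin.suc) (c ∘ Fin.suc)) n
      B = seq (sqDist (y ∘ Fin.suc) (c ∘ Fin.suc)) n
      one : sq (p - q) ≤ (a + b) + (a + b)
      one = ≤-by ((p + q - (r + r)) * (p + q - (r + r))) (0≤p² (p + q - (r + r)))
        (solve 3 (λ p q r → (p :+ q :- (r :+ r)) :* (p :+ q :- (r :+ r)) :=
          (((p :- r) :* ((p :- r) :* con 1ℚ) :+ (q :- r) :* ((q :- r) :* con 1ℚ))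
          :+ ((p :- r) :* ((p :- r) :* con 1ℚ) :+ (q :- r) :* ((q :- r) :* con 1ℚ)))
          :- (p :- q) :* ((p :- q) :* con 1ℚ)) refl p q r)

  ∈b⇒sqDist≤ : ∀ {d} {x c : ℝ^ d} {ρ} g → ρ ∈[0, ι g ] → x ∈b⟨ c , ρ ⟩ → sqDist x c ≤ℝ fromℚ (ι (g ℕ.^ 2))
  ∈b⇒sqDist≤ {x = x} {c} {ρ} g ρ∈ (_ , le) =
    ≤ℝ-trans {sqDist x c} {ρ ^ℝ 2} {fromℚ (ι (g ℕ.^ 2))} le (ρ²≤ {ρ} {g} ρ∈)

  ∈b⇒D≤g² : ∀ {d} (x c : Coord d) {ρ} g → ρ ∈[0, ι g ] →
    embedCoord x ∈b⟨ embedCoord c , ρ ⟩ → D x c ℕ.≤ g ℕ.^ 2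
  ∈b⇒D≤g² x c {ρ} g ρ∈ x∈b = ι-cancel-≤ (fromℚ-cancel-≤
    (≤ℝ-trans {fromℚ (ι (D x c))} {sqDist (embedCoord x) (embedCoord c)} {fromℚ (ι (g ℕ.^ 2))} (fromℚ-D≤ℝ x c)
      (∈b⇒sqDist≤ {x = embedCoord x} {embedCoord c} {ρ} g ρ∈ x∈b)))

  -- The centres of an optimal solution are arbitrary real points; this eliminates them in favour of
  -- a statement about two grid points.
  D≤4g² : ∀ {d} (x y : Coord d) (c : ℝ^ d) g →
    sqDist (embedCoord x) c ≤ℝ fromℚ (ι (g ℕ.^ 2)) → sqDist (embedCoord y) c ≤ℝ fromℚ (ι (g ℕ.^ 2)) →
    D x y ℕ.≤ 4 ℕ.* g ℕ.^ 2
  D≤4g² x y c g x≤ y≤ = ι-cancel-≤ (fromℚ-cancel-≤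
    (≤ℝ-trans {fromℚ (ι (D x y))} {sxy} {fromℚ (ι (4 ℕ.* G))} (fromℚ-D≤ℝ x y)
      (≤ℝ-trans {sxy} {(sx +ℝ sy) +ℝ (sx +ℝ sy)} {fromℚ (ι (4 ℕ.* G))}
        (pointwise⇒≤ℝ {sxy} {(sx +ℝ sy) +ℝ (sx +ℝ sy)} (0 , λ n _ → parallelogram (embedCoord x) (embedCoord y) c n))
        (subst (λ q → (sx +ℝ sy) +ℝ (sx +ℝ sy) ≤ℝ fromℚ q) sum≡ (+ℝ-mono-≤ {sx +ℝ sy} {γ +ℝ γ} {sx +ℝ sy} {γ +ℝ γ} both both)))))
    where
    G = g ℕ.^ 2
    γ = fromℚ (ι G)
    sxy = sqDist (embedCoord x) (embedCoord y)
    sx = sqDist (embedCoord x) c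
    sy = sqDist (embedCoord y) c
    both : sx +ℝ sy ≤ℝ γ +ℝ γ
    both = +ℝ-mono-≤ {sx} {γ} {sy} {γ} x≤ y≤
    sum≡ : (ι G + ι G) + (ι G + ι G) ≡ ι (4 ℕ.* G)
    sum≡ = trans (solve 1 (λ a → (a :+ a) :+ (a :+ a) := con (ι 4) :* a) refl (ι G)) (sym (ι-* 4 G))

-- The number of cells per axis

inv : (n : ℕ) .{{_ : ℕ.NonZero n}} → ℚ
inv n = ℤ.+ 1 ℚ./ n

module _ where
  open import Data.Rational using (_+_; _*_; _-_; _≤_; _<_)
  open ℚ.≤-Reasoning
  open +-*-Solver

  ι*inv : ∀ n .{{_ : ℕ.NonZero n}} → ι n * inv n ≡ 1ℚ
  ι*inv (suc n) = ℚ.toℚᵘ-injective (ℚᵘ.≃-trans (ℚ.toℚᵘ-homo-* (ι (suc n)) (inv (suc n)))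
    (ℚᵘ.≃-trans (ℚᵘ.*-cong (ℚ.toℚᵘ-fromℚᵘ (ℚᵘ.mkℚᵘ (ℤ.+ suc n) 0)) (ℚ.toℚᵘ-fromℚᵘ (ℚᵘ.mkℚᵘ (ℤ.+ 1) n)))
      (ℚᵘ.*≡* (trans (ℤ.*-identityʳ (ℤ.+ suc n ℤ.* ℤ.+ 1)) (trans (ℤ.*-identityʳ (ℤ.+ suc n))
        (cong (λ m → ℤ.+ suc m) (trans (sym (ℕ.+-identityʳ n)) (sym (ℕ.+-identityʳ (n ℕ.+ 0))))))))))

  0<inv : ∀ n .{{_ : ℕ.NonZero n}} → 0ℚ < inv n
  0<inv n = ℚ.positive⁻¹ (inv n) {{ℚ.normalize-pos 1 n}}

  0≤inv : ∀ n .{{_ : ℕ.NonZero n}} → 0ℚ ≤ inv n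
  0≤inv n = ℚ.<⇒≤ (0<inv n)

  inv≤ : ∀ m n .{{_ : ℕ.NonZero m}} .{{_ : ℕ.NonZero n}} → n ℕ.≤ m → inv m ≤ inv n
  inv≤ m n n≤m = begin
    inv m                   ≡⟨ sym (ℚ.*-identityʳ (inv m)) ⟩
    inv m * 1ℚ              ≡⟨ cong (inv m *_) (sym (ι*inv n)) ⟩
    inv m * (ι n * inv n)   ≡⟨ sym (ℚ.*-assoc (inv m) (ι n) (inv n)) ⟩
    inv m * ι n * inv n     ≤⟨ ℚ.*-monoʳ-≤-nonNeg (inv n) {{ℚ.nonNegative (0≤inv n)}}
                                 (ℚ.*-monoˡ-≤-nonNeg (inv m) {{ℚ.nonNegative (0≤inv m)}} (ι-mono-≤ n≤m)) ⟩
    inv m * ι m * inv n     ≡⟨ cong (_* inv n) (trans (ℚ.*-comm (inv m) (ι m)) (ι*inv m)) ⟩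
    1ℚ * inv n              ≡⟨ ℚ.*-identityˡ (inv n) ⟩
    inv n                   ∎

  p≤∣p∣ : ∀ p → p ≤ ℚ.∣ p ∣
  p≤∣p∣ p with ℚ.≤-total 0ℚ p
  ... | inj₁ 0≤p = ℚ.≤-reflexive (sym (ℚ.0≤p⇒∣p∣≡p 0≤p))
  ... | inj₂ p≤0 = ℚ.≤-trans p≤0 (ℚ.0≤∣p∣ p)

  archimedean : ∀ p → p ≤ ι ℤ.∣ ℚ.↥ p ∣
  archimedean p@(ℚ.mkℚ i d-1 _) = ℚ.toℚᵘ-cancel-≤ (ℚᵘ.≤-respʳ-≃
    (ℚᵘ.≃-sym (ℚ.toℚᵘ-fromℚᵘ (ℚᵘ.mkℚᵘ (ℤ.+ ℤ.∣ ℚ.↥ p ∣) 0))) (ℚᵘ.*≤* (numerator i d-1)))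
    where
    numerator : ∀ i d → i ℤ.* ℤ.+ 1 ℤ.≤ ℤ.+ ℤ.∣ i ∣ ℤ.* ℤ.+ suc d
    numerator (ℤ.+ n) d = subst₂ ℤ._≤_ (sym (ℤ.*-identityʳ (ℤ.+ n))) (ℤ.pos-* n (suc d))
      (ℤ.+≤+ (ℕ.m≤m*n n (suc d)))
    numerator ℤ.-[1+ n ] d = subst₂ ℤ._≤_ (sym (ℤ.*-identityʳ ℤ.-[1+ n ])) (ℤ.pos-* (suc n) (suc d)) ℤ.-≤+

  floor : ∀ p → 0ℚ ≤ p → ∃[ n ] (ι n ≤ p × p ≤ ι (suc n))
  floor p 0≤p = search ℤ.∣ ℚ.↥ p ∣ (archimedean p)
    where
    search : ∀ m → p ≤ ι m → ∃[ n ] (ι n ≤ p × p ≤ ι (suc n))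
    search zero    p≤ = 0 , 0≤p , ℚ.≤-trans p≤ (0≤ι 1)
    search (suc m) p≤ with ℚ.≤-total (ι m) p
    ... | inj₁ m≤p = m , m≤p , p≤
    ... | inj₂ p≤m = search m p≤m

  module _ (d′ : ℕ) where

    private
      d = suc d′

      -- `suc N` is the larger of 1 and the quotient of `E` by 8 d. With `E` the integer part of an
      -- approximation of 1 / ε, the first bound makes 1 / ε at most 24 d N cells' worth, where the
      -- 2 pays for approximating and rounding. The second keeps N small enough for `β`.
      gridSize : ∀ E → ∃[ N ] (E ℕ.+ 2 ℕ.≤ 24 ℕ.* (d ℕ.* suc N) × (N ≡ 0 ⊎ 8 ℕ.* (d ℕ.* suc N) ℕ.≤ E))
      gridSize E = choose (E ℕ./ (8 ℕ.* d)) (ℕ.m/n*n≤m E (8 ℕ.* d)) E+2≤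
        where
        E+2≤ : E ℕ.+ 2 ℕ.≤ 1 ℕ.+ (8 ℕ.* d ℕ.+ E ℕ./ (8 ℕ.* d) ℕ.* (8 ℕ.* d))
        E+2≤ = ℕ.≤-trans (ℕ.≤-reflexive (ℕ.+-comm E 2)) (ℕ.s≤s (subst (λ m → suc m ℕ.≤ 8 ℕ.* d ℕ.+ q) (sym (ℕ.m≡m%n+[m/n]*n E (8 ℕ.* d)))
          (ℕ.+-monoˡ-≤ q (ℕ.m%n<n E (8 ℕ.* d)))))
          where q = E ℕ./ (8 ℕ.* d) ℕ.* (8 ℕ.* d)
        choose : ∀ q → q ℕ.* (8 ℕ.* d) ℕ.≤ E → E ℕ.+ 2 ℕ.≤ 1 ℕ.+ (8 ℕ.* d ℕ.+ q ℕ.* (8 ℕ.* d)) →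
          ∃[ N ] (E ℕ.+ 2 ℕ.≤ 24 ℕ.* (d ℕ.* suc N) × (N ≡ 0 ⊎ 8 ℕ.* (d ℕ.* suc N) ℕ.≤ E))
        choose zero    _  E≤ = 0 , ℕ.≤-trans E≤ (subst (1 ℕ.+ (8 ℕ.* d ℕ.+ 0) ℕ.≤_) (eq d′) (ℕ.m≤m+n _ (15 ℕ.+ 16 ℕ.* d′))) , inj₁ refl
          where
          eq : ∀ d′ → 1 ℕ.+ (8 ℕ.* suc d′ ℕ.+ 0) ℕ.+ (15 ℕ.+ 16 ℕ.* d′) ≡ 24 ℕ.* (suc d′ ℕ.* 1)
          eq = solve-∀
        choose (suc q) ≤E E≤ = q , ℕ.≤-trans E≤ (subst (1 ℕ.+ (8 ℕ.* d ℕ.+ suc q ℕ.* (8 ℕ.* d)) ℕ.≤_) (eq d′ q) (ℕ.m≤m+n _ (7 ℕ.+ 8 ℕ.* d′ ℕ.+ 16 ℕ.* (d ℕ.* q))))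
          , inj₂ (subst (ℕ._≤ E) (eq′ d q) ≤E)
          where
          eq : ∀ d′ q → 1 ℕ.+ (8 ℕ.* suc d′ ℕ.+ suc q ℕ.* (8 ℕ.* suc d′)) ℕ.+ (7 ℕ.+ 8 ℕ.* d′ ℕ.+ 16 ℕ.* (suc d′ ℕ.* q)) ≡ 24 ℕ.* (suc d′ ℕ.* suc q)
          eq = solve-∀
          eq′ : ∀ d q → suc q ℕ.* (8 ℕ.* d) ≡ 8 ℕ.* (d ℕ.* suc q)
          eq′ = solve-∀

    -- The number N = 1 + N′ of cells per axis is about 1 / (8 d ε), so that
    -- ε ≤ 9 / (64 d N).
    β : ℕ → ℚ
    β N′ = inv (8 ℕ.* (d ℕ.* suc N′)) * (ℤ.+ 9 ℚ./ 8)

    module _ (ε x : ℝ) (0<ε : 0ℝ <ℝ ε) (εx≃1 : ε *ℝ x ≃ℝ 1ℝ) (ε≤ : ε ≤ℝ fromℚ (inv (8 ℕ.* d))) where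

      private
        0≤ε : Eventually λ n → 0ℚ ≤ seq ε n
        0≤ε = let e , 0<e , ev = 0<ε in eventually-map
          (λ n le → ℚ.≤-trans (ℚ.<⇒≤ 0<e) (subst (_≤ seq ε n) (ℚ.+-identityˡ e) le)) ev

        -- Eventually `ε x ≥ ½` with `ε ≥ 0`, which excludes negative `x`.
        0≤x : Eventually λ n → 0ℚ ≤ seq x n
        0≤x = eventually-map (λ n (0≤εₙ , le) → nonneg (seq ε n) (seq x n) 0≤εₙ le)
          (eventually-× 0≤ε (proj₂ εx≃1 ½ (ℚ.positive⁻¹ ½)))
          where
          nonneg : ∀ p q → 0ℚ ≤ p → 1ℚ ≤ p * q + ½ → 0ℚ ≤ q
          nonneg p q 0≤p le with ℚ.≤-total 0ℚ q
          ... | inj₁ 0≤q = 0≤q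
          ... | inj₂ q≤0 = contradiction (begin
            1ℚ          ≤⟨ le ⟩
            p * q + ½   ≤⟨ ℚ.+-monoˡ-≤ ½ (ℚ.*-monoˡ-≤-nonNeg p {{ℚ.nonNegative 0≤p}} q≤0) ⟩
            p * 0ℚ + ½  ≡⟨ cong (_+ ½) (ℚ.*-zeroʳ p) ⟩
            0ℚ + ½      ∎) (from-no (1ℚ ℚ.≤? (0ℚ + ½)))

        -- From this index on the approximations of 1 / ε are nonnegative and within 1 of `x̄`. The
        -- integer part is taken of this rational, since that of a real is not computable.
        n₁ : ℕ
        n₁ = proj₁ 0≤x ℕ.⊔ proj₁ (cauchy x 1ℚ (ℚ.positive⁻¹ 1ℚ))

        x̄ : ℚ
        x̄ = seq x n₁

        0≤x̄ : 0ℚ ≤ x̄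
        0≤x̄ = proj₂ 0≤x n₁ (ℕ.m≤m⊔n _ _)

        close : Eventually λ n → seq x n ≤ x̄ + 1ℚ × x̄ ≤ seq x n + 1ℚ
        close = n₁ , λ n n₁≤n →
            near (seq x n) x̄ (proj₂ (cauchy x 1ℚ (ℚ.positive⁻¹ 1ℚ)) n n₁ (ℕ.≤-trans (ℕ.m≤n⊔m _ _) n₁≤n) (ℕ.m≤n⊔m _ _))
          , near x̄ (seq x n) (proj₂ (cauchy x 1ℚ (ℚ.positive⁻¹ 1ℚ)) n₁ n (ℕ.m≤n⊔m _ _) (ℕ.≤-trans (ℕ.m≤n⊔m _ _) n₁≤n))
          where
          near : ∀ p q → ℚ.∣ p - q ∣ < 1ℚ → p ≤ q + 1ℚ
          near p q lt = begin
            p             ≡⟨ solve 2 (λ p q → p := q :+ (p :- q)) refl p q ⟩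
            q + (p - q)   ≤⟨ ℚ.+-monoʳ-≤ q (ℚ.≤-trans (p≤∣p∣ (p - q)) (ℚ.<⇒≤ lt)) ⟩
            q + 1ℚ        ∎

        E : ∃[ n ] (ι n ≤ x̄ × x̄ ≤ ι (suc n))
        E = floor x̄ 0≤x̄

        grid = gridSize (proj₁ E)

      N′ : ℕ
      N′ = proj₁ grid

      private
        N = suc N′
        m = 8 ℕ.* (d ℕ.* N)

        m≤x+1 : m ℕ.≤ proj₁ E → Eventually λ n → ι m ≤ seq x n + 1ℚ
        m≤x+1 le = eventually-map (λ n (_ , x̄≤) → ℚ.≤-trans (ι-mono-≤ le) (ℚ.≤-trans (proj₁ (proj₂ E)) x̄≤)) close

      x∈ : x ∈[0, ι (24 ℕ.* (d ℕ.* suc N′)) ]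
      x∈ = pointwise⇒≤ℝ {0ℝ} {x} 0≤x , pointwise⇒≤ℝ {x} {fromℚ (ι (24 ℕ.* (d ℕ.* N)))} (eventually-map (λ n (x≤ , _) → begin
        seq x n                      ≤⟨ x≤ ⟩
        x̄ + 1ℚ                       ≤⟨ ℚ.+-monoˡ-≤ 1ℚ (proj₂ (proj₂ E)) ⟩
        ι (suc (proj₁ E)) + ι 1      ≡⟨ sym (ι-+ (suc (proj₁ E)) 1) ⟩
        ι (suc (proj₁ E) ℕ.+ 1)      ≡⟨ cong ι (sym (ℕ.+-suc (proj₁ E) 1)) ⟩
        ι (proj₁ E ℕ.+ 2)            ≤⟨ ι-mono-≤ (proj₁ (proj₂ grid)) ⟩
        ι (24 ℕ.* (d ℕ.* N))         ∎) close)

      -- Links N to the hypothesis on Δ, where the factor 1 / (4 ε) + d is squared.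
      dN≤ : Eventually λ n → ι (d ℕ.* suc N′) ≤ (ℤ.+ 1 ℚ./ 4) * seq x n + ι d
      dN≤ = split (proj₂ (proj₂ grid))
        where
        ⅛ = ℤ.+ 1 ℚ./ 8
        bound : ∀ q → 0ℚ ≤ q → ι m ≤ q + 1ℚ → ι (d ℕ.* N) ≤ (ℤ.+ 1 ℚ./ 4) * q + ι d
        bound q 0≤q le = begin
          ι (d ℕ.* N)               ≡⟨ sym (ℚ.*-identityˡ (ι (d ℕ.* N))) ⟩
          ⅛ * ι 8 * ι (d ℕ.* N)     ≡⟨ ℚ.*-assoc ⅛ (ι 8) (ι (d ℕ.* N)) ⟩
          ⅛ * (ι 8 * ι (d ℕ.* N))   ≡⟨ cong (⅛ *_) (sym (ι-* 8 (d ℕ.* N))) ⟩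
          ⅛ * ι m                   ≤⟨ ℚ.*-monoˡ-≤-nonNeg ⅛ le ⟩
          ⅛ * (q + 1ℚ)              ≡⟨ ℚ.*-distribˡ-+ ⅛ q 1ℚ ⟩
          ⅛ * q + ⅛ * 1ℚ            ≤⟨ ℚ.+-mono-≤ (ℚ.*-monoʳ-≤-nonNeg q {{ℚ.nonNegative 0≤q}} (from-yes (⅛ ℚ.≤? (ℤ.+ 1 ℚ./ 4))))
                                                  (ℚ.≤-trans (from-yes (⅛ * 1ℚ ℚ.≤? ι 1)) (ι-mono-≤ (ℕ.s≤s (ℕ.z≤n {d′})))) ⟩
          (ℤ.+ 1 ℚ./ 4) * q + ι d   ∎
        split : N′ ≡ 0 ⊎ m ℕ.≤ proj₁ E → Eventually λ n → ι (d ℕ.* N) ≤ (ℤ.+ 1 ℚ./ 4) * seq x n + ι d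
        split (inj₁ N′≡0) = eventually-map (λ n 0≤q → begin
          ι (d ℕ.* N)                       ≡⟨ cong ι (trans (cong (λ N′ → d ℕ.* suc N′) N′≡0) (ℕ.*-identityʳ d)) ⟩
          ι d                               ≡⟨ sym (ℚ.+-identityˡ (ι d)) ⟩
          0ℚ + ι d                          ≤⟨ ℚ.+-monoˡ-≤ (ι d) (0≤* {ℤ.+ 1 ℚ./ 4} {seq x n} (ℚ.nonNegative⁻¹ (ℤ.+ 1 ℚ./ 4)) 0≤q) ⟩
          (ℤ.+ 1 ℚ./ 4) * seq x n + ι d     ∎) 0≤x
        split (inj₂ le) = eventually-map (λ n (0≤q , m≤) → bound (seq x n) 0≤q m≤) (eventually-× 0≤x (m≤x+1 le))

      ε∈⅛ : ε ∈[0, ℤ.+ 1 ℚ./ 8 ]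
      ε∈⅛ = weaken {ε} {inv (8 ℕ.* d)} {inv 8} (inv≤ (8 ℕ.* d) 8 (ℕ.m≤m*n 8 d)) (pointwise⇒≤ℝ {0ℝ} {ε} 0≤ε , ε≤)

      -- For `m = 8 d N ≤ 1 / ε + 1` one has `m ε ≤ 1 + ε ≤ 9 / 8`. In the case `N = 1` the assumed
      -- bound 1 / (8 d) on ε is already stronger.
      ε∈β : ε ∈[0, β N′ ]
      ε∈β = split (proj₂ (proj₂ grid))
        where
        9/8 = ℤ.+ 9 ℚ./ 8
        0≤i = 0≤inv m
        bound : ∀ e p q → 0ℚ ≤ e → 0ℚ ≤ p → ι m ≤ q + 1ℚ → p * q ≤ 1ℚ + ½ * e → p ≤ (ℤ.+ 1 ℚ./ 8) + ½ * e →
          p ≤ inv m * 9/8 + e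
        bound e p q 0≤e 0≤p m≤ pq≤ p≤ = begin
          p                         ≡⟨ sym (ℚ.*-identityˡ p) ⟩
          1ℚ * p                    ≡⟨ cong (_* p) (trans (sym (ι*inv m)) (ℚ.*-comm (ι m) (inv m))) ⟩
          inv m * ι m * p           ≡⟨ ℚ.*-assoc (inv m) (ι m) p ⟩
          inv m * (ι m * p)         ≤⟨ ℚ.*-monoˡ-≤-nonNeg (inv m) {{ℚ.nonNegative 0≤i}} (begin
            ι m * p                      ≤⟨ ℚ.*-monoʳ-≤-nonNeg p {{ℚ.nonNegative 0≤p}} m≤ ⟩
            (q + 1ℚ) * p                 ≡⟨ solve 2 (λ p q → (q :+ con 1ℚ) :* p := p :* q :+ p) refl p q ⟩
            p * q + p                    ≤⟨ ℚ.+-mono-≤ pq≤ p≤ ⟩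
            (1ℚ + ½ * e) + ((ℤ.+ 1 ℚ./ 8) + ½ * e) ≡⟨ solve 1 (λ e → (con 1ℚ :+ con ½ :* e) :+ (con (ℤ.+ 1 ℚ./ 8) :+ con ½ :* e)
                                                        := con 9/8 :+ e) refl e ⟩
            9/8 + e                      ∎) ⟩
          inv m * (9/8 + e)         ≡⟨ ℚ.*-distribˡ-+ (inv m) 9/8 e ⟩
          inv m * 9/8 + inv m * e   ≤⟨ ℚ.+-monoʳ-≤ (inv m * 9/8) (ℚ.≤-trans
                                        (ℚ.*-monoʳ-≤-nonNeg e {{ℚ.nonNegative 0≤e}} (inv≤ m 1 (ℕ.s≤s ℕ.z≤n)))
                                        (ℚ.≤-reflexive (ℚ.*-identityˡ e))) ⟩
          inv m * 9/8 + e           ∎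
        inv-1 : ∀ N′ → N′ ≡ 0 → inv (8 ℕ.* d) ≤ β N′
        inv-1 _ refl = begin
          inv (8 ℕ.* d)               ≤⟨ inv≤ (8 ℕ.* d) (8 ℕ.* (d ℕ.* 1)) (ℕ.*-monoʳ-≤ 8 (ℕ.≤-reflexive (ℕ.*-identityʳ d))) ⟩
          i                           ≡⟨ sym (ℚ.*-identityʳ i) ⟩
          i * 1ℚ                      ≤⟨ ℚ.*-monoˡ-≤-nonNeg i {{ℚ.nonNegative (0≤inv (8 ℕ.* (d ℕ.* 1)))}} (from-yes (1ℚ ℚ.≤? 9/8)) ⟩
          i * 9/8                     ∎
          where i = inv (8 ℕ.* (d ℕ.* 1))
        split : N′ ≡ 0 ⊎ m ℕ.≤ proj₁ E → ε ∈[0, β N′ ]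
        split (inj₁ N′≡0) = weaken {ε} {inv (8 ℕ.* d)} {β N′} (inv-1 N′ N′≡0) (pointwise⇒≤ℝ {0ℝ} {ε} 0≤ε , ε≤)
        split (inj₂ le)   = pointwise⇒≤ℝ {0ℝ} {ε} 0≤ε , λ e 0<e →
          let 0<½e = ℚ.positive⁻¹ (½ * e) {{ℚ.pos*pos⇒pos ½ e {{ℚ.positive 0<e}}}} in
          eventually-map (λ n ((0≤p , m≤) , (pq≤ , p≤)) → bound e (seq ε n) (seq x n) (ℚ.<⇒≤ 0<e) 0≤p m≤ pq≤ p≤)
            (eventually-× (eventually-× 0≤ε (m≤x+1 le)) (eventually-× (proj₁ εx≃1 (½ * e) 0<½e) (proj₂ ε∈⅛ (½ * e) 0<½e)))

open import Data.Nat hiding (_/_)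
open import Data.Nat.DivMod using (_mod_; m≡m%n+[m/n]*n; m%n<n; m<n⇒m%n≡m; m/n*n≤m)
open import Data.Nat.Logarithm
  using (⌈log₂_⌉; ⌈log₂⌉-mono-≤; ⌈log₂2^n⌉≡n; ⌈log₂⌈n/2⌉⌉≡⌈log₂n⌉∸1)
open import Data.Nat.Properties

-- Counting memories and streams

module _ {a b} {A : Set a} {B : Set b} where

  ↔-injective⇒≤ : ∀ {m n} → Fin m ↔ A → Fin n ↔ B →
    (f : A → B) → Injective _≡_ _≡_ f → m ≤ n
  ↔-injective⇒≤ F G f f-inj = Fin.injective⇒≤ {f = Inverse.from G ∘ f ∘ Inverse.to F} λ {i} {j} eq →
    trans (sym (Inverse.strictlyInverseʳ F i))
      (trans (cong (Inverse.from F) (f-inj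
         (trans (sym (Inverse.strictlyInverseˡ G _))
           (trans (cong (Inverse.to G) eq) (Inverse.strictlyInverseˡ G _)))))
        (Inverse.strictlyInverseʳ F j))

module _ {a} {A : Set a} where

  Vec-↔ : ∀ {m} n → Fin m ↔ A → Fin (m ^ n) ↔ Vec A n
  Vec-↔ zero F = mk↔ₛ′ (λ _ → []) (λ _ → Fin.zero) (λ { [] → refl }) (λ { Fin.zero → refl ; (Fin.suc ()) })
  Vec-↔ (suc n) F =
    mk↔ₛ′ (uncurry Vec._∷_) Vec.uncons (λ { (x ∷ xs) → refl }) (λ _ → refl)
    ↔-∘ ((F ×-↔ Vec-↔ n F) ↔-∘ Fin.*↔×)

  injective∈⇒≤length : ∀ {m} (f : Fin m → A) → Injective _≡_ _≡_ f →
    ∀ {xs} → (∀ i → f i ∈ xs) → m ≤ length xs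
  injective∈⇒≤length f f-inj f∈ = Fin.injective⇒≤ {f = λ i → Any.index (f∈ i)}
    λ eq → f-inj (Membershipₛ.index-injective (setoid A) (f∈ _) (f∈ _) eq)

  lookup-injective : ∀ {xs : List A} → Unique xs → Injective _≡_ _≡_ (List.lookup xs)
  lookup-injective (_   ∷ u) {Fin.zero}  {Fin.zero}  eq = refl
  lookup-injective (x∉ ∷ u) {Fin.zero}  {Fin.suc j} eq =
    contradiction eq (All.lookup x∉ (∈-lookup j))
  lookup-injective (x∉ ∷ u) {Fin.suc i} {Fin.zero}  eq =
    contradiction (sym eq) (All.lookup x∉ (∈-lookup i))
  lookup-injective (_   ∷ u) {Fin.suc i} {Fin.suc j} eq = cong Fin.suc (lookup-injective u eq)

  length≤ : ∀ {m} {xs : List A} → Unique xs → (g : ∀ {x} → x ∈ xs → Fin m) →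
    (∀ {x y} (x∈ : x ∈ xs) (y∈ : y ∈ xs) → g x∈ ≡ g y∈ → x ≡ y) → length xs ≤ m
  length≤ {xs = xs} u g g-inj = Fin.injective⇒≤ {f = λ i → g (∈-lookup {xs = xs} i)}
    λ eq → lookup-injective u (g-inj (∈-lookup _) (∈-lookup _) eq)

Memory-↔ : ∀ b s → Fin (2 ^ (b * s)) ↔ Memory b s
Memory-↔ b s = subst (λ m → Fin m ↔ Memory b s) (ℕ.^-*-assoc 2 b s) (Vec-↔ s (Vec-↔ b Fin.2↔Bool))

-- Pigeonhole, read in the exponents of `(2 ^ ℓ) ^ n ≤ 2 ^ (b * s)`.
memoryBound : ∀ {a} {A : Set a} ℓ n {b s} → Fin (2 ^ ℓ) ↔ A →
  (f : Vec A n → Memory b s) → Injective _≡_ _≡_ f → ℓ * n ≤ b * s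
memoryBound ℓ n {b} {s} F f f-inj = ℕ.≮⇒≥ λ bs<ℓn →
  ℕ.<⇒≱ (ℕ.^-monoʳ-< 2 (s≤s (s≤s z≤n)) bs<ℓn)
    (subst (_≤ 2 ^ (b * s)) (ℕ.^-*-assoc 2 ℓ n)
      (↔-injective⇒≤ (Vec-↔ n F) (Memory-↔ b s) f f-inj))

module _ {d Δ : ℕ} where

  private
    filter-∉ : ∀ {P : List (Point d Δ)} {p} → p ∉ P → filter (λ q → ¬? (q ≟ᴾ p)) P ≡ P
    filter-∉ {p = p} p∉P = filter-all (λ q → ¬? (q ≟ᴾ p))
      (All.map (λ p≢q q≡p → p≢q (sym q≡p)) (¬Any⇒All¬ _ p∉P))

  deleteHead : ∀ {P : List (Point d Δ)} {p} → p ∉ P →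
    filter (λ q → ¬? (q ≟ᴾ p)) (p ∷ P) ≡ P
  deleteHead {P} {p} p∉P = trans (filter-reject (λ q → ¬? (q ≟ᴾ p)) (λ p≢p → p≢p refl)) (filter-∉ p∉P)

  extend : ∀ {P : List (Point d Δ)} X → Unique (X ++ P) → Stream P → Stream (X ++ P)
  extend []      _        σ = σ
  extend (x ∷ X) (x∉ ∷ u) σ = insert (extend X u σ) x (All¬⇒¬Any x∉)

  fromUnique : ∀ {P : List (Point d Δ)} → Unique P → Stream P
  fromUnique []       = empty
  fromUnique {p ∷ P} (p∉ ∷ u) = insert (fromUnique u) p (All¬⇒¬Any p∉)

  module _ {b s} (A : Algorithm d Δ b s) where
    open Algorithm A

    run-subst : ∀ {P Q : List (Point d Δ)} (eq : P ≡ Q) (σ : Stream P) →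
      run (subst Stream eq σ) ≡ run σ
    run-subst refl σ = refl

    -- The memory is all that is known of the past, so two confused streams stay confused under
    -- common insertions although their point sets differ.
    run-extend : ∀ {P Q : List (Point d Δ)} X (u : Unique (X ++ P)) (v : Unique (X ++ Q))
      (σ : Stream P) (τ : Stream Q) → run σ ≡ run τ → run (extend X u σ) ≡ run (extend X v τ)
    run-extend []      _       _       σ τ eq = eq
    run-extend (x ∷ X) (_ ∷ u) (_ ∷ v) σ τ eq = cong (update (ins x)) (run-extend X u v σ τ eq)

    module _ {a} {U : Set a} (place : ℕ → U → Point d Δ) where

      -- Position m of a vector is counted from its end, so that its head is
      -- the point inserted last.
      placed : ∀ {m} → Vec U m → List (Point d Δ)
      placed []               = []
      placed {suc m} (u ∷ us) = place m u ∷ placed us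

      ∈-placed : ∀ {m} (us : Vec U m) {x} → x ∈ placed us →
        ∃[ i ] ∃[ u ] (i < m × x ≡ place i u)
      ∈-placed (u ∷ us) (here eq)  = _ , u , ℕ.≤-refl , eq
      ∈-placed (u ∷ us) (there x∈) with i , v , i<m , eq ← ∈-placed us x∈ =
        i , v , ℕ.m<n⇒m<1+n i<m , eq

      length-placed : ∀ {m} (us : Vec U m) → length (placed us) ≡ m
      length-placed []       = refl
      length-placed (u ∷ us) = cong suc (length-placed us)

      InjectivePlacement : ℕ → Set a
      InjectivePlacement n = ∀ {i j u v} → i < n → j < n → place i u ≡ place j v → i ≡ j × u ≡ v

      module _ {n} (inj : InjectivePlacement n) where

        placed-∉ : ∀ {m} (us : Vec U m) {u} → m < n → place m u ∉ placed us
        placed-∉ us m<n x∈ with i , v , i<m , eq ← ∈-placed us x∈ =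
          ℕ.<⇒≢ i<m (sym (proj₁ (inj m<n (ℕ.<-trans i<m m<n) eq)))

        placed-unique : ∀ {m} → m ≤ n → (us : Vec U m) → Unique (placed us)
        placed-unique m≤n []       = []
        placed-unique m≤n (u ∷ us) =
          ¬Any⇒All¬ _ (placed-∉ us m≤n) ∷ placed-unique (ℕ.<⇒≤ m≤n) us

        -- Enough for the blocks: there every point must be in the coreset, so any difference serves
        -- and nothing has to be deleted.
        placed-difference : DecidableEquality U → ∀ {m} → m ≤ n → (us vs : Vec U m) → us ≢ vs →
          ∃[ x ] (x ∈ placed us × x ∉ placed vs)
        placed-difference _≟_ m≤n []       []       us≢vs = contradiction refl us≢vs
        placed-difference _≟_ m≤n (u ∷ us) (v ∷ vs) us≢vs with u ≟ v
        ... | no u≢v = _ , here refl , λ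
          { (here eq)  → u≢v (proj₂ (inj m≤n m≤n eq))
          ; (there x∈) → placed-∉ vs m≤n x∈ }
        ... | yes refl with x , x∈ , x∉ ← placed-difference _≟_ (ℕ.<⇒≤ m≤n) us vs (us≢vs ∘ cong (u ∷_)) =
          x , there x∈ , λ { (here refl) → placed-∉ us m≤n x∈ ; (there x∈vs) → x∉ x∈vs }

        placedStream : ∀ {m} → m ≤ n → (us : Vec U m) → Stream (placed us)
        placedStream m≤n us = fromUnique (placed-unique m≤n us)

        -- Deleting the common last points of two streams that lead to the
        -- same memory exposes the last position at which they differ.
        lastDifference : ∀ {m} → m ≤ n → (us vs : Vec U m) → us ≢ vs →
          DecidableEquality U →
          (σ : Stream (placed us)) (τ : Stream (placed vs)) → run σ ≡ run τ →
          ∃[ i ] ∃[ u ] ∃[ v ] Σ[ us′ ∈ Vec U i ] Σ[ vs′ ∈ Vec U i ] (i < n × u ≢ v ×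
            Σ[ σ ∈ Stream (place i u ∷ placed us′) ] Σ[ τ ∈ Stream (place i v ∷ placed vs′) ]
              run σ ≡ run τ)
        lastDifference m≤n [] [] us≢vs _ σ τ eq = contradiction refl us≢vs
        lastDifference {suc m} m≤n (u ∷ us) (v ∷ vs) us≢vs _≟_ σ τ eq with u ≟ v
        ... | no u≢v  = m , u , v , us , vs , m≤n , u≢v , σ , τ , eq
        ... | yes refl = lastDifference (ℕ.<⇒≤ m≤n) us vs (us≢vs ∘ cong (u ∷_)) _≟_
          (subst Stream (deleteHead u∉us) (delete σ p (here refl)))
          (subst Stream (deleteHead u∉vs) (delete τ p (here refl)))
          (trans (run-subst (deleteHead u∉us) (delete σ p (here refl)))
            (trans (cong (update (del p)) eq)
              (sym (run-subst (deleteHead u∉vs) (delete τ p (here refl))))))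
          where
          p    = place m u
          u∉us = placed-∉ us m≤n
          u∉vs = placed-∉ vs m≤n

-- A point that every coreset contains

module _ {a} {A : Set a} (f : A → Bool) where

  ∈-filterᵇ⁺ : ∀ {x xs} → x ∈ xs → f x ≡ true → x ∈ filterᵇ f xs
  ∈-filterᵇ⁺ {xs = y ∷ xs} (here refl) fx with f y | fx
  ... | true | refl = here refl
  ∈-filterᵇ⁺ {xs = y ∷ xs} (there x∈) fx with f y
  ... | true  = there (∈-filterᵇ⁺ x∈ fx)
  ... | false = ∈-filterᵇ⁺ x∈ fx

  ∈-filterᵇ⁻ : ∀ {x xs} → x ∈ filterᵇ f xs → x ∈ xs × f x ≡ true
  ∈-filterᵇ⁻ {xs = y ∷ xs} x∈ with f y in fy
  ∈-filterᵇ⁻ {xs = y ∷ xs} (here refl) | true = here refl , fy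
  ∈-filterᵇ⁻ {xs = y ∷ xs} (there x∈)  | true  = let x∈ , fx = ∈-filterᵇ⁻ {xs = xs} x∈ in there x∈ , fx
  ∈-filterᵇ⁻ {xs = y ∷ xs} x∈          | false = let x∈ , fx = ∈-filterᵇ⁻ {xs = xs} x∈ in there x∈ , fx

  filterᵇ-unique : ∀ {xs} → Unique xs → Unique (filterᵇ f xs)
  filterᵇ-unique []       = []
  filterᵇ-unique {x ∷ xs} (x∉ ∷ u) with f x
  ... | true  = All.tabulate (λ y∈ → All.lookup x∉ (proj₁ (∈-filterᵇ⁻ {xs = xs} y∈))) ∷ filterᵇ-unique u
  ... | false = filterᵇ-unique u

module _ {d Δ : ℕ} where

  weight-unweighted : ∀ (f : Point d Δ → Bool) P →
    weight (filterᵇ (f ∘ proj₁) (unweighted P)) ≡ length (filterᵇ f P)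
  weight-unweighted f []      = refl
  weight-unweighted f (p ∷ P) with f p
  ... | true  = cong suc (weight-unweighted f P)
  ... | false = weight-unweighted f P

  ∈-unweighted⁺ : ∀ {P : List (Point d Δ)} {x} → x ∈ P → x ∈ points (unweighted P)
  ∈-unweighted⁺ (here eq) = here eq
  ∈-unweighted⁺ (there x∈) = there (∈-unweighted⁺ x∈)

  ∈-unweighted⁻ : ∀ {P : List (Point d Δ)} {x} → x ∈ points (unweighted P) → x ∈ P
  ∈-unweighted⁻ {p ∷ P} (here eq) = here eq
  ∈-unweighted⁻ {p ∷ P} (there x∈) = there (∈-unweighted⁻ x∈)

  -- An inclusion of the selections would reverse the inequality of weights. The main use is to
  -- extract a covered isolated point when the isolated points are too heavy.
  excess : ∀ (f g : Point d Δ → Bool) C →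
    weight (filterᵇ (g ∘ proj₁) C) ℕ.< weight (filterᵇ (f ∘ proj₁) C) →
    ∃[ x ] (x ∈ points C × f x ≡ true × g x ≡ false)
  excess f g ((x , w) ∷ C) lt with f x in fx | g x in gx
  ... | true  | false = x , here refl , fx , gx
  ... | true  | true  = let y , y∈ , r = excess f g C (ℕ.+-cancelˡ-< w _ _ lt) in y , there y∈ , r
  ... | false | true  = let y , y∈ , r = excess f g C (ℕ.≤-<-trans (ℕ.m≤n+m _ w) lt) in y , there y∈ , r
  ... | false | false = let y , y∈ , r = excess f g C lt in y , there y∈ , r

  module _ {k} (P : List (Point d Δ)) (c : Fin k → ℝ^ d) (r : ℝ) where

    uncoveredUnweighted : ∀ {z} (out : Point d Δ → Bool) →
      length (filterᵇ out P) ℕ.≤ z →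
      (∀ p → p ∈ P → out p ≡ false → ∃[ j ] embed p ∈b⟨ c j , r ⟩) →
      UncoveredWeight≤ z (unweighted P) c r
    uncoveredUnweighted {z} out le cover =
      out , subst (ℕ._≤ z) (sym (weight-unweighted out P)) le , λ p p∈ → cover p (∈-unweighted⁻ p∈)

    -- Unit weights make weight a length, so outliers can be counted by their positions in a list.
    CoveredBut : ℕ → Set
    CoveredBut z = Σ[ out ∈ List (Point d Δ) ] (length out ℕ.≤ z ×
      (∀ {p} → p ∈ P → p ∈ out ⊎ ∃[ j ] embed p ∈b⟨ c j , r ⟩))

    coveredBut : ∀ {z} → UncoveredWeight≤ z (unweighted P) c r → CoveredBut z
    coveredBut {z} (out , le , cover) =
      filterᵇ out P , subst (ℕ._≤ z) (weight-unweighted out P) le , λ {p} p∈ → split p p∈ (out p) refl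
      where
      split : ∀ p → p ∈ P → ∀ b → out p ≡ b → p ∈ filterᵇ out P ⊎ ∃[ j ] embed p ∈b⟨ c j , r ⟩
      split p p∈ true  eq = inj₁ (∈-filterᵇ⁺ out p∈ eq)
      split p p∈ false eq = inj₂ (cover p (∈-unweighted⁺ p∈) eq)

D-self : ∀ {d} (x : Coord d) → D x x ≡ 0
D-self {zero}  x = refl
D-self {suc d} x rewrite ℕ.∣n-n∣≡0 (x Fin.zero) = D-self (x ∘ Fin.suc)

-- The inserted points: two beacons for each ball in `B`, and z isolated points. A group consists of
-- the two beacons of a ball or of one isolated point; by `far`, no ball of radius `g` meets two
-- groups.
module Items {d Δ z g : ℕ} {B : Set} (_≟ᴮ_ : DecidableEquality B)
  (item : (B × Bool) ⊎ Fin z → Point d Δ)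
  (far : ∀ i j → Sum.map₁ proj₁ i ≢ Sum.map₁ proj₁ j →
    4 ℕ.* g ℕ.^ 2 ℕ.< D (coord (item i)) (coord (item j)))
  (beacon≢ : ∀ j → item (inj₁ (j , true)) ≢ item (inj₁ (j , false)))
  where

  group : (B × Bool) ⊎ Fin z → B ⊎ Fin z
  group = Sum.map₁ proj₁

  near⇒group≡ : ∀ i j → D (coord (item i)) (coord (item j)) ℕ.≤ 4 ℕ.* g ℕ.^ 2 → group i ≡ group j
  near⇒group≡ i j near with Sum.≡-dec _≟ᴮ_ Fin._≟_ (group i) (group j)
  ... | yes eq = eq
  ... | no neq = contradiction near (ℕ.<⇒≱ (far i j neq))

  item-injective : Injective _≡_ _≡_ item
  item-injective {i} {j} eq = split i j eq (near⇒group≡ i j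
    (subst (λ x → D (coord (item i)) (coord x) ℕ.≤ 4 ℕ.* g ℕ.^ 2) eq
      (subst (ℕ._≤ 4 ℕ.* g ℕ.^ 2) (sym (D-self (coord (item i)))) ℕ.z≤n)))
    where
    split : ∀ i j → item i ≡ item j → group i ≡ group j → i ≡ j
    split (inj₁ (a , true))  (inj₁ (.a , true))  eq refl = refl
    split (inj₁ (a , true))  (inj₁ (.a , false)) eq refl = contradiction eq (beacon≢ a)
    split (inj₁ (a , false)) (inj₁ (.a , true))  eq refl = contradiction (sym eq) (beacon≢ a)
    split (inj₁ (a , false)) (inj₁ (.a , false)) eq refl = refl
    split (inj₂ a)           (inj₂ .a)           eq refl = refl

  -- The value `false` for isolated points matters: a ball that holds one leaves its slot tagged
  -- `true` free.
  tag : (B × Bool) ⊎ Fin z → Bool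
  tag (inj₁ (_ , b)) = b
  tag (inj₂ _)       = false

  group-tag-injective : ∀ i j → group i ≡ group j → tag i ≡ tag j → i ≡ j
  group-tag-injective (inj₁ (a , b)) (inj₁ (.a , .b)) refl refl = refl
  group-tag-injective (inj₂ a)       (inj₂ .a)        refl _    = refl

-- The radius `h` bounds opt, `r` is that of the test balls, `w` bounds the enlargement ε opt, and
-- `g` bounds opt* + ε opt. The test balls miss only `p` and the isolated points, and still miss
-- them at radius `r + w`. A coreset without `p` would accept the test balls, which leave z + 1
-- points uncovered.
module Separation {d Δ k z : ℕ} {B : Set} (B↔ : Fin k ↔ B) (_≟ᴮ_ : DecidableEquality B)
  (P : List (Point d Δ)) (P! : Unique P)
  (h r w g : ℕ) (centre : B → Coord d)
  (item : (B × Bool) ⊎ Fin z → Point d Δ) (item∈P : ∀ i → item i ∈ P)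
  (p : Point d Δ) (p∈P : p ∈ P) (p≢t : ∀ i → p ≢ item (inj₂ i))
  (r≤h : r ℕ.≤ h)
  (centre-p : ∃[ j ] D (coord p) (centre j) ℕ.≤ h ℕ.^ 2)
  (covered : ∀ {x} → x ∈ P → x ≢ p → (∀ i → x ≢ item (inj₂ i)) → ∃[ j ] D (coord x) (centre j) ℕ.≤ r ℕ.^ 2)
  (p-far : ∀ j → (r ℕ.+ w) ℕ.^ 2 ℕ.< D (coord p) (centre j))
  (t-far : ∀ i j → (r ℕ.+ w) ℕ.^ 2 ℕ.< D (coord (item (inj₂ i))) (centre j))
  (far : ∀ i j → Sum.map₁ proj₁ i ≢ Sum.map₁ proj₁ j →
    4 ℕ.* g ℕ.^ 2 ℕ.< D (coord (item i)) (coord (item j)))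
  (beacon≢ : ∀ j → item (inj₁ (j , true)) ≢ item (inj₁ (j , false)))
  (ε : ℝ)
  (ε-h : ∀ opt → opt ∈[0, ι h ] → ε *ℝ opt ∈[0, ι w ])
  (ε-g : ∀ opt opt* → opt ∈[0, ι h ] → 0ℝ ≤ℝ opt* → opt* ≤ℝ (1ℝ +ℝ ε) *ℝ opt →
    opt* ∈[0, ι g ] × opt* +ℝ ε *ℝ opt ∈[0, ι g ])
  where

  open Items {g = g} _≟ᴮ_ item far beacon≢

  private
    t : Fin z → Point d Δ
    t = item ∘ inj₂

    c : Fin k → ℝ^ d
    c j = embedCoord (centre (Inverse.to B↔ j))

    inBall : ∀ (x : Point d Δ) ρ → ∃[ j ] D (coord x) (centre j) ℕ.≤ ρ ℕ.^ 2 → ∃[ j ] embed x ∈b⟨ c j , fromℕ ρ ⟩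
    inBall x ρ (j , le) = Inverse.from B↔ j , D≤r²⇒∈b (coord x) (centre (Inverse.to B↔ (Inverse.from B↔ j))) ρ
      (subst (λ b → D (coord x) (centre b) ℕ.≤ ρ ℕ.^ 2) (sym (Inverse.strictlyInverseˡ B↔ j)) le)

    isT : Point d Δ → Bool
    isT x = does (Fin.any? (λ i → x ≟ᴾ t i))

    isT⁻ : ∀ x → isT x ≡ true → ∃[ i ] x ≡ t i
    isT⁻ x eq with Fin.any? (λ i → x ≟ᴾ t i)
    ... | yes found = found

    isT-false : ∀ x → isT x ≡ false → ∀ i → x ≢ t i
    isT-false x eq i x≡t with Fin.any? (λ i → x ≟ᴾ t i)
    ... | no ¬found = ¬found (i , x≡t)

    t-outliers : length (filterᵇ isT P) ℕ.≤ z
    t-outliers = length≤ (filterᵇ-unique isT P!) (λ {x} x∈ → proj₁ (found x∈))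
      λ x∈ y∈ eq → trans (proj₂ (found x∈)) (trans (cong t eq) (sym (proj₂ (found y∈))))
      where
      found : ∀ {x} → x ∈ filterᵇ isT P → ∃[ i ] x ≡ t i
      found {x} x∈ = isT⁻ x (proj₂ (∈-filterᵇ⁻ isT {xs = P} x∈))

    feasible : Feasible k z (unweighted P) (fromℕ h)
    feasible = proj₁ (fromℚ-∈[0,] {ι h} (0≤ι h)) , c ,
      uncoveredUnweighted P c (fromℕ h) isT t-outliers λ x x∈ eq → cover x x∈ (isT-false x eq) (x ≟ᴾ p)
      where
      cover : ∀ x → x ∈ P → (∀ i → x ≢ t i) → Dec (x ≡ p) → ∃[ j ] embed x ∈b⟨ c j , fromℕ h ⟩
      cover x x∈ x≢t (yes x≡p) = inBall x h
        (subst (λ y → ∃[ j ] D (coord y) (centre j) ℕ.≤ h ℕ.^ 2) (sym x≡p) centre-p)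
      cover x x∈ x≢t (no x≢p)  = let j , le = covered x∈ x≢p x≢t in
        inBall x h (j , ℕ.≤-trans le (ℕ.^-monoˡ-≤ 2 r≤h))

    Near : Point d Δ → ℝ^ d → Set
    Near x c = sqDist (embed x) c ≤ℝ fromℚ (ι (g ℕ.^ 2))

    near-centre⇒group≡ : ∀ c i j → Near (item i) c → Near (item j) c → group i ≡ group j
    near-centre⇒group≡ c i j i-near j-near =
      near⇒group≡ i j (D≤4g² (coord (item i)) (coord (item j)) c g i-near j-near)

    -- If t i lies in ball j₀, the item t i accounts for both slots of j₀ in an
    -- assignment of the covered items to pairs (ball, tag); so together with
    -- the uncovered items there is one slot too few.
    module _ (c* : Fin k → ℝ^ d) (i₀ : Fin z) (j₀ : Fin k) (t-near : Near (t i₀) (c* j₀))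
      (out : List (Point d Δ)) (cover : ∀ i → item i ∈ out ⊎ ∃[ j ] Near (item i) (c* j)) where

      private
        domain : Fin (1 ℕ.+ (k ℕ.* 2 ℕ.+ z)) ↔ (⊤ ⊎ ((B × Bool) ⊎ Fin z))
        domain = (Fin.1↔⊤ ⊎-↔ ((((B↔ ×-↔ Fin.2↔Bool) ↔-∘ Fin.*↔×) ⊎-↔ ↔-id _) ↔-∘ Fin.+↔⊎)) ↔-∘ Fin.+↔⊎

        codomain : Fin (k ℕ.* 2 ℕ.+ length out) ↔ ((Fin k × Bool) ⊎ Fin (length out))
        codomain = (((↔-id _ ×-↔ Fin.2↔Bool) ↔-∘ Fin.*↔×) ⊎-↔ ↔-id _) ↔-∘ Fin.+↔⊎

        assign : ∀ i → item i ∈ out ⊎ ∃[ j ] Near (item i) (c* j) → (Fin k × Bool) ⊎ Fin (length out)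
        assign i (inj₁ i∈)      = inj₂ (Any.index i∈)
        assign i (inj₂ (j , _)) = inj₁ (j , tag i)

        assign-injective : ∀ i j s s′ → assign i s ≡ assign j s′ → i ≡ j
        assign-injective i j (inj₁ i∈) (inj₁ j∈) eq = item-injective
          (Membershipₛ.index-injective (setoid _) i∈ j∈ (inj₂-injective eq))
        assign-injective i j (inj₂ (a , i-near)) (inj₂ (b , j-near)) eq = group-tag-injective i j
          (near-centre⇒group≡ (c* b) i j
            (subst (λ b → Near (item i) (c* b)) (cong proj₁ (inj₁-injective eq)) i-near) j-near)
          (cong proj₂ (inj₁-injective eq))

        tag-t : ∀ i → group i ≡ inj₂ i₀ → tag i ≢ true
        tag-t (inj₂ _) _ ()

        assign≢ : ∀ i s → assign i s ≢ inj₁ (j₀ , true)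
        assign≢ i (inj₂ (j , i-near)) eq = tag-t i
          (near-centre⇒group≡ (c* j₀) i (inj₂ i₀)
            (subst (λ b → Near (item i) (c* b)) (cong proj₁ (inj₁-injective eq)) i-near) t-near)
          (cong proj₂ (inj₁-injective eq))

        φ : ⊤ ⊎ ((B × Bool) ⊎ Fin z) → (Fin k × Bool) ⊎ Fin (length out)
        φ (inj₁ _) = inj₁ (j₀ , true)
        φ (inj₂ i) = assign i (cover i)

        φ-injective : Injective _≡_ _≡_ φ
        φ-injective {inj₁ _} {inj₁ _} eq = refl
        φ-injective {inj₁ _} {inj₂ j} eq = contradiction (sym eq) (assign≢ j (cover j))
        φ-injective {inj₂ i} {inj₁ _} eq = contradiction eq (assign≢ i (cover i))
        φ-injective {inj₂ i} {inj₂ j} eq = cong inj₂ (assign-injective i j (cover i) (cover j) eq)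

      manyOutliers : z ℕ.< length out
      manyOutliers = ℕ.+-cancelˡ-< (k ℕ.* 2) z (length out) (↔-injective⇒≤ domain codomain φ φ-injective)

  module _ {C : Weighted d Δ} (C⊆P : ∀ {x} → x ∈ points C → x ∈ P) (p∉C : p ∉ points C)
    {opt opt*} (opt∈ : opt ∈[0, ι h ]) (opt*∈ : opt* ∈[0, ι g ])
    (opt*+εopt∈ : opt* +ℝ ε *ℝ opt ∈[0, ι g ])
    (property : ∀ (c : Fin k → ℝ^ d) r → 0ℝ ≤ℝ r →
      UncoveredWeight≤ z C c r → UncoveredWeight≤ z (unweighted P) c (r +ℝ ε *ℝ opt))
    (c* : Fin k → ℝ^ d) (uncovered* : UncoveredWeight≤ z C c* opt*) where

    private
      out* : Point d Δ → Bool
      out* = proj₁ uncovered*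

      -- If the isolated points weigh more than z, the optimal balls `c*` for `C` cover one of them.
      -- By the coreset property these balls, enlarged to radius opt* + ε opt, leave at most z
      -- points of `P` uncovered, contrary to `manyOutliers`.
      light : weight (filterᵇ (isT ∘ proj₁) C) ℕ.≤ z
      light = ℕ.≮⇒≥ λ z< → heavy
        (excess isT out* C (ℕ.≤-<-trans (proj₁ (proj₂ uncovered*)) z<))
        where
        expanded = coveredBut P c* (opt* +ℝ ε *ℝ opt) (property c* opt* (proj₁ opt*∈) uncovered*)
        items : ∀ i → item i ∈ proj₁ expanded ⊎ ∃[ j ] Near (item i) (c* j)
        items i = Sum.map₂ (λ (j , i∈b) → j ,
            ∈b⇒sqDist≤ {x = embed (item i)} {c* j} {opt* +ℝ ε *ℝ opt} g opt*+εopt∈ i∈b)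
          (proj₂ (proj₂ expanded) (item∈P i))
        heavy : ¬ (∃[ x ] (x ∈ points C × isT x ≡ true × out* x ≡ false))
        heavy (x , x∈C , isT-x , out-x) =
          let i , x≡t = isT⁻ x isT-x
              j , x∈b = proj₂ (proj₂ uncovered*) x x∈C out-x
          in ℕ.<⇒≱ (manyOutliers c* i j
            (subst (λ x → Near x (c* j)) x≡t (∈b⇒sqDist≤ {x = embed x} {c* j} {opt*} g opt*∈ x∈b))
            (proj₁ expanded) items) (proj₁ (proj₂ expanded))

      ρ : ℝ
      ρ = fromℕ r +ℝ ε *ℝ opt

      ρ∈ : ρ ∈[0, ι (r ℕ.+ w) ]
      ρ∈ = subst (ρ ∈[0,_]) (sym (ι-+ r w))
        (+-∈[0,] {fromℕ r} {ε *ℝ opt} {ι r} {ι w} (fromℚ-∈[0,] {ι r} (0≤ι r)) (ε-h opt opt∈))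

      -- As `p` is not in `C`, the test balls leave at most the isolated points of `C` uncovered,
      -- and these are `light`.
      test : CoveredBut P c ρ z
      test = coveredBut P c ρ (property c (fromℕ r) (proj₁ (fromℚ-∈[0,] {ι r} (0≤ι r)))
        (isT , light , λ x x∈ eq → inBall x r
          (covered (C⊆P x∈) (λ x≡p → p∉C (subst (_∈ points C) x≡p x∈)) (isT-false x eq))))

      outlier : ∀ x → x ∈ P → (∀ j → (r ℕ.+ w) ℕ.^ 2 ℕ.< D (coord x) (centre j)) → x ∈ proj₁ test
      outlier x x∈ x-far = Sum.fromInj₁ (λ (j , x∈b) → contradiction
        (∈b⇒D≤g² (coord x) (centre (Inverse.to B↔ j)) {ρ} (r ℕ.+ w) ρ∈ x∈b)
        (ℕ.<⇒≱ (x-far (Inverse.to B↔ j)))) (proj₂ (proj₂ test) x∈)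

      outliers : Fin (suc z) → Point d Δ
      outliers Fin.zero    = p
      outliers (Fin.suc i) = t i

      outliers-injective : Injective _≡_ _≡_ outliers
      outliers-injective {Fin.zero}  {Fin.zero}  eq = refl
      outliers-injective {Fin.zero}  {Fin.suc j} eq = contradiction eq (p≢t j)
      outliers-injective {Fin.suc i} {Fin.zero}  eq = contradiction (sym eq) (p≢t i)
      outliers-injective {Fin.suc i} {Fin.suc j} eq = cong Fin.suc (inj₂-injective (item-injective eq))

      outliers∈ : ∀ i → outliers i ∈ proj₁ test
      outliers∈ Fin.zero    = outlier p p∈P p-far
      outliers∈ (Fin.suc i) = outlier (t i) (item∈P (inj₂ i)) (t-far i)

    absurd : ⊥
    absurd = ℕ.1+n≰n (ℕ.≤-trans (injective∈⇒≤length outliers outliers-injective outliers∈) (proj₁ (proj₂ test)))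

  p∈coreset : ∀ {C} → IsCoreset ε k z (unweighted P) C → ¬ (p ∉ points C)
  p∈coreset {C} (_ , C⊆P , opt , opt* , (feas , optimal) , (feas* , _) , _ , opt*≤ , property) p∉C =
    absurd {C} (λ x∈ → ∈-unweighted⁻ (C⊆P x∈)) p∉C {opt} {opt*} opt∈
      (proj₁ ε∈) (proj₂ ε∈) property (proj₁ (proj₂ feas*)) (proj₂ (proj₂ feas*))
    where
    opt∈ : opt ∈[0, ι h ]
    opt∈ = proj₁ feas , optimal (fromℕ h) feasible
    ε∈ : opt* ∈[0, ι g ] × opt* +ℝ ε *ℝ opt ∈[0, ι g ]
    ε∈ = ε-g opt opt* opt∈ (proj₁ feas*) opt*≤

-- Instances of k + z points

D≡0⇒≗ : ∀ {d} (x y : Coord d) → D x y ≡ 0 → ∀ i → x i ≡ y i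
D≡0⇒≗ {suc d} x y eq Fin.zero = ℕ.∣m-n∣≡0⇒m≡n
  (ℕ.m^n≡0⇒m≡0 ℕ.∣ x Fin.zero - y Fin.zero ∣ 2 (ℕ.m+n≡0⇒m≡0 _ eq))
D≡0⇒≗ {suc d} x y eq (Fin.suc i) = D≡0⇒≗ (x ∘ Fin.suc) (y ∘ Fin.suc)
  (ℕ.m+n≡0⇒n≡0 (ℕ.∣ x Fin.zero - y Fin.zero ∣ ℕ.^ 2) eq) i

coord-injective : ∀ {d Δ} {x y : Point d Δ} → (∀ i → coord x i ≡ coord y i) → x ≡ y
coord-injective {x = x} {y} eq = trans (sym (Vec.tabulate∘lookup x))
  (trans (Vec.tabulate-cong (Fin.toℕ-injective ∘ eq)) (Vec.tabulate∘lookup y))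

module _ {d Δ : ℕ} where

  open DecMembership (_≟ᴾ_ {d} {Δ}) using (_∈?_)

  outside : List (Point d Δ) → Point d Δ → Bool
  outside S x = not (does (x ∈? S))

  outside-false : ∀ S x → outside S x ≡ false → x ∈ S
  outside-false S x eq with x ∈? S
  ... | yes x∈ = x∈

  weightOutside : List (Point d Δ) → Weighted d Δ → ℕ
  weightOutside S C = weight (filterᵇ (outside S ∘ proj₁) C)

  private
    weight-filterᵇ-∷ : ∀ (f : Point d Δ → Bool) x w C →
      weight (filterᵇ (f ∘ proj₁) ((x , w) ∷ C)) ℕ.≤ w ℕ.+ weight (filterᵇ (f ∘ proj₁) C)
    weight-filterᵇ-∷ f x w C with f x
    ... | true  = ℕ.≤-refl
    ... | false = ℕ.m≤n+m _ w

    weight-filterᵇ-reject : ∀ (f : Point d Δ → Bool) x w C → f x ≡ false →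
      weight (filterᵇ (f ∘ proj₁) ((x , w) ∷ C)) ≡ weight (filterᵇ (f ∘ proj₁) C)
    weight-filterᵇ-reject f x w C eq with f x
    ... | false = refl

    outside-∈ : ∀ {S x} → x ∈ S → outside S x ≡ false
    outside-∈ {S} {x} x∈ = cong not (dec-true (x ∈? S) x∈)

  weightOutside-anti : ∀ x S C → weightOutside (x ∷ S) C ℕ.≤ weightOutside S C
  weightOutside-anti x S C = ℕ.≮⇒≥ λ lt →
    let y , _ , out , in-S = excess (outside (x ∷ S)) (outside S) C lt in
    contradiction (trans (sym out) (outside-∈ {x ∷ S} (there (outside-false S y in-S)))) λ ()

  weightOutside-here : ∀ x w S C → weightOutside (x ∷ S) ((x , w) ∷ C) ℕ.≤ weightOutside S C
  weightOutside-here x w S C = ℕ.≤-trans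
    (ℕ.≤-reflexive (weight-filterᵇ-reject (outside (x ∷ S)) x w C (outside-∈ {x ∷ S} (here refl))))
    (weightOutside-anti x S C)

  -- Weights are positive, so each chosen point takes at least 1 off the total.
  coverLight : ∀ (C : Weighted d Δ) → All (λ (_ , w) → 0 ℕ.< w) C → ∀ m →
    ∃[ S ] (length S ℕ.≤ m × weightOutside S C ℕ.≤ weight C ℕ.∸ m)
  coverLight []            _           m       = [] , ℕ.z≤n , ℕ.z≤n
  coverLight C             _           zero    = [] , ℕ.z≤n , all-outside C
    where
    all-outside : ∀ C → weightOutside [] C ℕ.≤ weight C
    all-outside []            = ℕ.z≤n
    all-outside ((x , w) ∷ C) = ℕ.+-monoʳ-≤ w (all-outside C)
  coverLight ((x , w) ∷ C) (0<w ∷ pos) (suc m) = let S , len , le = coverLight C pos m in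
    x ∷ S , ℕ.s≤s len , (begin
      weightOutside (x ∷ S) ((x , w) ∷ C) ≤⟨ weightOutside-here x w S C ⟩
      weightOutside S C                    ≤⟨ le ⟩
      weight C ℕ.∸ m                       ≤⟨ ℕ.∸-monoˡ-≤ (suc m) (ℕ.+-monoˡ-≤ (weight C) 0<w) ⟩
      (w ℕ.+ weight C) ℕ.∸ suc m           ∎)
    where open ℕ.≤-Reasoning

  -- Saves one unit more than `coverLight` does with equally many points, by choosing the heavy
  -- point among them.
  coverHeavy : ∀ (C : Weighted d Δ) → All (λ (_ , w) → 0 ℕ.< w) C → Any (λ (_ , w) → 2 ℕ.≤ w) C → ∀ m →
    ∃[ S ] (length S ℕ.≤ suc m × weightOutside S C ℕ.≤ weight C ℕ.∸ (2 ℕ.+ m))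
  coverHeavy ((x , w) ∷ C) (_ ∷ pos) (here 2≤w) m = let S , len , le = coverLight C pos m in
    x ∷ S , ℕ.s≤s len , (begin
      weightOutside (x ∷ S) ((x , w) ∷ C) ≤⟨ weightOutside-here x w S C ⟩
      weightOutside S C                    ≤⟨ le ⟩
      weight C ℕ.∸ m                       ≤⟨ ℕ.∸-monoˡ-≤ (2 ℕ.+ m) (ℕ.+-monoˡ-≤ (weight C) 2≤w) ⟩
      (w ℕ.+ weight C) ℕ.∸ (2 ℕ.+ m)       ∎)
    where open ℕ.≤-Reasoning
  -- With only one point to choose, the head is passed over for the heavy point further on. The
  -- weight of that point keeps the truncated subtraction exact.
  coverHeavy ((x , w) ∷ C) (_ ∷ pos) (there heavy) zero = let S , len , le = coverHeavy C pos heavy zero in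
    S , len , (begin
      weightOutside S ((x , w) ∷ C)  ≤⟨ weight-filterᵇ-∷ (outside S) x w C ⟩
      w ℕ.+ weightOutside S C        ≤⟨ ℕ.+-monoʳ-≤ w le ⟩
      w ℕ.+ (weight C ℕ.∸ 2)         ≡⟨ sym (ℕ.+-∸-assoc w (heavy⇒2≤ C heavy)) ⟩
      (w ℕ.+ weight C) ℕ.∸ 2         ∎)
    where
    open ℕ.≤-Reasoning
    heavy⇒2≤ : ∀ C → Any (λ ((_ , w) : Point d Δ × ℕ) → 2 ℕ.≤ w) C → 2 ℕ.≤ weight C
    heavy⇒2≤ ((x , w) ∷ C) (here 2≤w) = ℕ.≤-trans 2≤w (ℕ.m≤m+n w _)
    heavy⇒2≤ ((x , w) ∷ C) (there h)  = ℕ.≤-trans (heavy⇒2≤ C h) (ℕ.m≤n+m _ w)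
  coverHeavy ((x , w) ∷ C) (0<w ∷ pos) (there heavy) (suc m) = let S , len , le = coverHeavy C pos heavy m in
    x ∷ S , ℕ.s≤s len , (begin
      weightOutside (x ∷ S) ((x , w) ∷ C) ≤⟨ weightOutside-here x w S C ⟩
      weightOutside S C                    ≤⟨ le ⟩
      weight C ℕ.∸ (2 ℕ.+ m)               ≤⟨ ℕ.∸-monoˡ-≤ (3 ℕ.+ m) (ℕ.+-monoˡ-≤ (weight C) 0<w) ⟩
      (w ℕ.+ weight C) ℕ.∸ (3 ℕ.+ m)       ∎)
    where open ℕ.≤-Reasoning

  -- One ball fewer than available suffices: a point of weight at least 2 pays
  -- for the missing point, and without one C has at most |C| < n weight.
  coverCoreset : ∀ (C : Weighted d Δ) k z → All (λ (_ , w) → 0 ℕ.< w) C →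
    length C ℕ.< suc (suc k) ℕ.+ z → weight C ℕ.≤ suc (suc k) ℕ.+ z →
    ∃[ S ] (length S ℕ.≤ suc k × weightOutside S C ℕ.≤ z)
  coverCoreset C k z pos len<  w≤ with Any.any? (λ (_ , w) → 2 ℕ.≤? w) C
  ... | yes heavy = let S , len , le = coverHeavy C pos heavy k in S , len ,
    ℕ.≤-trans le (ℕ.≤-trans (ℕ.∸-monoˡ-≤ (2 ℕ.+ k) w≤) (ℕ.≤-reflexive (ℕ.m+n∸m≡n (2 ℕ.+ k) z)))
  ... | no ¬heavy = let S , len , le = coverLight C pos (suc k) in S , len ,
    ℕ.≤-trans le (ℕ.≤-trans (ℕ.∸-monoˡ-≤ (suc k) (ℕ.≤-trans (light C (¬Any⇒All¬ C ¬heavy)) (ℕ.≤-pred len<)))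
      (ℕ.≤-reflexive (ℕ.m+n∸m≡n (suc k) z)))
    where
    light : ∀ C → All (λ ((_ , w) : Point d Δ × ℕ) → ¬ 2 ℕ.≤ w) C → weight C ℕ.≤ length C
    light []      []          = ℕ.z≤n
    light (_ ∷ C) (w≱2 ∷ all) = ℕ.+-mono-≤ (ℕ.≤-pred (ℕ.≰⇒> w≱2)) (light C all)

  -- Unused balls are centred off the grid.
  centres : ∀ k → List (Point d Δ) → Fin k → Coord d
  centres k       []      _           = λ _ → Δ
  centres (suc k) (x ∷ S) Fin.zero    = coord x
  centres (suc k) (x ∷ S) (Fin.suc j) = centres k S j

  ∈⇒centre : ∀ {k S x} → length S ℕ.≤ k → x ∈ S → ∃[ j ] centres k S j ≡ coord x
  ∈⇒centre (ℕ.s≤s len) (here refl) = Fin.zero , refl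
  ∈⇒centre (ℕ.s≤s len) (there x∈)  = let j , eq = ∈⇒centre len x∈ in Fin.suc j , eq

  ∈⇒covered : ∀ {k S x} → length S ℕ.≤ k → x ∈ S →
    ∃[ j ] embed x ∈b⟨ embedCoord (centres k S j) , fromℕ 0 ⟩
  ∈⇒covered {k} {S} {x} len x∈ = let j , eq = ∈⇒centre len x∈ in
    j , D≤r²⇒∈b (coord x) (centres k S j) 0
      (ℕ.≤-reflexive (trans (cong (D (coord x)) eq) (D-self (coord x))))

module _ {d′ Δ : ℕ} where

  private
    d = suc d′

  centre⇒∈ : ∀ k S j (x : Point d Δ) → (∀ i → coord x i ≡ centres k S j i) → x ∈ S
  centre⇒∈ k       []      j           x eq = contradiction (Fin.toℕ<n (Vec.lookup x Fin.zero)) (ℕ.<-irrefl (eq Fin.zero))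
  centre⇒∈ (suc k) (y ∷ S) Fin.zero    x eq = here (coord-injective eq)
  centre⇒∈ (suc k) (y ∷ S) (Fin.suc j) x eq = there (centre⇒∈ k S j x eq)

  weight-unweighted≡ : ∀ (P : List (Point d Δ)) → weight (unweighted P) ≡ length P
  weight-unweighted≡ []      = refl
  weight-unweighted≡ (_ ∷ P) = cong suc (weight-unweighted≡ P)

  unweighted-positive : ∀ (P : List (Point d Δ)) → All (λ (_ , w) → 0 ℕ.< w) (unweighted P)
  unweighted-positive []      = []
  unweighted-positive (_ ∷ P) = ℕ.s≤s ℕ.z≤n ∷ unweighted-positive P

  -- One ball per point and z outliers show that opt is 0, so the coreset property enlarges no
  -- radius. If `p` is missing from `C`, balls of radius 0 at `suc k` points suffice for `C`, and
  -- then `P` has at most `suc k + z` points.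
  all∈coreset : ∀ {ε e k z} {P : List (Point d Δ)} {C} → Unique P → length P ≡ suc (suc k) ℕ.+ z →
    ε ∈[0, e ] → IsCoreset ε (suc (suc k)) z (unweighted P) C → weight C ℕ.≤ weight (unweighted P) →
    ∀ {p} → p ∈ P → ¬ (p ∉ points C)
  all∈coreset {ε} {e} {k} {z} {P} {C} P! |P|≡ ε∈
    ((C! , pos) , C⊆P , opt , _ , (feas , optimal) , _ , _ , _ , property) w≤ {p} p∈P p∉C =
    ℕ.<⇒≱ (ℕ.+-monoˡ-< z (ℕ.s≤s |S|≤)) (begin
      suc (suc k) ℕ.+ z                     ≡⟨ sym |P|≡ ⟩
      length P                              ≤⟨ injective∈⇒≤length (List.lookup P) (lookup-injective P!) P⊆ ⟩
      length (S ++ out)                     ≡⟨ length-++ S ⟩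
      length S ℕ.+ length out               ≤⟨ ℕ.+-monoʳ-≤ (length S) (proj₁ (proj₂ expanded)) ⟩
      length S ℕ.+ z                        ∎)
    where
    open ℕ.≤-Reasoning
    ball : List (Point d Δ) → Fin (suc (suc k)) → ℝ^ d
    ball S j = embedCoord (centres (suc (suc k)) S j)
    weightP : weight (unweighted P) ≡ suc (suc k) ℕ.+ z
    weightP = trans (weight-unweighted≡ P) |P|≡
    feasible : Feasible (suc (suc k)) z (unweighted P) 0ℝ
    feasible = let S , len , le = coverLight (unweighted P) (unweighted-positive P) (suc (suc k)) in
      proj₁ (fromℚ-∈[0,] {ι 0} (0≤ι 0)) , ball S , outside S ,
      ℕ.≤-trans le (ℕ.≤-reflexive (trans (cong (ℕ._∸ suc (suc k)) weightP) (ℕ.m+n∸m≡n (suc (suc k)) z))) ,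
      λ x _ eq → ∈⇒covered {k = suc (suc k)} {S = S} {x = x} len (outside-false S x eq)
    extra : Fin (suc (length (points C))) → Point d Δ
    extra Fin.zero    = p
    extra (Fin.suc i) = List.lookup (points C) i
    extra-injective : Injective _≡_ _≡_ extra
    extra-injective {Fin.zero}  {Fin.zero}  eq = refl
    extra-injective {Fin.zero}  {Fin.suc j} eq = contradiction (subst (_∈ points C) (sym eq) (∈-lookup j)) p∉C
    extra-injective {Fin.suc i} {Fin.zero}  eq = contradiction (subst (_∈ points C) eq (∈-lookup i)) p∉C
    extra-injective {Fin.suc i} {Fin.suc j} eq = cong Fin.suc (lookup-injective C! eq)
    extra∈P : ∀ i → extra i ∈ P
    extra∈P Fin.zero    = p∈P
    extra∈P (Fin.suc i) = ∈-unweighted⁻ (C⊆P (∈-lookup i))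
    |C|< : length C ℕ.< suc (suc k) ℕ.+ z
    |C|< = subst₂ (λ m n → m ℕ.< n) (length-map proj₁ C) |P|≡ (injective∈⇒≤length extra extra-injective extra∈P)
    chosen = coverCoreset C k z pos |C|< (ℕ.≤-trans w≤ (ℕ.≤-reflexive weightP))
    S = proj₁ chosen
    |S|≤ = proj₁ (proj₂ chosen)
    ρ = fromℕ 0 +ℝ ε *ℝ opt
    ρ∈ : ρ ∈[0, ι 0 ]
    ρ∈ = subst (ρ ∈[0,_]) (trans (ℚ.+-identityˡ (e ℚ.* ι 0)) (ℚ.*-zeroʳ e))
      (+-∈[0,] {fromℕ 0} {ε *ℝ opt} {ι 0} {e ℚ.* ι 0} (fromℚ-∈[0,] {ι 0} (0≤ι 0))
        (*-∈[0,] {ε} {opt} {e} {ι 0} ε∈ (proj₁ feas , optimal 0ℝ feasible)))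
    expanded : CoveredBut P (ball S) ρ z
    expanded = coveredBut P (ball S) ρ (property (ball S) (fromℕ 0) (proj₁ (fromℚ-∈[0,] {ι 0} (0≤ι 0)))
      (outside S , proj₂ (proj₂ chosen) ,
        λ x _ eq → ∈⇒covered {k = suc (suc k)} {S = S} {x = x} (ℕ.m≤n⇒m≤1+n |S|≤) (outside-false S x eq)))
    out = proj₁ expanded
    P⊆ : ∀ i → List.lookup P i ∈ S ++ out
    P⊆ i = [ ∈-++⁺ʳ S , (λ (j , x∈b) → ∈-++⁺ˡ (centre⇒∈ (suc (suc k)) S j x
        (D≡0⇒≗ (coord x) (centres (suc (suc k)) S j)
          (ℕ.n≤0⇒n≡0 (∈b⇒D≤g² (coord x) (centres (suc (suc k)) S j) {ρ} 0 ρ∈ x∈b))))) ]′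
      (proj₂ (proj₂ expanded) (∈-lookup {xs = P} i))
      where
      x : Point d Δ
      x = List.lookup P i

-- Covering by shifted balls

≤-slack : ∀ {m n} o → n ≡ m + o → m ≤ n
≤-slack {m} o refl = m≤m+n m o

^2-mono-≤ : ∀ {m n} → m ≤ n → m ^ 2 ≤ n ^ 2
^2-mono-≤ = ^-monoˡ-≤ 2

m+n≤o⇒n≤∣o-m∣ : ∀ {m n o} → m + n ≤ o → n ≤ ∣ o - m ∣
m+n≤o⇒n≤∣o-m∣ {m} {n} {o} le = +-cancelˡ-≤ m n ∣ o - m ∣ (≤-trans le (m≤n+∣m-n∣ o m))

m+n≤o⇒n≤∣m-o∣ : ∀ {m n o} → m + n ≤ o → n ≤ ∣ m - o ∣
m+n≤o⇒n≤∣m-o∣ {m} {n} {o} le = subst (n ≤_) (∣-∣-comm o m) (m+n≤o⇒n≤∣o-m∣ le)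

∣m-n∣≤ : ∀ {m n o} → m ≤ n + o → n ≤ m + o → ∣ m - n ∣ ≤ o
∣m-n∣≤ {m} {n} {o} m≤ n≤ with ∣m-n∣≡[m∸n]∨[n∸m] m n
... | inj₁ eq = subst (_≤ o) (sym eq) (m≤n+o⇒m∸n≤o m n m≤)
... | inj₂ eq = subst (_≤ o) (sym eq) (m≤n+o⇒m∸n≤o n m n≤)

Σ : ∀ {n} → (Fin n → ℕ) → ℕ
Σ = VecF.foldr _+_ 0

term≤Σ : ∀ {n} (f : Fin n → ℕ) i → f i ≤ Σ f
term≤Σ f Fin.zero    = m≤m+n _ _
term≤Σ f (Fin.suc i) = ≤-trans (term≤Σ (f ∘ Fin.suc) i) (m≤n+m _ _)

terms≤Σ : ∀ {n} (f : Fin n → ℕ) {i j} → i ≢ j → f i + f j ≤ Σ f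
terms≤Σ f {Fin.zero}  {Fin.zero}  i≢j = contradiction refl i≢j
terms≤Σ f {Fin.zero}  {Fin.suc j} i≢j = +-monoʳ-≤ (f Fin.zero) (term≤Σ (f ∘ Fin.suc) j)
terms≤Σ f {Fin.suc i} {Fin.zero}  i≢j = subst (_≤ Σ f) (+-comm (f Fin.zero) (f (Fin.suc i)))
  (+-monoʳ-≤ (f Fin.zero) (term≤Σ (f ∘ Fin.suc) i))
terms≤Σ f {Fin.suc i} {Fin.suc j} i≢j =
  ≤-trans (terms≤Σ (f ∘ Fin.suc) (i≢j ∘ cong Fin.suc)) (m≤n+m _ _)

Σ≤ : ∀ {n} (f : Fin n → ℕ) b → (∀ i → f i ≤ b) → Σ f ≤ n * b
Σ≤ {zero}  f b f≤ = z≤n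
Σ≤ {suc n} f b f≤ = +-mono-≤ (f≤ Fin.zero) (Σ≤ (f ∘ Fin.suc) b (f≤ ∘ Fin.suc))

-- The summand `b` on the left avoids the factor n - 1 on the right.
Σ≤-except : ∀ {n} (f : Fin n → ℕ) b i → (∀ j → j ≢ i → f j ≤ b) → Σ f + b ≤ n * b + f i
Σ≤-except {suc n} f b Fin.zero f≤ = begin
  f Fin.zero + Σ (f ∘ Fin.suc) + b   ≤⟨ +-monoˡ-≤ b (+-monoʳ-≤ (f Fin.zero)
                                        (Σ≤ (f ∘ Fin.suc) b (λ j → f≤ (Fin.suc j) λ ()))) ⟩
  f Fin.zero + n * b + b             ≡⟨ swap (f Fin.zero) (n * b) b ⟩
  b + n * b + f Fin.zero             ∎
  where
  open ≤-Reasoning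
  swap : ∀ x y b → x + y + b ≡ b + y + x
  swap = solve-∀
Σ≤-except {suc n} f b (Fin.suc i) f≤ = begin
  f Fin.zero + Σ (f ∘ Fin.suc) + b     ≡⟨ +-assoc (f Fin.zero) _ b ⟩
  f Fin.zero + (Σ (f ∘ Fin.suc) + b)   ≤⟨ +-mono-≤ (f≤ Fin.zero λ ())
                                          (Σ≤-except (f ∘ Fin.suc) b i λ j j≢i → f≤ (Fin.suc j) (j≢i ∘ Fin.suc-injective)) ⟩
  b + (n * b + f (Fin.suc i))          ≡⟨ sym (+-assoc b (n * b) _) ⟩
  b + n * b + f (Fin.suc i)            ∎
  where open ≤-Reasoning

argmax : ∀ {n} (f : Fin (suc n) → ℕ) → ∃[ i ] ∀ j → f j ≤ f i
argmax {zero}  f = Fin.zero , λ { Fin.zero → ≤-refl }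
argmax {suc n} f with argmax (f ∘ Fin.suc)
... | i , max with ≤-total (f Fin.zero) (f (Fin.suc i))
...   | inj₁ le = Fin.suc i , λ { Fin.zero → le ; (Fin.suc j) → max j }
...   | inj₂ ge = Fin.zero , λ { Fin.zero → ≤-refl ; (Fin.suc j) → ≤-trans (max j) ge }

D-cong : ∀ {d} {x x′ y y′ : Coord d} → x ≗ x′ → y ≗ y′ → D x y ≡ D x′ y′
D-cong {zero}  x≗ y≗ = refl
D-cong {suc d} x≗ y≗ = cong₂ _+_ (cong₂ (λ a b → ∣ a - b ∣ ^ 2) (x≗ Fin.zero) (y≗ Fin.zero))
  (D-cong (x≗ ∘ Fin.suc) (y≗ ∘ Fin.suc))

D-congˡ : ∀ {d} {x x′ : Coord d} y → x ≗ x′ → D x y ≡ D x′ y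
D-congˡ y x≗ = D-cong x≗ (λ _ → refl)

coordinate≤D : ∀ {d} (x y : Coord d) l {a} → a ≤ ∣ x l - y l ∣ → a ^ 2 ≤ D x y
coordinate≤D x y l le = ≤-trans (^2-mono-≤ le) (term≤Σ (λ l → ∣ x l - y l ∣ ^ 2) l)

shift : ∀ {d} → Fin d → Bool → ℕ → Coord d → Coord d
shift l true  a x = VecF.updateAt x l (_+ a)
shift l false a x = VecF.updateAt x l (_∸ a)

shift-other : ∀ {d} {l l′ : Fin d} s a (x : Coord d) → l′ ≢ l → shift l s a x l′ ≡ x l′
shift-other {l = l} {l′} true  a x l′≢l = VecF.updateAt-minimal l′ l x l′≢l
shift-other {l = l} {l′} false a x l′≢l = VecF.updateAt-minimal l′ l x l′≢l

shift-true : ∀ {d} (l : Fin d) a (x : Coord d) → shift l true a x l ≡ x l + a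
shift-true l a x = VecF.updateAt-updates l x

shift-false : ∀ {d} (l : Fin d) a (x : Coord d) → a ≤ x l → shift l false a x l + a ≡ x l
shift-false l a x a≤ = trans (cong (_+ a) (VecF.updateAt-updates l x)) (m∸n+n≡m a≤)

shift≤ : ∀ {d} (l l′ : Fin d) s a (x : Coord d) → shift l s a x l′ ≤ x l′ + a
shift≤ l l′ s a x with l′ Fin.≟ l
shift≤ l l′ s a x | no l′≢l = subst (_≤ x l′ + a) (sym (shift-other s a x l′≢l)) (m≤m+n _ a)
shift≤ l .l true  a x | yes refl = ≤-reflexive (shift-true l a x)
shift≤ l .l false a x | yes refl = subst (_≤ x l + a) (sym (VecF.updateAt-updates l x))
  (≤-trans (m∸n≤m (x l) a) (m≤m+n (x l) a))

≤shift : ∀ {d} (l l′ : Fin d) s a (x : Coord d) → x l′ ≤ shift l s a x l′ + a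
≤shift l l′ s a x with l′ Fin.≟ l
≤shift l l′ s a x | no l′≢l = subst (λ y → x l′ ≤ y + a) (sym (shift-other s a x l′≢l)) (m≤m+n _ a)
≤shift l .l true  a x | yes refl = subst (λ y → x l ≤ y + a) (sym (shift-true l a x))
  (≤-trans (m≤m+n (x l) a) (m≤m+n _ a))
≤shift l .l false a x | yes refl = subst (λ y → x l ≤ y + a) (sym (VecF.updateAt-updates l x))
  (m≤n+m∸n′ (x l) a)
  where
  m≤n+m∸n′ : ∀ m n → m ≤ (m ∸ n) + n
  m≤n+m∸n′ m n = subst (m ≤_) (+-comm n (m ∸ n)) (m≤n+m∸n m n)

∣shift-∣ : ∀ {d} (l : Fin d) s a (x : Coord d) → a ≤ x l → ∣ x l - shift l s a x l ∣ ≡ a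
∣shift-∣ l true  a x _  = trans (cong (∣ x l -_∣) (shift-true l a x)) (∣m-m+n∣≡n (x l) a)
∣shift-∣ l false a x a≤ = trans (cong (∣_- shift l false a x l ∣) (sym (shift-false l a x a≤)))
  (trans (∣-∣-comm (shift l false a x l + a) (shift l false a x l)) (∣m-m+n∣≡n (shift l false a x l) a))

∣shift-shift∣ : ∀ {d} (l : Fin d) s a b (x : Coord d) → a ≤ x l → b ≤ x l →
  ∣ shift l s a x l - shift l s b x l ∣ ≡ ∣ a - b ∣
∣shift-shift∣ l true a b x _ _ = trans (cong₂ ∣_-_∣ (shift-true l a x) (shift-true l b x))
  (∣m+n-m+o∣≡∣n-o∣ (x l) a b)
∣shift-shift∣ l false a b x a≤ b≤ = begin
  -- Adding `a + b` to both numbers undoes both truncated subtractions.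
  ∣ p - q ∣              ≡⟨ sym (∣m+n-m+o∣≡∣n-o∣ (a + b) p q) ⟩
  ∣ a + b + p - a + b + q ∣ ≡⟨ cong₂ ∣_-_∣ (trans (arrange₁ a b p) (cong (_+ b) (shift-false l a x a≤)))
                                            (trans (arrange₂ a b q) (cong (_+ a) (shift-false l b x b≤))) ⟩
  ∣ x l + b - x l + a ∣  ≡⟨ ∣m+n-m+o∣≡∣n-o∣ (x l) b a ⟩
  ∣ b - a ∣              ≡⟨ ∣-∣-comm b a ⟩
  ∣ a - b ∣              ∎
  where
  open ≡-Reasoning
  p = shift l false a x l
  q = shift l false b x l
  arrange₁ : ∀ a b p → a + b + p ≡ p + a + b
  arrange₁ = solve-∀
  arrange₂ : ∀ a b q → a + b + q ≡ q + b + a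
  arrange₂ = solve-∀

D-shift : ∀ {d} (l : Fin d) (x y : Coord d) → (∀ l′ → l′ ≢ l → x l′ ≡ y l′) → D x y ≤ ∣ x l - y l ∣ ^ 2
D-shift {d} l x y eq = begin
  D x y                         ≡⟨ sym (+-identityʳ (D x y)) ⟩
  D x y + 0                     ≤⟨ Σ≤-except (λ l → ∣ x l - y l ∣ ^ 2) 0 l (λ l′ l′≢l →
                                     ≤-reflexive (cong (_^ 2) (m≡n⇒∣m-n∣≡0 (eq l′ l′≢l)))) ⟩
  d * 0 + ∣ x l - y l ∣ ^ 2     ≡⟨ cong (_+ ∣ x l - y l ∣ ^ 2) (*-zeroʳ d) ⟩
  ∣ x l - y l ∣ ^ 2             ∎
  where open ≤-Reasoning

-- x is pushed into the ball by its largest displacement from p: if that is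
-- m then D ≤ (d − 1) m² + (h − m)² ≤ h² − hm, because dm ≤ h.
directionalCover : ∀ {d′} (x p : Coord (suc d′)) M v h r →
  (∀ l → ∣ x l - p l ∣ ≤ M) → (∃[ l ] 24 * v ≤ ∣ x l - p l ∣) →
  suc d′ * M ≡ h → r + 12 * v ≡ h → (∀ l → h ≤ p l) →
  ∃[ l ] ∃[ s ] D x (shift l s h p) ≤ r ^ 2
directionalCover {d′} x p M v h r small (l₀ , large) dM≡h r+12v≡h h≤p =
  let l , max = argmax (λ l → ∣ x l - p l ∣)
      m≤M = small l
      m = ∣ x l - p l ∣
      e , m+e≡h = m≤n⇒∃[o]m+o≡n (≤-trans m≤M (subst (M ≤_) dM≡h (m≤m+n M (d′ * M))))
      s , eq = side l e m+e≡h
  in l , s , +-cancelʳ-≤ (m ^ 2) (D x (shift l s h p)) (r ^ 2) (begin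
    D x (shift l s h p) + m ^ 2                    ≤⟨ Σ≤-except (λ l′ → ∣ x l′ - shift l s h p l′ ∣ ^ 2) (m ^ 2) l
                                                       (λ l′ l′≢l → subst (λ y → ∣ x l′ - y ∣ ^ 2 ≤ m ^ 2)
                                                         (sym (shift-other s h p l′≢l)) (^2-mono-≤ (max l′))) ⟩
    suc d′ * m ^ 2 + ∣ x l - shift l s h p l ∣ ^ 2 ≡⟨ cong (λ y → suc d′ * m ^ 2 + y ^ 2) eq ⟩
    suc d′ * m ^ 2 + e ^ 2                         ≤⟨ bound m e m+e≡h (≤-trans large (max l₀))
                                                       (subst (suc d′ * m ≤_) dM≡h (*-monoʳ-≤ (suc d′) m≤M)) ⟩
    r ^ 2 + m ^ 2                                  ∎)
  where
  open ≤-Reasoning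
  side : ∀ l e → ∣ x l - p l ∣ + e ≡ h → ∃[ s ] ∣ x l - shift l s h p l ∣ ≡ e
  side l e m+e≡h with ≤-total (p l) (x l)
  ... | inj₁ p≤x with m , eq ← m≤n⇒∃[o]m+o≡n p≤x = true , trans
    (cong₂ ∣_-_∣ (sym eq) (trans (shift-true l h p) (trans (cong (p l +_) (trans (sym m+e≡h) (cong (_+ e)
      (trans (cong (∣_- p l ∣) (sym eq)) (trans (∣-∣-comm (p l + m) (p l)) (∣m-m+n∣≡n (p l) m)))))) (sym (+-assoc (p l) m e)))))
    (∣m-m+n∣≡n (p l + m) e)
  ... | inj₂ x≤p with m , eq ← m≤n⇒∃[o]m+o≡n x≤p = false , trans
    (cong (∣_- shift l false h p l ∣) x≡) (trans (∣-∣-comm (shift l false h p l + e) (shift l false h p l)) (∣m-m+n∣≡n (shift l false h p l) e))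
    where
    m≡ : ∣ x l - p l ∣ ≡ m
    m≡ = trans (cong (∣ x l -_∣) (sym eq)) (∣m-m+n∣≡n (x l) m)
    x≡ : x l ≡ shift l false h p l + e
    x≡ = +-cancelʳ-≡ m (x l) (shift l false h p l + e) (begin-equality
      x l + m                         ≡⟨ eq ⟩
      p l                             ≡⟨ sym (shift-false l h p (h≤p l)) ⟩
      shift l false h p l + h         ≡⟨ cong (shift l false h p l +_) (sym (trans (+-comm e m) (trans (cong (_+ e) (sym m≡)) m+e≡h))) ⟩
      shift l false h p l + (e + m)   ≡⟨ sym (+-assoc _ e m) ⟩
      shift l false h p l + e + m     ∎)
  bound : ∀ m e → m + e ≡ h → 24 * v ≤ m → suc d′ * m ≤ h → suc d′ * m ^ 2 + e ^ 2 ≤ r ^ 2 + m ^ 2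
  bound m e m+e≡h 24v≤m dm≤h = begin
    suc d′ * m ^ 2 + e ^ 2       ≡⟨ eq₁ (suc d′) m e ⟩
    suc d′ * m * m + e ^ 2       ≤⟨ +-monoˡ-≤ (e ^ 2) (*-monoˡ-≤ m dm≤h) ⟩
    h * m + e ^ 2                ≡⟨ cong (λ h → h * m + e ^ 2) (sym m+e≡h) ⟩
    (m + e) * m + e ^ 2          ≡⟨ eq₂ m e ⟩
    e * (m + e) + m ^ 2          ≡⟨ cong (λ h → e * h + m ^ 2) m+e≡h ⟩
    e * h + m ^ 2                ≤⟨ +-monoˡ-≤ (m ^ 2) eh≤r² ⟩
    r ^ 2 + m ^ 2                ∎
    where
    eq₁ : ∀ d m e → d * (m * (m * 1)) + e * (e * 1) ≡ d * m * m + e * (e * 1)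
    eq₁ = solve-∀
    eq₂ : ∀ m e → (m + e) * m + e * (e * 1) ≡ e * (m + e) + m * (m * 1)
    eq₂ = solve-∀
    eq₃ : ∀ r v → (r + 12 * v) * (r + 12 * v) + 144 * (v * v) ≡ r * (r * 1) + 24 * v * (r + 12 * v)
    eq₃ = solve-∀
    -- Here e h = h² - m h ≤ h² - 24 v h ≤ (h - 12 v)², with the terms moved so that nothing is
    -- subtracted.
    eh≤r² : e * h ≤ r ^ 2
    eh≤r² = +-cancelʳ-≤ (24 * v * h) (e * h) (r ^ 2) (begin
      e * h + 24 * v * h       ≤⟨ +-monoʳ-≤ (e * h) (*-monoˡ-≤ h 24v≤m) ⟩
      e * h + m * h            ≡⟨ sym (*-distribʳ-+ h e m) ⟩
      (e + m) * h              ≡⟨ cong (_* h) (trans (+-comm e m) m+e≡h) ⟩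
      h * h                    ≡⟨ cong₂ _*_ (sym r+12v≡h) (sym r+12v≡h) ⟩
      (r + 12 * v) * (r + 12 * v) ≤⟨ m≤m+n _ (144 * (v * v)) ⟩
      (r + 12 * v) * (r + 12 * v) + 144 * (v * v) ≡⟨ eq₃ r v ⟩
      r ^ 2 + 24 * v * (r + 12 * v) ≡⟨ cong (λ h → r ^ 2 + 24 * v * h) r+12v≡h ⟩
      r ^ 2 + 24 * v * h       ∎)

-- Clusters, cells and beacons

lookup≢ : ∀ {N d} (γ γ′ : Vec (Fin N) d) → γ ≢ γ′ → ∃[ l ] Vec.lookup γ l ≢ Vec.lookup γ′ l
lookup≢ []      []        γ≢ = contradiction refl γ≢
lookup≢ (a ∷ γ) (a′ ∷ γ′) γ≢ with a Fin.≟ a′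
... | no a≢      = Fin.zero , a≢
... | yes refl   = let l , ≢ = lookup≢ γ γ′ (γ≢ ∘ cong (a ∷_)) in Fin.suc l , ≢

module Zones (d′ H : ℕ) where

  private
    d = suc d′

  -- All points used lie in disjoint zones, spread along the first axis.
  base : ℕ → Coord d
  base i Fin.zero    = 8 * H * i + 3 * H
  base i (Fin.suc _) = 3 * H

  at : ℕ → Coord d → Coord d
  at i ρ l = base i l + ρ l

  -- Relative to 8 H i on the first axis, and to 0 on the others, unshifted points lie between 3 H
  -- and 4 H, and shifts by at most 2 H stay between H and 6 H. The period 8 H thus leaves gaps of 3
  -- H. On the other axes only the upper bound matters, for membership in the grid.
  InZone : ℕ → Coord d → Set
  InZone i x = 8 * H * i + H ≤ x Fin.zero × x Fin.zero ≤ 8 * H * i + 6 * H × (∀ l → x (Fin.suc l) ≤ 6 * H)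

  3H≤base : ∀ i l → 3 * H ≤ base i l
  3H≤base i Fin.zero    = m≤n+m (3 * H) (8 * H * i)
  3H≤base i (Fin.suc l) = ≤-refl

  zone-gap< : ∀ {i j x y} → i < j → InZone i x → InZone j y → x Fin.zero + 3 * H ≤ y Fin.zero
  zone-gap< {i} {j} {x} {y} i<j (_ , x≤ , _) (≤y , _ , _) with o , refl ← m≤n⇒∃[o]m+o≡n i<j = begin
    x Fin.zero + 3 * H                    ≤⟨ +-monoˡ-≤ (3 * H) x≤ ⟩
    8 * H * i + 6 * H + 3 * H             ≤⟨ ≤-slack (8 * H * o) (eq H i o) ⟩
    8 * H * (suc i + o) + H               ≤⟨ ≤y ⟩
    y Fin.zero                            ∎
    where
    open ≤-Reasoning
    eq : ∀ H i o → 8 * H * (1 + i + o) + H ≡ 8 * H * i + 6 * H + 3 * H + 8 * H * o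
    eq = solve-∀

  zone-gap : ∀ {i j x y} → i ≢ j → InZone i x → InZone j y → 3 * H ≤ ∣ x Fin.zero - y Fin.zero ∣
  zone-gap {i} {j} {x} {y} i≢j x∈ y∈ with <-cmp i j
  ... | tri< i<j _ _ = m+n≤o⇒n≤∣m-o∣ {x Fin.zero} {3 * H} (zone-gap< {x = x} {y} i<j x∈ y∈)
  ... | tri≈ _ i≡j _ = contradiction i≡j i≢j
  ... | tri> _ _ i>j = m+n≤o⇒n≤∣o-m∣ {y Fin.zero} {3 * H} (zone-gap< {x = y} {x} i>j y∈ x∈)

  zone-far : ∀ {i j} x y → i ≢ j → InZone i x → InZone j y → (3 * H) ^ 2 ≤ D x y
  zone-far x y i≢j x∈ y∈ = coordinate≤D x y Fin.zero (zone-gap {x = x} {y} i≢j x∈ y∈)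

  at-zone : ∀ i ρ → (∀ l → ρ l ≤ H) → InZone i (at i ρ)
  at-zone i ρ ρ≤ =
      (begin
        8 * H * i + H                  ≤⟨ ≤-slack (2 * H + ρ Fin.zero) (eq₁ (8 * H * i) H (ρ Fin.zero)) ⟩
        8 * H * i + 3 * H + ρ Fin.zero ∎)
    , (begin
        8 * H * i + 3 * H + ρ Fin.zero ≤⟨ +-monoʳ-≤ (8 * H * i + 3 * H) (ρ≤ Fin.zero) ⟩
        8 * H * i + 3 * H + H          ≤⟨ ≤-slack (2 * H) (eq₂ (8 * H * i) H) ⟩
        8 * H * i + 6 * H              ∎)
    , λ l → begin
        3 * H + ρ (Fin.suc l)          ≤⟨ +-monoʳ-≤ (3 * H) (ρ≤ (Fin.suc l)) ⟩
        3 * H + H                      ≤⟨ ≤-slack (2 * H) (eq₃ H) ⟩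
        6 * H                          ∎
    where
    open ≤-Reasoning
    eq₁ : ∀ b H ρ → b + 3 * H + ρ ≡ b + H + (2 * H + ρ)
    eq₁ = solve-∀
    eq₂ : ∀ b H → b + 6 * H ≡ b + 3 * H + H + 2 * H
    eq₂ = solve-∀
    eq₃ : ∀ H → 6 * H ≡ 3 * H + H + 2 * H
    eq₃ = solve-∀

  shift-zone : ∀ i ρ → (∀ l → ρ l ≤ H) → ∀ l s {a} → a ≤ 2 * H → InZone i (shift l s a (at i ρ))
  shift-zone i ρ ρ≤ l s {a} a≤ =
      +-cancelʳ-≤ (2 * H) (8 * H * i + H) (y Fin.zero) (begin
        8 * H * i + H + 2 * H               ≤⟨ ≤-slack (ρ Fin.zero) (eq₁ (8 * H * i) H (ρ Fin.zero)) ⟩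
        8 * H * i + 3 * H + ρ Fin.zero      ≤⟨ ≤shift l Fin.zero s a (at i ρ) ⟩
        y Fin.zero + a                      ≤⟨ +-monoʳ-≤ (y Fin.zero) a≤ ⟩
        y Fin.zero + 2 * H                  ∎)
    , (begin
        y Fin.zero                               ≤⟨ shift≤ l Fin.zero s a (at i ρ) ⟩
        8 * H * i + 3 * H + ρ Fin.zero + a       ≤⟨ +-mono-≤ (+-monoʳ-≤ (8 * H * i + 3 * H) (ρ≤ Fin.zero)) a≤ ⟩
        8 * H * i + 3 * H + H + 2 * H            ≡⟨ eq₂ (8 * H * i) H ⟩
        8 * H * i + 6 * H                        ∎)
    , λ l′ → begin
        y (Fin.suc l′)                      ≤⟨ shift≤ l (Fin.suc l′) s a (at i ρ) ⟩
        3 * H + ρ (Fin.suc l′) + a          ≤⟨ +-mono-≤ (+-monoʳ-≤ (3 * H) (ρ≤ (Fin.suc l′))) a≤ ⟩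
        3 * H + H + 2 * H                   ≡⟨ eq₃ H ⟩
        6 * H                               ∎
    where
    open ≤-Reasoning
    y = shift l s a (at i ρ)
    eq₁ : ∀ b H ρ → b + 3 * H + ρ ≡ b + H + 2 * H + ρ
    eq₁ = solve-∀
    eq₂ : ∀ b H → b + 3 * H + H + 2 * H ≡ b + 6 * H
    eq₂ = solve-∀
    eq₃ : ∀ H → 3 * H + H + 2 * H ≡ 6 * H
    eq₃ = solve-∀

  zone⇒<Δ : ∀ {n Δ i} x → 0 < H → 8 * H * n ≤ Δ → i < n → InZone i x → ∀ l → x l < Δ
  zone⇒<Δ {n} {Δ} {i} x 0<H ≤Δ i<n (_ , x≤ , x′≤) l = ≤-trans (below l) (≤-trans (*-monoʳ-≤ (8 * H) i<n) ≤Δ)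
    where
    open ≤-Reasoning
    eq : ∀ i H → 8 * H * (1 + i) ≡ 8 * H * i + 6 * H + H + H
    eq = solve-∀
    6H< : ∀ b → 8 * H * i + 6 * H ≡ b → suc b ≤ 8 * H * suc i
    6H< b refl = begin
      suc (8 * H * i + 6 * H)         ≡⟨ +-comm 1 (8 * H * i + 6 * H) ⟩
      8 * H * i + 6 * H + 1           ≤⟨ +-monoʳ-≤ (8 * H * i + 6 * H) 0<H ⟩
      8 * H * i + 6 * H + H           ≤⟨ m≤m+n _ H ⟩
      8 * H * i + 6 * H + H + H       ≡⟨ sym (eq i H) ⟩
      8 * H * suc i                   ∎
    below : ∀ l → suc (x l) ≤ 8 * H * suc i
    below Fin.zero     = ≤-trans (s≤s x≤) (6H< _ refl)
    below (Fin.suc l′) = ≤-trans (s≤s (≤-trans (x′≤ l′) (m≤n+m (6 * H) (8 * H * i)))) (6H< _ refl)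

module Cells (d′ N : ℕ) where

  private
    d = suc d′

  opaque
    -- The cell γ of a cluster at scale v; u moves the point inside the cell.
    -- The first coordinate is at least 32 v N, whereas cells of smaller scales
    -- stay below 8 v N.
    cell : ℕ → Vec (Fin N) d → ℕ → Coord d
    cell v γ u Fin.zero    = 32 * v * (N + toℕ (Vec.lookup γ Fin.zero)) + u
    cell v γ u (Fin.suc l) = 32 * v * toℕ (Vec.lookup γ (Fin.suc l))

    next : ∀ v m n → m < n → 32 * v * m + 32 * v ≤ 32 * v * n
    next v m n m<n = begin
      32 * v * m + 32 * v   ≡⟨ +-comm (32 * v * m) (32 * v) ⟩
      32 * v + 32 * v * m   ≡⟨ sym (*-suc (32 * v) m) ⟩
      32 * v * suc m        ≤⟨ *-monoʳ-≤ (32 * v) m<n ⟩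
      32 * v * n            ∎
      where open ≤-Reasoning

    ≤64Nv : ∀ v m → m < N + N → 32 * v * m + 32 * v ≤ 64 * N * v
    ≤64Nv v m m< = ≤-trans (next v m (N + N) m<) (≤-reflexive (eq N v))
      where
      eq : ∀ N v → 32 * v * (N + N) ≡ 64 * N * v
      eq = solve-∀

    cell≤ : ∀ v γ u → u ≤ 8 * v → ∀ l → cell v γ u l ≤ 64 * N * v
    cell≤ v γ u u≤ Fin.zero = ≤-trans
      (+-monoʳ-≤ (32 * v * (N + toℕ (Vec.lookup γ Fin.zero))) (≤-trans u≤ (*-monoˡ-≤ v (m≤m+n 8 24))))
      (≤64Nv v _ (+-monoʳ-< N (Fin.toℕ<n (Vec.lookup γ Fin.zero))))
    cell≤ v γ u u≤ (Fin.suc l) = ≤-trans (m≤m+n _ (32 * v))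
      (≤64Nv v _ (<-≤-trans (Fin.toℕ<n (Vec.lookup γ (Fin.suc l))) (m≤m+n N N)))

    32vN≤cell : ∀ v γ u → 32 * v * N ≤ cell v γ u Fin.zero
    32vN≤cell v γ u = ≤-trans (*-monoʳ-≤ (32 * v) (m≤m+n N _)) (m≤m+n _ u)

    -- Here the ratio 8 of consecutive scales is used: smaller cells reach at most 64 N v′ ≤ 8 N v,
    -- which leaves 24 N v below the first coordinate 32 v N.
    cell-gap-scale : ∀ {v v′} γ γ′ u u′ → 0 < N → 8 * v′ ≤ v → u′ ≤ 8 * v′ →
      24 * v ≤ ∣ cell v′ γ′ u′ Fin.zero - cell v γ u Fin.zero ∣
    cell-gap-scale {v} {v′} γ γ′ u u′ 0<N 8v′≤v u′≤ = m+n≤o⇒n≤∣m-o∣ {cell v′ γ′ u′ Fin.zero} {24 * v} (begin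
      cell v′ γ′ u′ Fin.zero + 24 * v    ≤⟨ +-monoˡ-≤ (24 * v) (cell≤ v′ γ′ u′ u′≤ Fin.zero) ⟩
      64 * N * v′ + 24 * v               ≡⟨ cong (_+ 24 * v) (eq₁ N v′) ⟩
      8 * N * (8 * v′) + 24 * v          ≤⟨ +-mono-≤ (*-monoʳ-≤ (8 * N) 8v′≤v) (*-monoˡ-≤ v (m≤m*n 24 N {{>-nonZero 0<N}})) ⟩
      8 * N * v + 24 * N * v             ≡⟨ eq₂ N v ⟩
      32 * v * N                         ≤⟨ 32vN≤cell v γ u ⟩
      cell v γ u Fin.zero                ∎)
      where
      open ≤-Reasoning
      eq₁ : ∀ N v′ → 64 * N * v′ ≡ 8 * N * (8 * v′)
      eq₁ = solve-∀
      eq₂ : ∀ N v → 8 * N * v + 24 * N * v ≡ 32 * v * N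
      eq₂ = solve-∀

    -- Of the spacing 32 v between cells, the offset uses up at most 8 v.
    gap : ∀ v m n u u′ → m < n → u ≤ 8 * v → 32 * v * m + u + 24 * v ≤ 32 * v * n + u′
    gap v m n u u′ m<n u≤ = begin
      32 * v * m + u + 24 * v          ≤⟨ +-monoˡ-≤ (24 * v) (+-monoʳ-≤ (32 * v * m) u≤) ⟩
      32 * v * m + 8 * v + 24 * v      ≡⟨ eq (32 * v * m) v ⟩
      32 * v * m + 32 * v              ≤⟨ next v m n m<n ⟩
      32 * v * n                       ≤⟨ m≤m+n _ u′ ⟩
      32 * v * n + u′                  ∎
      where
      open ≤-Reasoning
      eq : ∀ b v → b + 8 * v + 24 * v ≡ b + 32 * v
      eq = solve-∀

    gap∣-∣ : ∀ v m n u u′ → m ≢ n → u ≤ 8 * v → u′ ≤ 8 * v →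
      24 * v ≤ ∣ 32 * v * m + u - (32 * v * n + u′) ∣
    gap∣-∣ v m n u u′ m≢n u≤ u′≤ with <-cmp m n
    ... | tri< m<n _ _ = m+n≤o⇒n≤∣m-o∣ {32 * v * m + u} {24 * v} (gap v m n u u′ m<n u≤)
    ... | tri≈ _ m≡n _ = contradiction m≡n m≢n
    ... | tri> _ _ n<m = m+n≤o⇒n≤∣o-m∣ {32 * v * n + u′} {24 * v} (gap v n m u′ u n<m u′≤)

    cell-gap : ∀ v γ γ′ u u′ → γ ≢ γ′ → u ≤ 8 * v → u′ ≤ 8 * v →
      ∃[ l ] 24 * v ≤ ∣ cell v γ u l - cell v γ′ u′ l ∣
    cell-gap v γ γ′ u u′ γ≢ u≤ u′≤ with lookup≢ γ γ′ γ≢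
    ... | Fin.zero  , ≢ = Fin.zero , gap∣-∣ v (N + toℕ (Vec.lookup γ Fin.zero)) (N + toℕ (Vec.lookup γ′ Fin.zero)) u u′
      (≢ ∘ Fin.toℕ-injective ∘ +-cancelˡ-≡ N _ _) u≤ u′≤
    ... | Fin.suc l , ≢ = Fin.suc l , subst₂ (λ m n → 24 * v ≤ ∣ m - n ∣)
      (+-identityʳ (32 * v * toℕ (Vec.lookup γ (Fin.suc l)))) (+-identityʳ (32 * v * toℕ (Vec.lookup γ′ (Fin.suc l))))
      (gap∣-∣ v (toℕ (Vec.lookup γ (Fin.suc l))) (toℕ (Vec.lookup γ′ (Fin.suc l))) 0 0 (≢ ∘ Fin.toℕ-injective) z≤n z≤n)

    cell-offset-injective : ∀ v γ u u′ → cell v γ u ≗ cell v γ u′ → u ≡ u′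
    cell-offset-injective v γ u u′ eq = +-cancelˡ-≡ (32 * v * (N + toℕ (Vec.lookup γ Fin.zero))) u u′ (eq Fin.zero)

module Configuration (d′ N H v k₀ z : ℕ) (0<N : 0 < N) (0<v : 0 < v) (h≤H : 64 * (suc d′ * N * v) ≤ H)
  (i₀ : Fin (suc k₀)) (ρ : Coord (suc d′)) (ρ≤ : ∀ l → ρ l ≤ 64 * N * v) where

  open Zones d′ H

  private
    d = suc d′
    X = d * N * v
    M = 64 * N * v

  -- `h` is d times the side 64 N v of a cluster, as `directionalCover` requires. From ε ≤ 9 / (64 d
  -- N) follows ε h ≤ `w`, and from ε ≤ 1 / 8 that `g` bounds (1 + 2 ε) h.
  h r w g : ℕ
  h = 64 * X
  r = h ∸ 12 * v
  w = 9 * v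
  g = 80 * X

  p : Coord d
  p = at (toℕ i₀) ρ

  -- One ball for each of the `k₀` clusters without `p`, and one for each of the 2 d axis directions
  -- at `p`.
  Ball : Set
  Ball = Fin k₀ ⊎ (Fin d × Bool)

  private
    open ≤-Reasoning

    v≤X : v ≤ X
    v≤X = m≤n*m v (d * N) {{>-nonZero (≤-trans 0<N (m≤m+n N (d′ * N)))}}

    0<X : 0 < X
    0<X = ≤-trans 0<v v≤X

    dM≡h : d * M ≡ h
    dM≡h = eq d N v
      where
      eq : ∀ d N v → d * (64 * N * v) ≡ 64 * (d * N * v)
      eq = solve-∀

    M≤h : M ≤ h
    M≤h = subst (M ≤_) dM≡h (m≤m+n M (d′ * M))

    M≤H : M ≤ H
    M≤H = ≤-trans M≤h h≤H

    12v≤h : 12 * v ≤ h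
    12v≤h = *-mono-≤ (m≤m+n 12 52) v≤X

  r+12v≡h : r + 12 * v ≡ h
  r+12v≡h = m∸n+n≡m 12v≤h

  r≤h : r ≤ h
  r≤h = m∸n≤m h (12 * v)

  r+w<h : r + w < h
  r+w<h = begin-strict
    r + 9 * v    <⟨ +-monoʳ-< r (*-monoˡ-< v {{>-nonZero 0<v}} {9} {12} (m≤m+n 10 2)) ⟩
    r + 12 * v   ≡⟨ r+12v≡h ⟩
    h            ∎

  private
    -- The beacons of a directional ball lie beyond its centre as seen from `p`, at distance r or r
    -- - 1 from it: still inside the ball, but far from the beacons of the other directions.
    reach : Bool → ℕ
    reach true  = h + r
    reach false = h + r ∸ 1

    reach≤ : ∀ b → reach b ≤ h + r
    reach≤ true  = ≤-refl
    reach≤ false = m∸n≤m (h + r) 1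

    reach≤2H : ∀ b → reach b ≤ 2 * H
    reach≤2H b = begin
      reach b     ≤⟨ reach≤ b ⟩
      h + r       ≤⟨ +-mono-≤ h≤H (≤-trans r≤h h≤H) ⟩
      H + H       ≡⟨ cong (H +_) (sym (+-identityʳ H)) ⟩
      2 * H       ∎

    -- 128 X - 12 v - 1 ≥ 115 X because v and 1 are at most X. The factor 115 suffices even for
    -- perpendicular beacons, as 2 · 115² = 26450 exceeds 4 · 80² = 25600.
    ≤reach : ∀ b → 115 * X ≤ reach b
    ≤reach b = ≤-trans (+-cancelʳ-≤ (1 + 12 * v) (115 * X) (h + r ∸ 1) (begin
      115 * X + (1 + 12 * v)         ≤⟨ +-monoʳ-≤ (115 * X) (+-mono-≤ 0<X (*-monoʳ-≤ 12 v≤X)) ⟩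
      115 * X + (X + 12 * X)         ≡⟨ eq₁ X ⟩
      h + h                          ≡⟨ cong (h +_) (sym r+12v≡h) ⟩
      h + (r + 12 * v)               ≡⟨ sym (+-assoc h r (12 * v)) ⟩
      h + r + 12 * v                 ≡⟨ cong (_+ 12 * v) (sym (m∸n+n≡m 1≤h+r)) ⟩
      h + r ∸ 1 + 1 + 12 * v         ≡⟨ +-assoc (h + r ∸ 1) 1 (12 * v) ⟩
      h + r ∸ 1 + (1 + 12 * v)       ∎)) (pred≤ b)
      where
      eq₁ : ∀ X → 115 * X + (X + 12 * X) ≡ 64 * X + 64 * X
      eq₁ = solve-∀
      1≤h+r : 1 ≤ h + r
      1≤h+r = ≤-trans 0<X (≤-trans (m≤n*m X 64) (m≤m+n h r))
      pred≤ : ∀ b → h + r ∸ 1 ≤ reach b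
      pred≤ true  = m∸n≤m (h + r) 1
      pred≤ false = ≤-refl

    M<reach : ∀ b → M < reach b
    M<reach b = begin-strict
      M         ≤⟨ M≤h ⟩
      64 * X    <⟨ *-monoˡ-< X {{>-nonZero 0<X}} {64} {115} (m≤m+n 65 50) ⟩
      115 * X   ≤⟨ ≤reach b ⟩
      reach b   ∎

    2H≤p : ∀ l → 2 * H ≤ p l
    2H≤p l = ≤-trans (*-monoˡ-≤ H (m≤m+n 2 1)) (≤-trans (3H≤base (toℕ i₀) l) (m≤m+n _ (ρ l)))

    reach≤p : ∀ b l → reach b ≤ p l
    reach≤p b l = ≤-trans (reach≤2H b) (2H≤p l)

    H≤2H : H ≤ 2 * H
    H≤2H = m≤m+n H (1 * H)

    h≤p : ∀ l → h ≤ p l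
    h≤p l = ≤-trans h≤H (≤-trans H≤2H (2H≤p l))

    -- Values 0 and 1 of the first coordinate are free in every cluster, since the cells begin at 32
    -- v N.
    offset : Bool → Coord d
    offset false Fin.zero = 1
    offset _     _        = 0

    offset≤1 : ∀ b l → offset b l ≤ 1
    offset≤1 true  l           = z≤n
    offset≤1 false Fin.zero    = ≤-refl
    offset≤1 false (Fin.suc l) = z≤n

    1≤M : 1 ≤ M
    1≤M = ≤-trans 0<v (m≤n*m v (64 * N) {{>-nonZero (≤-trans 0<N (m≤n*m N 64))}})

  centre : Ball → Coord d
  centre (inj₁ c)       = at (toℕ (punchIn i₀ c)) (λ _ → 32 * N * v)
  centre (inj₂ (l , s)) = shift l s h p

  -- The beacons belonging to a ball lie inside it; the remaining items are
  -- isolated points.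
  item : (Ball × Bool) ⊎ Fin z → Coord d
  item (inj₁ (inj₁ c , b))       = at (toℕ (punchIn i₀ c)) (offset b)
  item (inj₁ (inj₂ (l , s) , b)) = shift l s (reach b) p
  item (inj₂ t)                  = at (suc k₀ + toℕ t) (λ _ → 0)

  zone : Ball ⊎ Fin z → ℕ
  zone (inj₁ (inj₁ c)) = toℕ (punchIn i₀ c)
  zone (inj₁ (inj₂ _)) = toℕ i₀
  zone (inj₂ t)        = suc k₀ + toℕ t

  private
    group : (Ball × Bool) ⊎ Fin z → Ball ⊎ Fin z
    group = Sum.map₁ proj₁

  zone< : ∀ i → zone i < suc k₀ + z
  zone< (inj₁ (inj₁ c)) = ≤-trans (Fin.toℕ<n (punchIn i₀ c)) (m≤m+n (suc k₀) z)
  zone< (inj₁ (inj₂ _)) = ≤-trans (Fin.toℕ<n i₀) (m≤m+n (suc k₀) z)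
  zone< (inj₂ t)        = +-monoʳ-< (suc k₀) (Fin.toℕ<n t)

  item∈zone : ∀ i → InZone (zone (group i)) (item i)
  item∈zone (inj₁ (inj₁ c , b))       = at-zone _ (offset b) λ l → ≤-trans (offset≤1 b l) (≤-trans 1≤M M≤H)
  item∈zone (inj₁ (inj₂ (l , s) , b)) = shift-zone _ ρ (λ l → ≤-trans (ρ≤ l) M≤H) l s (reach≤2H b)
  item∈zone (inj₂ t)                  = at-zone _ (λ _ → 0) λ _ → z≤n

  private
    centre∈zone : ∀ j → InZone (zone (inj₁ j)) (centre j)
    centre∈zone (inj₁ c)       = at-zone _ (λ _ → 32 * N * v) λ _ → ≤-trans
      (*-monoˡ-≤ v (*-monoˡ-≤ N (m≤m+n 32 32))) M≤H
    centre∈zone (inj₂ (l , s)) = shift-zone _ ρ (λ l → ≤-trans (ρ≤ l) M≤H) l s (≤-trans h≤H H≤2H)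

    p∈zone : InZone (toℕ i₀) p
    p∈zone = at-zone _ ρ λ l → ≤-trans (ρ≤ l) M≤H

    3h≤3H : (3 * h) ^ 2 ≤ (3 * H) ^ 2
    3h≤3H = ^2-mono-≤ (*-monoʳ-≤ 3 h≤H)

    0<X² : 0 < X * X
    0<X² = *-mono-≤ 0<X 0<X

    [r+w]²< : ∀ {D} → h ^ 2 ≤ D → (r + w) ^ 2 < D
    [r+w]²< = <-≤-trans (^-monoˡ-< 2 r+w<h)

    h²≤[3H]² : h ^ 2 ≤ (3 * H) ^ 2
    h²≤[3H]² = ≤-trans (^2-mono-≤ (m≤n*m h 3)) 3h≤3H

    zone≢i₀ : ∀ c → toℕ i₀ ≢ toℕ (punchIn i₀ c)
    zone≢i₀ c eq = Fin.punchInᵢ≢i i₀ c (sym (Fin.toℕ-injective eq))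

    zone≢T : ∀ (i : Fin (suc k₀)) t → toℕ i ≢ suc k₀ + toℕ {z} t
    zone≢T i t eq = <⇒≱ (Fin.toℕ<n i) (subst (suc k₀ ≤_) (sym eq) (m≤m+n (suc k₀) (toℕ t)))

    clusterZone : Ball → Fin (suc k₀)
    clusterZone (inj₁ c) = punchIn i₀ c
    clusterZone (inj₂ _) = i₀

    zone≡ : ∀ j → zone (inj₁ j) ≡ toℕ (clusterZone j)
    zone≡ (inj₁ c) = refl
    zone≡ (inj₂ _) = refl

    ball≢T : ∀ j t → zone (inj₁ j) ≢ zone (inj₂ t)
    ball≢T j t eq = zone≢T (clusterZone j) t (trans (sym (zone≡ j)) eq)

  -- The distance of `p` to every directional centre is exactly `h`, and `r + w < h`; the other
  -- centres lie in other zones.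
  p-far : ∀ j → (r + w) ^ 2 < D p (centre j)
  p-far (inj₁ c)       = [r+w]²< (≤-trans h²≤[3H]² (zone-far p (centre (inj₁ c)) (zone≢i₀ c) p∈zone (centre∈zone (inj₁ c))))
  p-far (inj₂ (l , s)) = [r+w]²< (coordinate≤D p (shift l s h p) l
    (≤-reflexive (sym (∣shift-∣ l s h p (h≤p l)))))

  t-far : ∀ t j → (r + w) ^ 2 < D (item (inj₂ t)) (centre j)
  t-far t j = [r+w]²< (≤-trans h²≤[3H]²
    (zone-far (item (inj₂ t)) (centre j) (≢-sym (ball≢T j t)) (item∈zone (inj₂ t)) (centre∈zone j)))

  p-near : D p (centre (inj₂ (Fin.zero , true))) ≤ h ^ 2
  p-near = ≤-trans (D-shift Fin.zero p (shift Fin.zero true h p) λ l l≢ → sym (shift-other true h p l≢))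
    (≤-reflexive (cong (_^ 2) (∣shift-∣ Fin.zero true h p (h≤p Fin.zero))))

  private
    far-zones : ∀ {i j} x y → i ≢ j → InZone i x → InZone j y → 4 * g ^ 2 < D x y
    far-zones x y i≢j x∈ y∈ = <-≤-trans (begin-strict
      4 * g ^ 2          ≡⟨ eq₁ X ⟩
      25600 * (X * X)    <⟨ *-monoˡ-< (X * X) {{>-nonZero 0<X²}} {25600} {36864} (m≤m+n 25601 11263) ⟩
      36864 * (X * X)    ≡⟨ eq₂ X ⟩
      (3 * h) ^ 2        ≤⟨ 3h≤3H ⟩
      (3 * H) ^ 2        ∎) (zone-far x y i≢j x∈ y∈)
      where
      eq₁ : ∀ X → 4 * (80 * X * (80 * X * 1)) ≡ 25600 * (X * X)
      eq₁ = solve-∀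
      eq₂ : ∀ X → 36864 * (X * X) ≡ 3 * (64 * X) * (3 * (64 * X) * 1)
      eq₂ = solve-∀

    -- Perpendicular beacons differ by a full reach in two coordinates, opposite ones by the sum of
    -- their reaches in one.
    far-directions : ∀ l s b l′ s′ b′ → (l , s) ≢ (l′ , s′) →
      4 * g ^ 2 < D (shift l s (reach b) p) (shift l′ s′ (reach b′) p)
    far-directions l s b l′ s′ b′ neq with l Fin.≟ l′
    ... | no l≢l′ = begin-strict
      4 * g ^ 2                          ≡⟨ eq₁ X ⟩
      25600 * (X * X)                    <⟨ *-monoˡ-< (X * X) {{>-nonZero 0<X²}} {25600} {26450} (m≤m+n 25601 849) ⟩
      26450 * (X * X)                    ≡⟨ eq₂ X ⟩
      (115 * X) ^ 2 + (115 * X) ^ 2      ≤⟨ +-mono-≤ (^2-mono-≤ (≤reach b)) (^2-mono-≤ (≤reach b′)) ⟩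
      reach b ^ 2 + reach b′ ^ 2         ≡⟨ cong₂ (λ m n → m ^ 2 + n ^ 2) (sym at-l) (sym at-l′) ⟩
      ∣ x l - y l ∣ ^ 2 + ∣ x l′ - y l′ ∣ ^ 2   ≤⟨ terms≤Σ (λ l → ∣ x l - y l ∣ ^ 2) l≢l′ ⟩
      D x y                              ∎
      where
      x = shift l s (reach b) p
      y = shift l′ s′ (reach b′) p
      eq₁ : ∀ X → 4 * (80 * X * (80 * X * 1)) ≡ 25600 * (X * X)
      eq₁ = solve-∀
      eq₂ : ∀ X → 26450 * (X * X) ≡ 115 * X * (115 * X * 1) + 115 * X * (115 * X * 1)
      eq₂ = solve-∀
      at-l : ∣ x l - y l ∣ ≡ reach b
      at-l = trans (cong (∣ x l -_∣) (shift-other s′ (reach b′) p l≢l′))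
        (trans (∣-∣-comm (x l) (p l)) (∣shift-∣ l s (reach b) p (reach≤p b l)))
      at-l′ : ∣ x l′ - y l′ ∣ ≡ reach b′
      at-l′ = trans (cong (∣_- y l′ ∣) (shift-other s (reach b) p (≢-sym l≢l′)))
        (∣shift-∣ l′ s′ (reach b′) p (reach≤p b′ l′))
    far-directions l s b .l s′ b′ neq | yes refl = begin-strict
      4 * g ^ 2                          ≡⟨ eq₁ X ⟩
      25600 * (X * X)                    <⟨ *-monoˡ-< (X * X) {{>-nonZero 0<X²}} {25600} {52900} (m≤m+n 25601 27299) ⟩
      52900 * (X * X)                    ≡⟨ eq₂ X ⟩
      (115 * X + 115 * X) ^ 2            ≤⟨ ^2-mono-≤ (+-mono-≤ (≤reach b) (≤reach b′)) ⟩
      (reach b + reach b′) ^ 2           ≤⟨ coordinate≤D x y l (opposite s s′ b b′ (neq ∘ cong (l ,_))) ⟩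
      D x y                              ∎
      where
      x = shift l s (reach b) p
      y = shift l s′ (reach b′) p
      eq₁ : ∀ X → 4 * (80 * X * (80 * X * 1)) ≡ 25600 * (X * X)
      eq₁ = solve-∀
      eq₂ : ∀ X → 52900 * (X * X) ≡ (115 * X + 115 * X) * ((115 * X + 115 * X) * 1)
      eq₂ = solve-∀
      apart : ∀ a a′ → a′ ≤ p l → shift l false a′ p l + (a + a′) ≤ shift l true a p l
      apart a a′ a′≤ = ≤-reflexive (trans (eq₃ (shift l false a′ p l) a a′)
        (trans (cong (_+ a) (shift-false l a′ p a′≤)) (sym (shift-true l a p))))
        where
        eq₃ : ∀ x a a′ → x + (a + a′) ≡ x + a′ + a
        eq₃ = solve-∀
      opposite : ∀ s s′ b b′ → s ≢ s′ →
        reach b + reach b′ ≤ ∣ shift l s (reach b) p l - shift l s′ (reach b′) p l ∣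
      opposite true  true  b b′ s≢ = contradiction refl s≢
      opposite false false b b′ s≢ = contradiction refl s≢
      opposite true  false b b′ s≢ = m+n≤o⇒n≤∣o-m∣ {shift l false (reach b′) p l} {reach b + reach b′}
        (apart (reach b) (reach b′) (reach≤p b′ l))
      opposite false true  b b′ s≢ = m+n≤o⇒n≤∣m-o∣ {shift l false (reach b) p l} {reach b + reach b′}
        (≤-trans (+-monoʳ-≤ (shift l false (reach b) p l) (≤-reflexive (+-comm (reach b) (reach b′))))
          (apart (reach b′) (reach b) (reach≤p b l)))

  far : ∀ i j → group i ≢ group j → 4 * g ^ 2 < D (item i) (item j)
  far i@(inj₁ (inj₁ c , b)) j@(inj₁ (inj₁ c′ , b′)) neq = far-zones (item i) (item j)
    (λ eq → neq (cong (inj₁ ∘ inj₁) (Fin.punchIn-injective i₀ c c′ (Fin.toℕ-injective eq)))) (item∈zone i) (item∈zone j)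
  far i@(inj₁ (inj₁ c , b)) j@(inj₁ (inj₂ _ , b′)) neq = far-zones (item i) (item j) (≢-sym (zone≢i₀ c)) (item∈zone i) (item∈zone j)
  far i@(inj₁ (inj₂ _ , b)) j@(inj₁ (inj₁ c , b′)) neq = far-zones (item i) (item j) (zone≢i₀ c) (item∈zone i) (item∈zone j)
  far (inj₁ (inj₂ (l , s) , b)) (inj₁ (inj₂ (l′ , s′) , b′)) neq =
    far-directions l s b l′ s′ b′ (neq ∘ cong (inj₁ ∘ inj₂))
  far i@(inj₁ (a , b)) j@(inj₂ t) neq = far-zones (item i) (item j) (ball≢T a t) (item∈zone i) (item∈zone j)
  far i@(inj₂ t) j@(inj₁ (a , b)) neq = far-zones (item i) (item j) (≢-sym (ball≢T a t)) (item∈zone i) (item∈zone j)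
  far i@(inj₂ t) j@(inj₂ t′) neq = far-zones (item i) (item j)
    (λ eq → neq (cong inj₂ (Fin.toℕ-injective (+-cancelˡ-≡ (suc k₀) _ _ eq)))) (item∈zone i) (item∈zone j)

  beacon≢ : ∀ j → ¬ (item (inj₁ (j , true)) ≗ item (inj₁ (j , false)))
  beacon≢ (inj₁ c) eq = contradiction
    (+-cancelˡ-≡ (base (toℕ (punchIn i₀ c)) Fin.zero) 0 1 (eq Fin.zero)) λ ()
  beacon≢ (inj₂ (l , s)) eq = contradiction
    (trans (sym (∣shift-shift∣ l s (reach true) (reach false) p (reach≤p true l) (reach≤p false l)))
      (m≡n⇒∣m-n∣≡0 (eq l)))
    λ eq → m≢1+n∸1 (h + r) (≤-trans 0<X (≤-trans (m≤n*m X 64) (m≤m+n h r))) (∣m-n∣≡0⇒m≡n eq)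
    where
    m≢1+n∸1 : ∀ m → 0 < m → m ≢ m ∸ 1
    m≢1+n∸1 (suc m) _ eq = 1+n≢n eq

  -- The centre of a cluster is within half its side in each coordinate. Even with √d estimated by d
  -- the distance is at most 32 X, below r.
  clusterCovered : ∀ i (σ : Coord d) → (∀ l → σ l ≤ 64 * N * v) → D (at i σ) (at i (λ _ → 32 * N * v)) ≤ r ^ 2
  clusterCovered i σ σ≤ = begin
    D (at i σ) (at i (λ _ → A))     ≤⟨ Σ≤ _ (A ^ 2) (λ l → ^2-mono-≤ (close l)) ⟩
    d * A ^ 2                       ≤⟨ m≤m+n (d * A ^ 2) (d′ * (d * A ^ 2)) ⟩
    d * (d * A ^ 2)                 ≡⟨ eq₁ d A ⟩
    (d * A) ^ 2                     ≤⟨ ^2-mono-≤ dA≤r ⟩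
    r ^ 2                           ∎
    where
    A = 32 * N * v
    eq₁ : ∀ d A → d * (d * (A * (A * 1))) ≡ d * A * (d * A * 1)
    eq₁ = solve-∀
    eq₂ : ∀ A → 2 * A ≡ A + A
    eq₂ = solve-∀
    A+A≡M : A + A ≡ M
    A+A≡M = eq N v
      where
      eq : ∀ N v → 32 * N * v + 32 * N * v ≡ 64 * N * v
      eq = solve-∀
    close : ∀ l → ∣ at i σ l - at i (λ _ → A) l ∣ ≤ A
    close l = subst (_≤ A) (sym (∣m+n-m+o∣≡∣n-o∣ (base i l) (σ l) A))
      (∣m-n∣≤ (subst (σ l ≤_) (sym A+A≡M) (σ≤ l)) (m≤n+m A (σ l)))
    dA≤r : d * A ≤ r
    dA≤r = +-cancelʳ-≤ (12 * v) (d * A) r (begin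
      d * A + 12 * v          ≡⟨ cong (_+ 12 * v) (eq d N v) ⟩
      32 * X + 12 * v         ≤⟨ +-monoʳ-≤ (32 * X) (*-mono-≤ (m≤m+n 12 20) v≤X) ⟩
      32 * X + 32 * X         ≡⟨ eq₃ X ⟩
      64 * X                  ≡⟨ sym r+12v≡h ⟩
      r + 12 * v              ∎)
      where
      eq : ∀ d N v → d * (32 * N * v) ≡ 32 * (d * N * v)
      eq = solve-∀
      eq₃ : ∀ X → 32 * X + 32 * X ≡ 64 * X
      eq₃ = solve-∀

  beaconCovered : ∀ j b → D (item (inj₁ (j , b))) (centre j) ≤ r ^ 2
  beaconCovered (inj₁ c) b = clusterCovered (toℕ (punchIn i₀ c)) (offset b) λ l → ≤-trans (offset≤1 b l) 1≤M
  beaconCovered (inj₂ (l , s)) b = begin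
    D x y                    ≤⟨ D-shift l x y (λ l′ l′≢ → trans (shift-other s (reach b) p l′≢) (sym (shift-other s h p l′≢))) ⟩
    ∣ x l - y l ∣ ^ 2        ≡⟨ cong (_^ 2) (∣shift-shift∣ l s (reach b) h p (reach≤p b l) (h≤p l)) ⟩
    ∣ reach b - h ∣ ^ 2      ≤⟨ ^2-mono-≤ (∣m-n∣≤ (reach≤ b) (≤-trans (≤-trans h≤115X (≤reach b)) (m≤m+n (reach b) r))) ⟩
    r ^ 2                    ∎
    where
    x = shift l s (reach b) p
    y = shift l s h p
    h≤115X : h ≤ 115 * X
    h≤115X = *-monoˡ-≤ X (m≤m+n 64 51)

  slotCovered : ∀ (i : Fin (suc k₀)) (σ : Coord d) → (∀ l → σ l ≤ 64 * N * v) →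
    (i ≡ i₀ → ∃[ l ] 24 * v ≤ ∣ σ l - ρ l ∣) → ∃[ j ] D (at (toℕ i) σ) (centre j) ≤ r ^ 2
  slotCovered i σ σ≤ apart with i₀ Fin.≟ i
  ... | no i₀≢i = inj₁ (Fin.punchOut i₀≢i) ,
    subst (λ c → D (at (toℕ i) σ) (at (toℕ c) (λ _ → 32 * N * v)) ≤ r ^ 2) (sym (Fin.punchIn-punchOut i₀≢i))
      (clusterCovered (toℕ i) σ σ≤)
  ... | yes refl = let l , s , le = directionalCover (at (toℕ i) σ) p M v h r small
                         (proj₁ (apart refl) , subst (24 * v ≤_) (sym (difference (proj₁ (apart refl)))) (proj₂ (apart refl)))
                         dM≡h r+12v≡h h≤p
                   in inj₂ (l , s) , le
    where
    difference : ∀ l → ∣ at (toℕ i) σ l - p l ∣ ≡ ∣ σ l - ρ l ∣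
    difference l = ∣m+n-m+o∣≡∣n-o∣ (base (toℕ i) l) (σ l) (ρ l)
    small : ∀ l → ∣ at (toℕ i) σ l - p l ∣ ≤ M
    small l = subst (_≤ M) (sym (difference l))
      (∣m-n∣≤ (≤-trans (σ≤ l) (m≤n+m M (ρ l))) (≤-trans (ρ≤ l) (m≤n+m M (σ l))))

  -- Needed because only absent points may be inserted. Directional beacons are farther from `p`
  -- than the side of its cluster; beacons of other clusters have first coordinate below 2.
  item≢slot : ∀ j (i : Fin (suc k₀)) (σ : Coord d) → (∀ l → σ l ≤ 64 * N * v) → 2 ≤ σ Fin.zero →
    ¬ (item j ≗ at (toℕ i) σ)
  item≢slot j i σ σ≤ 2≤σ eq with zone (group j) ≟ toℕ i
  ... | no zone≢ = <⇒≱ 0<3H (≤-trans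
      (zone-gap {x = item j} {at (toℕ i) σ} zone≢ (item∈zone j) (at-zone (toℕ i) σ λ l → ≤-trans (σ≤ l) M≤H))
      (≤-reflexive (m≡n⇒∣m-n∣≡0 (eq Fin.zero))))
    where
    0<3H : 0 < 3 * H
    0<3H = ≤-trans (≤-trans 1≤M M≤H) (m≤n*m H 3)
  ... | yes zone≡ = same j zone≡ eq
    where
    same : ∀ j → zone (group j) ≡ toℕ i → ¬ (item j ≗ at (toℕ i) σ)
    same (inj₂ t) z≡ eq = zone≢T i t (sym z≡)
    same (inj₁ (inj₁ c , b)) z≡ eq = <⇒≱ 2≤σ (subst (_≤ 1)
      (+-cancelˡ-≡ (base (toℕ i) Fin.zero) (offset b Fin.zero) (σ Fin.zero)
        (trans (cong (λ i → base i Fin.zero + offset b Fin.zero) (sym z≡)) (eq Fin.zero)))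
      (offset≤1 b Fin.zero))
    same (inj₁ (inj₂ (l , s) , b)) z≡ eq = <⇒≱ (M<reach b) (begin
      reach b                                  ≡⟨ sym (∣shift-∣ l s (reach b) p (reach≤p b l)) ⟩
      ∣ p l - shift l s (reach b) p l ∣        ≡⟨ cong (∣ p l -_∣) (trans (eq l) (cong (λ i → base i l + σ l) (sym z≡))) ⟩
      ∣ p l - base (toℕ i₀) l + σ l ∣          ≡⟨ ∣m+n-m+o∣≡∣n-o∣ (base (toℕ i₀) l) (ρ l) (σ l) ⟩
      ∣ ρ l - σ l ∣                            ≤⟨ ∣m-n∣≤ (≤-trans (ρ≤ l) (m≤n+m M (σ l))) (≤-trans (σ≤ l) (m≤n+m M (ρ l))) ⟩
      M                                        ∎)

-- Families of instances

module _ {d Δ : ℕ} {{_ : NonZero Δ}} where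

  -- Coordinates are reduced modulo Δ; only points of the grid are used.
  toPoint : Coord d → Point d Δ
  toPoint x = Vec.tabulate (λ l → x l mod Δ)

  coord-toPoint : ∀ x → (∀ l → x l < Δ) → coord (toPoint x) ≗ x
  coord-toPoint x x< l = begin
    toℕ (Vec.lookup (toPoint x) l)   ≡⟨ cong toℕ (Vec.lookup∘tabulate (λ l → x l mod Δ) l) ⟩
    toℕ (x l mod Δ)                  ≡⟨ Fin.toℕ-fromℕ< (m%n<n (x l) Δ) ⟩
    x l % Δ                          ≡⟨ m<n⇒m%n≡m (x< l) ⟩
    x l                              ∎
    where open ≡-Reasoning

  toPoint-injective : ∀ {x y} → (∀ l → x l < Δ) → (∀ l → y l < Δ) → toPoint x ≡ toPoint y → x ≗ y
  toPoint-injective {x} {y} x< y< eq l =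
    trans (sym (coord-toPoint x x< l)) (trans (cong (λ p → coord p l) eq) (coord-toPoint y y< l))

-- The level is the leading digit of a slot number, so later slots never have smaller scales and
-- deletion from the end removes the largest cells first.
quotient-mono : ∀ {m} n (i j : Fin (m * n)) → i Fin.< j → Fin.quotient {m} n i Fin.≤ Fin.quotient {m} n j
quotient-mono {m} n i j i<j = ≮⇒≥ λ q< → <⇒≱ i<j (<⇒≤
  (subst₂ Fin._<_ (Fin.combine-remQuot {m} n j) (Fin.combine-remQuot {m} n i)
    (Fin.combine-monoˡ-< (Fin.remainder {m} n j) (Fin.remainder {m} n i) q<)))

-- Clusters with cells at geometrically growing scales

module Instance (d′ N J k₀ z ℓ Δ H : ℕ) {{_ : NonZero Δ}} (0<N : 0 < N) (0<J : 0 < J)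
  (h≤H : ∀ j → j < J → 64 * (suc d′ * N * (8 ^ j * 2 ^ ℓ)) ≤ H)
  (H≤Δ : 8 * H * (suc k₀ + z) ≤ Δ)
  (ε : ℝ)
  (ε-h : ∀ v opt → opt ∈[0, ι (64 * (suc d′ * N * v)) ] → ε *ℝ opt ∈[0, ι (9 * v) ])
  (ε-g : ∀ v opt opt* → opt ∈[0, ι (64 * (suc d′ * N * v)) ] → 0ℝ ≤ℝ opt* → opt* ≤ℝ (1ℝ +ℝ ε) *ℝ opt →
    opt* ∈[0, ι (80 * (suc d′ * N * v)) ] × opt* +ℝ ε *ℝ opt ∈[0, ι (80 * (suc d′ * N * v)) ])
  {b words : ℕ} (A : Algorithm (suc d′) Δ b words)
  (maintains : MaintainsWeightRestrictedCoreset ε (k₀ + suc d′ * 2) z A)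
  where

  open Algorithm A using (run; coreset)
  open Zones d′ H
  open Cells d′ N

  private
    d = suc d′
    k = k₀ + d * 2

  n : ℕ
  n = J * (suc k₀ * N ^ d)

  Slot : Set
  Slot = Fin J × (Fin (suc k₀) × Vec (Fin N) d)

  private
    0<n : 0 < n
    0<n = *-mono-≤ 0<J (*-mono-≤ (s≤s (z≤n {k₀})) (m^n>0 N {{>-nonZero 0<N}} d))

    instance
      n≢0 : NonZero n
      n≢0 = >-nonZero 0<n

    slot↔ : Fin n ↔ Slot
    slot↔ = (↔-id _ ×-↔ ((↔-id _ ×-↔ Vec-↔ d (↔-id _)) ↔-∘ Fin.*↔×)) ↔-∘ Fin.*↔×

    slot : ℕ → Slot
    slot m = Inverse.to slot↔ (m mod n)

    level : Slot → ℕ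
    level (j , _) = toℕ j

    cluster : Slot → Fin (suc k₀)
    cluster (_ , i , _) = i

    opaque
      -- The factor `2 ^ ℓ` makes room for all offsets even in the smallest cells.
      scale : Slot → ℕ
      scale s = 8 ^ level s * 2 ^ ℓ

      0<scale : ∀ s → 0 < scale s
      0<scale s = *-mono-≤ (m^n>0 8 (level s)) (m^n>0 2 ℓ)

      u≤8scale : ∀ s (u : Fin (2 ^ ℓ)) → toℕ u ≤ 8 * scale s
      u≤8scale s u = ≤-trans (<⇒≤ (Fin.toℕ<n u))
        (≤-trans (m≤n*m (2 ^ ℓ) (8 ^ level s) {{m^n≢0 8 (level s)}}) (m≤n*m (scale s) 8))

      8*scale≤ : ∀ s s′ → level s < level s′ → 8 * scale s ≤ scale s′
      8*scale≤ s s′ lt = begin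
        8 * (8 ^ level s * 2 ^ ℓ)   ≡⟨ sym (*-assoc 8 (8 ^ level s) (2 ^ ℓ)) ⟩
        8 ^ suc (level s) * 2 ^ ℓ   ≤⟨ *-monoˡ-≤ (2 ^ ℓ) (^-monoʳ-≤ 8 lt) ⟩
        8 ^ level s′ * 2 ^ ℓ        ∎
        where open ≤-Reasoning

      scale-mono : ∀ s s′ → level s ≤ level s′ → scale s ≤ scale s′
      scale-mono s s′ le = *-monoˡ-≤ (2 ^ ℓ) (^-monoʳ-≤ 8 le)

      64dN*scale≤H : ∀ s → 64 * (d * N * scale s) ≤ H
      64dN*scale≤H (j , _) = h≤H (toℕ j) (Fin.toℕ<n j)

      scale-cong : ∀ s s′ → level s ≡ level s′ → scale s ≡ scale s′
      scale-cong s s′ eq = cong (λ j → 8 ^ j * 2 ^ ℓ) eq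

    64N*scale≤H : ∀ s → 64 * N * scale s ≤ H
    64N*scale≤H s = begin
      64 * N * scale s          ≡⟨ *-assoc 64 N (scale s) ⟩
      64 * (N * scale s)        ≤⟨ *-monoʳ-≤ 64 (*-monoˡ-≤ (scale s) (m≤m+n N (d′ * N))) ⟩
      64 * (d * N * scale s)    ≤⟨ 64dN*scale≤H s ⟩
      H                         ∎
      where open ≤-Reasoning

    inCluster : Slot → ℕ → Coord d
    inCluster s@(_ , _ , γ) u = cell (scale s) γ u

    position : Slot → ℕ → Coord d
    position s u = at (toℕ (cluster s)) (inCluster s u)

    place : ℕ → Fin (2 ^ ℓ) → Point d Δ
    place m u = toPoint (position (slot m) (toℕ u))

    toℕ-mod : ∀ {m} → m < n → toℕ (m mod n) ≡ m
    toℕ-mod {m} m<n = trans (Fin.toℕ-fromℕ< (m%n<n m n)) (m<n⇒m%n≡m m<n)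

    slot-injective : ∀ {m m′} → m < n → m′ < n → slot m ≡ slot m′ → m ≡ m′
    slot-injective {m} {m′} m<n m′<n eq = begin
      m              ≡⟨ sym (toℕ-mod m<n) ⟩
      toℕ (m mod n)  ≡⟨ cong toℕ (trans (sym (Inverse.strictlyInverseʳ slot↔ (m mod n)))
                          (trans (cong (Inverse.from slot↔) eq) (Inverse.strictlyInverseʳ slot↔ (m′ mod n)))) ⟩
      toℕ (m′ mod n) ≡⟨ toℕ-mod m′<n ⟩
      m′             ∎
      where open ≡-Reasoning

    level-mono : ∀ {m m′} → m < m′ → m′ < n → level (slot m) ≤ level (slot m′)
    level-mono {m} {m′} m<m′ m′<n = quotient-mono {J} (suc k₀ * N ^ d) (m mod n) (m′ mod n)
      (subst₂ _<_ (sym (toℕ-mod (<-trans m<m′ m′<n))) (sym (toℕ-mod m′<n)) m<m′)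

    inCluster≤ : ∀ s (u : Fin (2 ^ ℓ)) l → inCluster s (toℕ u) l ≤ 64 * N * scale s
    inCluster≤ s@(_ , _ , γ) u = cell≤ (scale s) γ (toℕ u) (u≤8scale s u)

    0<H : 0 < H
    0<H = ≤-trans (*-mono-≤ {1} {64} (m≤m+n 1 63) (*-mono-≤ (*-mono-≤ (s≤s (z≤n {d′})) 0<N)
      (*-mono-≤ (m^n>0 8 0) (m^n>0 2 ℓ)))) (h≤H 0 0<J)

    position∈zone : ∀ s (u : Fin (2 ^ ℓ)) → InZone (toℕ (cluster s)) (position s (toℕ u))
    position∈zone s u = at-zone (toℕ (cluster s)) (inCluster s (toℕ u)) λ l → ≤-trans (inCluster≤ s u l) (64N*scale≤H s)

    position<Δ : ∀ s (u : Fin (2 ^ ℓ)) l → position s (toℕ u) l < Δ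
    position<Δ s u = zone⇒<Δ (position s (toℕ u)) 0<H H≤Δ
      (≤-trans (Fin.toℕ<n (cluster s)) (m≤m+n (suc k₀) z)) (position∈zone s u)

    -- Different scales are separated by the first coordinate, equal scales by the cells. The gap is
    -- measured at the larger scale, which will be that of `p` and so determines the test radius.
    slots-apart : ∀ s′ s (u′ u : Fin (2 ^ ℓ)) → level s′ ≤ level s → s′ ≢ s → cluster s′ ≡ cluster s →
      ∃[ l ] 24 * scale s ≤ ∣ inCluster s′ (toℕ u′) l - inCluster s (toℕ u) l ∣
    slots-apart s′@(j′ , i′ , γ′) s@(j , i , γ) u′ u le s′≢s i′≡i = [ lower , same ]′ (m≤n⇒m<n∨m≡n le)
      where
      Apart : Set
      Apart = ∃[ l ] 24 * scale s ≤ ∣ cell (scale s′) γ′ (toℕ u′) l - cell (scale s) γ (toℕ u) l ∣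
      lower : level s′ < level s → Apart
      lower lt = Fin.zero ,
        cell-gap-scale γ γ′ (toℕ u) (toℕ u′) 0<N (8*scale≤ s′ s lt) (u≤8scale s′ u′)
      same : level s′ ≡ level s → Apart
      same eq = subst (λ v → ∃[ l ] 24 * scale s ≤ ∣ cell v γ′ (toℕ u′) l - cell (scale s) γ (toℕ u) l ∣)
        (sym (scale-cong s′ s eq))
        (cell-gap (scale s) γ′ γ (toℕ u′) (toℕ u)
          (λ γ′≡γ → s′≢s (cong₂ _,_ (Fin.toℕ-injective eq) (cong₂ _,_ i′≡i γ′≡γ))) (u≤8scale s u′) (u≤8scale s u))

    position≢ : ∀ s′ s (u′ u : Fin (2 ^ ℓ)) → level s′ ≤ level s → s′ ≢ s → ¬ (position s′ (toℕ u′) ≗ position s (toℕ u))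
    position≢ s′ s u′ u le s′≢s eq = decide (cluster s′ Fin.≟ cluster s)
      where
      decide : Dec (cluster s′ ≡ cluster s) → ⊥
      decide (no ≢i) = <⇒≱ (≤-trans 0<H (m≤n*m H 3)) (≤-trans
        (zone-gap {x = position s′ (toℕ u′)} {position s (toℕ u)} (≢i ∘ Fin.toℕ-injective) (position∈zone s′ u′) (position∈zone s u))
        (≤-reflexive (m≡n⇒∣m-n∣≡0 (eq Fin.zero))))
      decide (yes i≡) = let l , apart = slots-apart s′ s u′ u le s′≢s i≡ in
        <⇒≱ (≤-trans (0<scale s) (m≤n*m (scale s) 24)) (≤-trans apart (≤-reflexive (m≡n⇒∣m-n∣≡0
          (+-cancelˡ-≡ (base (toℕ (cluster s)) l) (inCluster s′ (toℕ u′) l) (inCluster s (toℕ u) l)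
            (trans (cong (λ i → base (toℕ i) l + inCluster s′ (toℕ u′) l) (sym i≡)) (eq l))))))

    slot≢ : ∀ {m m′} → m < m′ → m′ < n → slot m ≢ slot m′
    slot≢ m<m′ m′<n eq = <⇒≢ m<m′ (slot-injective (<-trans m<m′ m′<n) m′<n eq)

    place-injective : InjectivePlacement A place n
    place-injective {i} {j} {u} {v} i<n j<n eq = trichotomy (<-cmp i j)
      where
      trichotomy : Tri (i < j) (i ≡ j) (j < i) → i ≡ j × u ≡ v
      trichotomy (tri< i<j _ _) = ⊥-elim (position≢ (slot i) (slot j) u v (level-mono i<j j<n) (slot≢ i<j j<n)
        (toPoint-injective {x = position (slot i) (toℕ u)} {position (slot j) (toℕ v)}
          (position<Δ (slot i) u) (position<Δ (slot j) v) eq))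
      trichotomy (tri> _ _ j<i) = ⊥-elim (position≢ (slot j) (slot i) v u (level-mono j<i i<n) (slot≢ j<i i<n)
        (toPoint-injective {x = position (slot j) (toℕ v)} {position (slot i) (toℕ u)}
          (position<Δ (slot j) v) (position<Δ (slot i) u) (sym eq)))
      trichotomy (tri≈ _ i≡j _) = i≡j , Fin.toℕ-injective (cell-offset-injective (scale t) γ (toℕ u) (toℕ v)
        λ l → +-cancelˡ-≡ (base (toℕ (cluster t)) l) (inCluster t (toℕ u) l) (inCluster t (toℕ v) l)
          (toPoint-injective {x = position t (toℕ u)} {position t (toℕ v)} (position<Δ t u) (position<Δ t v)
            (trans eq (cong (λ m → place m v) (sym i≡j))) l))
        where
        t = slot i
        γ = proj₂ (proj₂ t)

    -- The beacons are placed around `place m u`, but both streams receive them, so they have to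
    -- avoid `place m v` as well. Equal memories then give one coreset `C` of both `P` and `Q`.
    module Distinguish {m : ℕ} (m<n : m < n) (u v : Fin (2 ^ ℓ)) (u≢v : u ≢ v) (us vs : Vec (Fin (2 ^ ℓ)) m)
      (σ : Stream (place m u ∷ placed A place us)) (τ : Stream (place m v ∷ placed A place vs))
      (σ≡τ : run σ ≡ run τ) where

      t = slot m

      open Configuration d′ N H (scale t) k₀ z 0<N (0<scale t) (64dN*scale≤H t)
        (cluster t) (inCluster t (toℕ u)) (inCluster≤ t u)

      _≟ᴮ_ : DecidableEquality Ball
      _≟ᴮ_ = Sum.≡-dec Fin._≟_ (Product.≡-dec Fin._≟_ Bool._≟_)

      Ball↔ : Fin k ↔ Ball
      Ball↔ = (↔-id _ ⊎-↔ ((↔-id _ ×-↔ Fin.2↔Bool) ↔-∘ Fin.*↔×)) ↔-∘ Fin.+↔⊎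

      Item↔ : Fin (k * 2 + z) ↔ ((Ball × Bool) ⊎ Fin z)
      Item↔ = (((Ball↔ ×-↔ Fin.2↔Bool) ↔-∘ Fin.*↔×) ⊎-↔ ↔-id _) ↔-∘ Fin.+↔⊎

      item<Δ : ∀ i l → item i l < Δ
      item<Δ i = zone⇒<Δ (item i) 0<H H≤Δ (zone< (Sum.map₁ proj₁ i)) (item∈zone i)

      itemᴾ : (Ball × Bool) ⊎ Fin z → Point d Δ
      itemᴾ i = toPoint (item i)

      coord-item : ∀ i → coord (itemᴾ i) ≗ item i
      coord-item i = coord-toPoint (item i) (item<Δ i)

      coord-place : ∀ m (u : Fin (2 ^ ℓ)) → coord (place m u) ≗ position (slot m) (toℕ u)
      coord-place m u = coord-toPoint (position (slot m) (toℕ u)) (position<Δ (slot m) u)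

      farᴾ : ∀ i j → Sum.map₁ proj₁ i ≢ Sum.map₁ proj₁ j → 4 * g ^ 2 < D (coord (itemᴾ i)) (coord (itemᴾ j))
      farᴾ i j neq = subst (4 * g ^ 2 <_) (sym (D-cong (coord-item i) (coord-item j))) (far i j neq)

      beacon≢ᴾ : ∀ j → itemᴾ (inj₁ (j , true)) ≢ itemᴾ (inj₁ (j , false))
      beacon≢ᴾ j eq = beacon≢ j (toPoint-injective (item<Δ (inj₁ (j , true))) (item<Δ (inj₁ (j , false))) eq)

      itemᴾ≢place : ∀ i {m′} (u′ : Fin (2 ^ ℓ)) → m′ ≤ m → itemᴾ i ≢ place m′ u′
      itemᴾ≢place i {m′} u′ m′≤m eq = item≢slot i (cluster s) (inCluster s (toℕ u′))
        (λ l → ≤-trans (inCluster≤ s u′ l) (*-monoʳ-≤ (64 * N) (scale-mono s t le)))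
        (≤-trans (*-mono-≤ (*-mono-≤ {2} {32} (m≤m+n 2 30) (0<scale s)) 0<N)
          (32vN≤cell (scale s) (proj₂ (proj₂ s)) (toℕ u′)))
        (toPoint-injective (item<Δ i) (position<Δ s u′) eq)
        where
        s = slot m′
        le : level s ≤ level t
        le = [ (λ lt → level-mono lt m<n) , (λ eq → ≤-reflexive (cong (level ∘ slot) eq)) ]′ (m≤n⇒m<n∨m≡n m′≤m)

      inserted : List (Point d Δ)
      inserted = List.tabulate (itemᴾ ∘ Inverse.to Item↔)

      inserted-unique : Unique inserted
      inserted-unique = Unique.tabulate⁺ λ {i} {j} eq → trans (sym (Inverse.strictlyInverseʳ Item↔ i))
        (trans (cong (Inverse.from Item↔) (Items.item-injective {g = g} _≟ᴮ_ itemᴾ farᴾ beacon≢ᴾ {Inverse.to Item↔ i} {Inverse.to Item↔ j} eq))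
          (Inverse.strictlyInverseʳ Item↔ j))

      ∈inserted⁻ : ∀ {x} → x ∈ inserted → ∃[ i ] x ≡ itemᴾ i
      ∈inserted⁻ x∈ = let i , eq = ∈-tabulate⁻ x∈ in Inverse.to Item↔ i , eq

      unique : ∀ u us → Unique (inserted ++ place m u ∷ placed A place us)
      unique u us = Unique.++⁺ inserted-unique (placed-unique A place place-injective m<n (u ∷ us))
        λ (x∈ , y∈) → let i , eq = ∈inserted⁻ x∈
                          m′ , u′ , m′< , eq′ = ∈-placed A place (u ∷ us) y∈
                      in itemᴾ≢place i u′ (≤-pred m′<) (trans (sym eq) eq′)

      P Q : List (Point d Δ)
      P = inserted ++ place m u ∷ placed A place us
      Q = inserted ++ place m v ∷ placed A place vs

      C : Weighted d Δ
      C = coreset (run (extend inserted (unique u us) σ))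

      C-coreset : IsCoreset ε k z (unweighted P) C
      C-coreset = proj₁ (maintains (extend inserted (unique u us) σ))

      C-coreset′ : IsCoreset ε k z (unweighted Q) C
      C-coreset′ = subst (IsCoreset ε k z (unweighted Q) ∘ coreset)
        (sym (run-extend A inserted (unique u us) (unique v vs) σ τ σ≡τ))
        (proj₁ (maintains (extend inserted (unique v vs) τ)))

      p∉Q : place m u ∉ Q
      p∉Q x∈ = split (∈-++⁻ inserted x∈)
        where
        split : place m u ∈ inserted ⊎ place m u ∈ place m v ∷ placed A place vs → ⊥
        split (inj₁ x∈X)          = let i , eq = ∈inserted⁻ x∈X in itemᴾ≢place i u ≤-refl (sym eq)
        split (inj₂ (here eq))    = u≢v (proj₂ (place-injective m<n m<n eq))
        split (inj₂ (there x∈vs)) = placed-∉ A place place-injective vs m<n x∈vs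

      p∉C : place m u ∉ points C
      p∉C x∈ = p∉Q (∈-unweighted⁻ (proj₁ (proj₂ C-coreset′) x∈))

      item∈P : ∀ i → itemᴾ i ∈ P
      item∈P i = ∈-++⁺ˡ (subst (λ i → itemᴾ i ∈ inserted) (Inverse.strictlyInverseˡ Item↔ i)
        (∈-tabulate⁺ {f = itemᴾ ∘ Inverse.to Item↔} (Inverse.from Item↔ i)))

      Covered : Point d Δ → Set
      Covered x = ∃[ j ] D (coord x) (centre j) ≤ r ^ 2

      covered-item : ∀ i → (∀ a → i ≢ inj₂ a) → Covered (itemᴾ i)
      covered-item (inj₂ a)       i≢ = contradiction refl (i≢ a)
      covered-item (inj₁ (j , b)) _  = j , subst (_≤ r ^ 2)
        (sym (D-congˡ (centre j) (coord-item (inj₁ (j , b))))) (beaconCovered j b)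

      covered-placed : ∀ {m′} (u′ : Fin (2 ^ ℓ)) → m′ < m → Covered (place m′ u′)
      covered-placed {m′} u′ m′<m = let j , le = slotCovered (cluster s) (inCluster s (toℕ u′))
                                                  (λ l → ≤-trans (inCluster≤ s u′ l) (*-monoʳ-≤ (64 * N) (scale-mono s t lv)))
                                                  (slots-apart s t u′ u lv (slot≢ m′<m m<n))
        in j , subst (_≤ r ^ 2) (sym (D-congˡ (centre j) (coord-place m′ u′))) le
        where
        s = slot m′
        lv = level-mono m′<m m<n

      covered : ∀ {x} → x ∈ P → x ≢ place m u → (∀ a → x ≢ itemᴾ (inj₂ a)) → Covered x
      covered {x} x∈ x≢p x≢t = split (∈-++⁻ inserted x∈)
        where
        split : x ∈ inserted ⊎ x ∈ place m u ∷ placed A place us → Covered x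
        split (inj₁ x∈X) = let i , eq = ∈inserted⁻ x∈X in
          subst Covered (sym eq) (covered-item i λ a i≡ → x≢t a (trans eq (cong itemᴾ i≡)))
        split (inj₂ (here eq))    = contradiction eq x≢p
        split (inj₂ (there x∈us)) = let m′ , u′ , m′<m , eq = ∈-placed A place us x∈us in
          subst Covered (sym eq) (covered-placed u′ m′<m)

      open Separation Ball↔ _≟ᴮ_ P (unique u us) h r w g centre itemᴾ item∈P
        (place m u) (∈-++⁺ʳ inserted (here refl)) (λ a eq → itemᴾ≢place (inj₂ a) u ≤-refl (sym eq)) r≤h
        (inj₂ (Fin.zero , true) , subst (_≤ h ^ 2) (sym (D-congˡ (centre (inj₂ (Fin.zero , true))) (coord-place m u))) p-near)
        covered
        (λ j → subst ((r + w) ^ 2 <_) (sym (D-congˡ (centre j) (coord-place m u))) (p-far j))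
        (λ a j → subst ((r + w) ^ 2 <_) (sym (D-congˡ (centre j) (coord-item (inj₂ a)))) (t-far a j))
        farᴾ beacon≢ᴾ ε (ε-h (scale t)) (ε-g (scale t))

      impossible : ⊥
      impossible = p∈coreset {C} C-coreset p∉C

  slotBound : ℓ * n ≤ b * words
  slotBound = memoryBound ℓ n {b} {words} (↔-id _) (λ us → run (stream us)) injective
    where
    stream : (us : Vec (Fin (2 ^ ℓ)) n) → Stream (placed A place us)
    stream us = placedStream A place place-injective ≤-refl us
    injective : Injective _≡_ _≡_ λ us → run (stream us)
    injective {us} {vs} eq = decide (Vec.≡-dec Fin._≟_ us vs)
      where
      decide : Dec (us ≡ vs) → us ≡ vs
      decide (yes us≡vs) = us≡vs
      decide (no us≢vs)  = let m , u , v , us′ , vs′ , m<n , u≢v , σ , τ , σ≡τ =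
                                 lastDifference A place place-injective ≤-refl us vs us≢vs
                                   Fin._≟_ (stream us) (stream vs) eq
                           in ⊥-elim (Distinguish.impossible m<n u v u≢v us′ vs′ σ τ σ≡τ)

-- One point in each of k + z blocks on the first axis

module Blocks (d′ k z ℓ Δ : ℕ) {{_ : NonZero Δ}} (blocks≤Δ : 2 ^ ℓ * (suc (suc k) + z) ≤ Δ)
  {ε e} (ε∈ : ε ∈[0, e ])
  {b words : ℕ} (A : Algorithm (suc d′) Δ b words)
  (maintains : MaintainsWeightRestrictedCoreset ε (suc (suc k)) z A)
  where

  open Algorithm A using (run; coreset)

  private
    n = suc (suc k) + z
    L = 2 ^ ℓ

    position : ℕ → ℕ → Coord (suc d′)
    position m u Fin.zero    = L * m + u
    position m u (Fin.suc _) = 0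

    position< : ∀ m (u : Fin L) → L * m + toℕ u < L * suc m
    position< m u = subst (L * m + toℕ u <_) (trans (+-comm (L * m) L) (sym (*-suc L m)))
      (+-monoʳ-< (L * m) (Fin.toℕ<n u))

    0<Δ : 0 < Δ
    0<Δ = >-nonZero⁻¹ Δ

    position<Δ : ∀ {m} → m < n → ∀ (u : Fin L) l → position m (toℕ u) l < Δ
    position<Δ {m} m<n u Fin.zero    = <-≤-trans (position< m u) (≤-trans (*-monoʳ-≤ L m<n) blocks≤Δ)
    position<Δ     m<n u (Fin.suc l) = 0<Δ

    position-injective : ∀ m m′ (u u′ : Fin L) → L * m + toℕ u ≡ L * m′ + toℕ u′ → m ≡ m′ × u ≡ u′
    position-injective m m′ u u′ eq = trichotomy (<-cmp m m′)
      where
      differ : ∀ {m m′} (u u′ : Fin L) → m < m′ → L * m + toℕ u ≢ L * m′ + toℕ u′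
      differ {m} {m′} u u′ m<m′ = <⇒≢ (<-≤-trans (position< m u) (≤-trans (*-monoʳ-≤ L m<m′) (m≤m+n (L * m′) (toℕ u′))))
      trichotomy : Tri (m < m′) (m ≡ m′) (m′ < m) → m ≡ m′ × u ≡ u′
      trichotomy (tri< m<m′ _ _) = ⊥-elim (differ u u′ m<m′ eq)
      trichotomy (tri> _ _ m′<m) = ⊥-elim (differ u′ u m′<m (sym eq))
      trichotomy (tri≈ _ refl _) = refl , Fin.toℕ-injective (+-cancelˡ-≡ (L * m) (toℕ u) (toℕ u′) eq)

    place : ℕ → Fin L → Point (suc d′) Δ
    place m u = toPoint (position m (toℕ u))

    place-injective : InjectivePlacement A place n
    place-injective {i} {j} {u} {v} i<n j<n eq = position-injective i j u v
      (toPoint-injective {x = position i (toℕ u)} {position j (toℕ v)} (position<Δ i<n u) (position<Δ j<n v) eq Fin.zero)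

    stream : (us : Vec (Fin L) n) → Stream (placed A place us)
    stream us = placedStream A place place-injective ≤-refl us

    injective : Injective _≡_ _≡_ λ us → run (stream us)
    injective {us} {vs} eq = decide (Vec.≡-dec Fin._≟_ us vs)
      where
      decide : Dec (us ≡ vs) → us ≡ vs
      decide (yes us≡vs) = us≡vs
      decide (no us≢vs)  =
        let p , p∈us , p∉vs = placed-difference A place place-injective Fin._≟_ ≤-refl us vs us≢vs
            C-coreset       = subst (λ M → IsCoreset ε (suc (suc k)) z (unweighted (placed A place vs)) (coreset M))
                                (sym eq) (proj₁ (maintains (stream vs)))
        in ⊥-elim (all∈coreset {ε = ε} {e} {k} {z} {placed A place us} {coreset (run (stream us))}
             (placed-unique A place place-injective ≤-refl us) (length-placed A place us) ε∈
             (proj₁ (maintains (stream us))) (proj₂ (maintains (stream us))) {p} p∈us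
             (λ p∈C → p∉vs (∈-unweighted⁻ (proj₁ (proj₂ C-coreset) p∈C))))

  blockBound : ℓ * n ≤ b * words
  blockBound = memoryBound ℓ n {b} {words} (↔-id _) (λ us → run (stream us)) injective

-- Choice of the parameters

^2-cancel-≤ : ∀ {m n} → m ^ 2 ≤ n ^ 2 → m ≤ n
^2-cancel-≤ m²≤n² = ≮⇒≥ λ n<m → <⇒≱ (^-monoˡ-< 2 n<m) m²≤n²

*-^2 : ∀ m n → (m * n) ^ 2 ≡ m ^ 2 * n ^ 2
*-^2 = eq
  where
  eq : ∀ m n → m * n * (m * n * 1) ≡ m * (m * 1) * (n * (n * 1))
  eq = solve-∀

^-distrib-* : ∀ m n o → (m * n) ^ o ≡ m ^ o * n ^ o
^-distrib-* m n zero    = refl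
^-distrib-* m n (suc o) = trans (cong (m * n *_) (^-distrib-* m n o)) (eq m n (m ^ o) (n ^ o))
  where
  eq : ∀ m n p q → m * n * (p * q) ≡ m * p * (n * q)
  eq = solve-∀

<⌈log₂⌉⇒2^≤ : ∀ {m n} → m < ⌈log₂ n ⌉ → 2 ^ m ≤ n
<⌈log₂⌉⇒2^≤ {m} {n} m< = ≮⇒≥ λ n<2^m →
  <⇒≱ m< (≤-trans (⌈log₂⌉-mono-≤ (<⇒≤ n<2^m)) (≤-reflexive (⌈log₂2^n⌉≡n m)))

n≤2^⌈log₂n⌉ : ∀ n → n ≤ 2 ^ ⌈log₂ n ⌉
n≤2^⌈log₂n⌉ = <-rec (λ n → n ≤ 2 ^ ⌈log₂ n ⌉) step
  where
  step : ∀ n → (∀ {m} → m < n → m ≤ 2 ^ ⌈log₂ m ⌉) → n ≤ 2 ^ ⌈log₂ n ⌉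
  step 0             _   = z≤n
  step 1             _   = m^n>0 2 ⌈log₂ 1 ⌉
  step n@(suc (suc n′)) rec = begin
    n                          ≡⟨ sym (⌊n/2⌋+⌈n/2⌉≡n n) ⟩
    ⌊ n /2⌋ + ⌈ n /2⌉          ≤⟨ +-monoˡ-≤ ⌈ n /2⌉ (⌊n/2⌋≤⌈n/2⌉ n) ⟩
    ⌈ n /2⌉ + ⌈ n /2⌉          ≡⟨ cong (⌈ n /2⌉ +_) (sym (+-identityʳ ⌈ n /2⌉)) ⟩
    2 * ⌈ n /2⌉                ≤⟨ *-monoʳ-≤ 2 (rec (⌈n/2⌉<n n′)) ⟩
    2 ^ suc ⌈log₂ ⌈ n /2⌉ ⌉    ≡⟨ cong (λ l → 2 ^ suc l) (⌈log₂⌈n/2⌉⌉≡⌈log₂n⌉∸1 n) ⟩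
    2 ^ suc (⌈log₂ n ⌉ ∸ 1)    ≡⟨ cong (2 ^_) (m+[n∸m]≡n {1} (⌈log₂⌉-mono-≤ {2} {n} (s≤s (s≤s z≤n)))) ⟩
    2 ^ ⌈log₂ n ⌉              ∎
    where open ≤-Reasoning

-- 2592 = 2 · 36² comes from the slots when ⌈log₂ Δ ⌉ ≥ 25, the second summand
-- covers the boundedly many remaining Δ, and 4 is the contribution of z.
constant : ℕ → ℕ
constant d = 2592 * d * (24 * d) ^ d + 96 * (2 ^ 15) ^ d + 4

module Bounds (d′ κ k₀ z N Δ : ℕ) {{_ : NonZero Δ}} (0<N : 0 < N) (ε : ℝ) {e} (ε∈ : ε ∈[0, e ])
  (ε-h : ∀ v opt → opt ∈[0, ι (64 * (suc d′ * N * v)) ] → ε *ℝ opt ∈[0, ι (9 * v) ])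
  (ε-g : ∀ v opt opt* → opt ∈[0, ι (64 * (suc d′ * N * v)) ] → 0ℝ ≤ℝ opt* → opt* ≤ℝ (1ℝ +ℝ ε) *ℝ opt →
    opt* ∈[0, ι (80 * (suc d′ * N * v)) ] × opt* +ℝ ε *ℝ opt ∈[0, ι (80 * (suc d′ * N * v)) ])
  where

  private
    d = suc d′
    k = k₀ + d * 2
    logΔ = ⌈log₂ Δ ⌉
    Y = d * N * (2 * k + z)

  module _ (Y²≤Δ : Y ^ 2 ≤ Δ) {b words : ℕ} (b≤ : b ≤ κ * logΔ) (A : Algorithm d Δ b words)
    (maintains : MaintainsWeightRestrictedCoreset ε k z A) where

    private
      open ≤-Reasoning

      0<dN : 0 < d * N
      0<dN = *-mono-≤ (s≤s (z≤n {d′})) 0<N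

      2≤k : 2 ≤ k
      2≤k = ≤-trans (*-monoˡ-≤ 2 (s≤s (z≤n {d′}))) (m≤n+m (d * 2) k₀)

      2k+z≤Y : 2 * k + z ≤ Y
      2k+z≤Y = m≤n*m (2 * k + z) (d * N) {{>-nonZero 0<dN}}

      -- `Y ≥ 2 k ≥ 4` gives Δ ≥ 16. It ensures that a block holds at least one bit.
      3≤λ : 3 ≤ logΔ
      3≤λ = ≮⇒≥ λ λ<3 → <⇒≱ {4} {16} (m≤m+n 5 11) (begin
        4 ^ 2       ≤⟨ ^2-mono-≤ (≤-trans (*-monoʳ-≤ 2 2≤k) (≤-trans (m≤m+n (2 * k) z) 2k+z≤Y)) ⟩
        Y ^ 2       ≤⟨ Y²≤Δ ⟩
        Δ           ≤⟨ n≤2^⌈log₂n⌉ Δ ⟩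
        2 ^ logΔ      ≤⟨ ^-monoʳ-≤ 2 (≤-pred λ<3) ⟩
        2 ^ 2       ∎)

      -- After squaring, `2 ^ (m + m)` and `x ^ 2` each fit into one factor Δ.
      ≤Δ : ∀ m {x} → m + m < logΔ → x ≤ Y → 2 ^ m * x ≤ Δ
      ≤Δ m {x} 2m< x≤Y = ^2-cancel-≤ (begin
        (2 ^ m * x) ^ 2       ≡⟨ *-^2 (2 ^ m) x ⟩
        (2 ^ m) ^ 2 * x ^ 2   ≡⟨ cong (_* x ^ 2) (eq (2 ^ m)) ⟩
        2 ^ m * 2 ^ m * x ^ 2 ≡⟨ cong (_* x ^ 2) (sym (^-distribˡ-+-* 2 m m)) ⟩
        2 ^ (m + m) * x ^ 2   ≤⟨ *-mono-≤ (<⌈log₂⌉⇒2^≤ {m + m} {Δ} 2m<) (≤-trans (^2-mono-≤ x≤Y) Y²≤Δ) ⟩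
        Δ * Δ                 ≡⟨ eq Δ ⟨
        Δ ^ 2                 ∎)
        where
        eq : ∀ a → a * (a * 1) ≡ a * a
        eq = solve-∀

      b*words≤ : b * words ≤ κ * logΔ * words
      b*words≤ = *-monoˡ-≤ words b≤

      -- The largest value with `ℓ + ℓ < logΔ`, as `≤Δ` demands.
      ℓ : ℕ
      ℓ = pred logΔ ℕ./ 2

      λ≡ : logΔ ≡ suc (pred logΔ)
      λ≡ = sym (suc-pred logΔ {{>-nonZero (≤-trans (s≤s z≤n) 3≤λ)}})

      ℓ+ℓ<λ : ℓ + ℓ < logΔ
      ℓ+ℓ<λ = begin-strict
        ℓ + ℓ        ≡⟨ eq ℓ ⟩
        ℓ * 2        ≤⟨ m/n*n≤m (pred logΔ) 2 ⟩
        pred logΔ      <⟨ ≤-reflexive (sym λ≡) ⟩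
        logΔ           ∎
        where
        eq : ∀ a → a + a ≡ a * 2
        eq = solve-∀

      λ≤2+2ℓ : logΔ ≤ 2 + ℓ * 2
      λ≤2+2ℓ = begin
        logΔ                                ≡⟨ λ≡ ⟩
        1 + pred logΔ                       ≡⟨ cong suc (m≡m%n+[m/n]*n (pred logΔ) 2) ⟩
        1 + (pred logΔ % 2 + ℓ * 2)         ≤⟨ s≤s (+-monoˡ-≤ (ℓ * 2) (≤-pred (m%n<n (pred logΔ) 2))) ⟩
        2 + ℓ * 2                         ∎

      0<ℓ : 0 < ℓ
      0<ℓ = positive ℓ (≤-trans 3≤λ λ≤2+2ℓ)
        where
        positive : ∀ ℓ → 3 ≤ 2 + ℓ * 2 → 0 < ℓ
        positive zero    (s≤s (s≤s ()))
        positive (suc ℓ) _ = s≤s z≤n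

      λ≤4ℓ : logΔ ≤ 4 * ℓ
      λ≤4ℓ = begin
        logΔ                 ≤⟨ λ≤2+2ℓ ⟩
        2 + ℓ * 2          ≤⟨ +-monoˡ-≤ (ℓ * 2) (*-monoˡ-≤ 2 0<ℓ) ⟩
        ℓ * 2 + ℓ * 2      ≡⟨ eq ℓ ⟩
        4 * ℓ              ∎
        where
        eq : ∀ a → a * 2 + a * 2 ≡ 4 * a
        eq = solve-∀

      k″ : ℕ
      k″ = k ∸ 2

      k≡ : k ≡ suc (suc k″)
      k≡ = sym (m+[n∸m]≡n 2≤k)

      blocks : ℓ * (k + z) ≤ b * words
      blocks = subst (λ k → ℓ * (k + z) ≤ b * words) (sym k≡)
        (Blocks.blockBound d′ k″ z ℓ Δ
          (subst (λ k → 2 ^ ℓ * (k + z) ≤ Δ) k≡ (≤Δ ℓ ℓ+ℓ<λ (≤-trans (+-monoˡ-≤ z (m≤n*m k 2)) 2k+z≤Y)))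
          {ε} {e} ε∈ {b} {words} A
          (subst (λ k → MaintainsWeightRestrictedCoreset ε k z A) k≡ maintains))

    -- A block stores at least `logΔ / 4` bits, which cancels the length of a word. Besides the z
    -- term this supplies the factor k for `small`.
    k+z≤ : k + z ≤ 4 * κ * words
    k+z≤ = *-cancelˡ-≤ ℓ {{>-nonZero 0<ℓ}} (begin
      ℓ * (k + z)              ≤⟨ blocks ⟩
      b * words                ≤⟨ b*words≤ ⟩
      κ * logΔ * words           ≤⟨ *-monoˡ-≤ words (*-monoʳ-≤ κ λ≤4ℓ) ⟩
      κ * (4 * ℓ) * words      ≡⟨ eq κ ℓ words ⟩
      ℓ * (4 * κ * words)      ∎)
      where
      eq : ∀ κ ℓ s → κ * (4 * ℓ) * s ≡ ℓ * (4 * κ * s)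
      eq = solve-∀

    private
      -- The largest number of scales with `2 * (6 * t + 6) < logΔ`, or 0. A zone takes up
      -- `8 * H = 2 ^ (6 * t + 6) * (d * N)`, where 3 t of the exponent comes from the scales and 3
      -- t from the offsets.
      t : ℕ
      t = (logΔ ∸ 13) ℕ./ 12

      λ≤24+12t : logΔ ≤ 24 + t * 12
      λ≤24+12t = begin
        logΔ                                          ≤⟨ m≤n+m∸n logΔ 13 ⟩
        13 + (logΔ ∸ 13)                              ≡⟨ cong (13 +_) (m≡m%n+[m/n]*n (logΔ ∸ 13) 12) ⟩
        13 + ((logΔ ∸ 13) % 12 + t * 12)              ≤⟨ +-monoʳ-≤ 13 (+-monoˡ-≤ (t * 12) (≤-pred (m%n<n (logΔ ∸ 13) 12))) ⟩
        24 + t * 12                                 ∎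

      -- With t scales and 2 ^ (3 t) positions per cell, each of the k / ε ^ d
      -- cells contributes t · 3 t bits, which is of order log² Δ.
      large : ∀ t′ → t ≡ suc t′ → k * (24 * (d * N)) ^ d * logΔ ≤ 2592 * d * (24 * d) ^ d * (κ * words)
      large t′ t≡ = begin
        k * (24 * (d * N)) ^ d * logΔ                   ≤⟨ *-monoˡ-≤ logΔ (*-monoˡ-≤ ((24 * (d * N)) ^ d) k≤) ⟩
        2 * d * suc k₀ * (24 * (d * N)) ^ d * logΔ      ≡⟨ cong (λ p → 2 * d * suc k₀ * p * logΔ)
                                                          (trans (cong (_^ d) (sym (*-assoc 24 d N))) (^-distrib-* (24 * d) N d)) ⟩
        2 * d * suc k₀ * ((24 * d) ^ d * N ^ d) * logΔ  ≡⟨ eq₁ d (suc k₀) ((24 * d) ^ d) (N ^ d) logΔ ⟩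
        2 * d * (24 * d) ^ d * (logΔ * G)               ≤⟨ *-monoʳ-≤ (2 * d * (24 * d) ^ d) λG≤ ⟩
        2 * d * (24 * d) ^ d * (1296 * (κ * words))   ≡⟨ eq₂ d ((24 * d) ^ d) (κ * words) ⟩
        2592 * d * (24 * d) ^ d * (κ * words)         ∎
        where
        G = suc k₀ * N ^ d
        T = suc t′
        eq₁ : ∀ d K p q l → 2 * d * K * (p * q) * l ≡ 2 * d * p * (l * (K * q))
        eq₁ = solve-∀
        eq₂ : ∀ d p s → 2 * d * p * (1296 * s) ≡ 2592 * d * p * s
        eq₂ = solve-∀
        k≤ : k ≤ 2 * d * suc k₀
        k≤ = ≤-trans (+-monoˡ-≤ (d * 2) (m≤n*m k₀ (2 * d))) (≤-reflexive (eq k₀ d))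
          where
          eq : ∀ k₀ d → 2 * d * k₀ + d * 2 ≡ 2 * d * (1 + k₀)
          eq = solve-∀
        λ≤36T : logΔ ≤ 36 * T
        λ≤36T = begin
          logΔ                    ≤⟨ λ≤24+12t ⟩
          24 + t * 12           ≡⟨ cong (λ t → 24 + t * 12) t≡ ⟩
          24 + T * 12           ≤⟨ m≤m+n (24 + T * 12) (24 * t′) ⟩
          24 + T * 12 + 24 * t′ ≡⟨ eq t′ ⟩
          36 * T                ∎
          where
          eq : ∀ t′ → 24 + (1 + t′) * 12 + 24 * t′ ≡ 36 * (1 + t′)
          eq = solve-∀
        12T+12<λ : 6 * T + 6 + (6 * T + 6) < logΔ
        12T+12<λ = begin-strict
          6 * T + 6 + (6 * T + 6)   ≡⟨ eq T ⟩
          12 + T * 12               <⟨ n<1+n (12 + T * 12) ⟩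
          13 + T * 12               ≡⟨ cong (λ t → 13 + t * 12) (sym t≡) ⟩
          13 + t * 12               ≤⟨ +-monoʳ-≤ 13 (m/n*n≤m (logΔ ∸ 13) 12) ⟩
          13 + (logΔ ∸ 13)            ≡⟨ m+[n∸m]≡n {13} {logΔ} (<⇒≤ (m∸n≢0⇒n<m {logΔ} {13} (t≢0 t≡))) ⟩
          logΔ                        ∎
          where
          eq : ∀ T → 6 * T + 6 + (6 * T + 6) ≡ 12 + T * 12
          eq = solve-∀
          t≢0 : t ≡ T → logΔ ∸ 13 ≢ 0
          t≢0 t≡ eq = 0≢1+n (trans (sym (cong (ℕ._/ 12) eq)) t≡)
        H : ℕ
        H = 64 * (d * N * (8 ^ t′ * 2 ^ (3 * T)))
        h≤H : ∀ j → j < T → 64 * (d * N * (8 ^ j * 2 ^ (3 * T))) ≤ H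
        h≤H j j<T = *-monoʳ-≤ 64 (*-monoʳ-≤ (d * N) (*-monoˡ-≤ (2 ^ (3 * T)) (^-monoʳ-≤ 8 (≤-pred j<T))))
        8H≡ : 8 * H ≡ 2 ^ (6 * T + 6) * (d * N)
        8H≡ = trans (eq (d * N) (8 ^ t′) (2 ^ (3 * T))) (cong (_* (d * N)) (begin-equality
          64 * (8 ^ T * 2 ^ (3 * T))        ≡⟨ cong (λ p → 64 * (p * 2 ^ (3 * T))) (^-*-assoc 2 3 T) ⟩
          2 ^ 6 * (2 ^ (3 * T) * 2 ^ (3 * T)) ≡⟨ cong (2 ^ 6 *_) (sym (^-distribˡ-+-* 2 (3 * T) (3 * T))) ⟩
          2 ^ 6 * 2 ^ (3 * T + 3 * T)       ≡⟨ sym (^-distribˡ-+-* 2 6 (3 * T + 3 * T)) ⟩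
          2 ^ (6 + (3 * T + 3 * T))         ≡⟨ cong (2 ^_) (eq′ T) ⟩
          2 ^ (6 * T + 6)                   ∎))
          where
          eq : ∀ X p q → 8 * (64 * (X * (p * q))) ≡ 64 * (8 * p * q) * X
          eq = solve-∀
          eq′ : ∀ T → 6 + (3 * T + 3 * T) ≡ 6 * T + 6
          eq′ = solve-∀
        H≤Δ : 8 * H * (suc k₀ + z) ≤ Δ
        H≤Δ = begin
          8 * H * (suc k₀ + z)                         ≡⟨ cong (_* (suc k₀ + z)) 8H≡ ⟩
          2 ^ (6 * T + 6) * (d * N) * (suc k₀ + z)     ≡⟨ *-assoc (2 ^ (6 * T + 6)) (d * N) (suc k₀ + z) ⟩
          2 ^ (6 * T + 6) * (d * N * (suc k₀ + z))     ≤⟨ ≤Δ (6 * T + 6) 12T+12<λ (*-monoʳ-≤ (d * N) (+-monoˡ-≤ z suck₀≤)) ⟩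
          Δ                                            ∎
          where
          suck₀≤ : suc k₀ ≤ 2 * k
          suck₀≤ = ≤-trans (≤-trans (≤-reflexive (+-comm 1 k₀)) (+-monoʳ-≤ k₀ (s≤s (z≤n {suc (d′ * 2)})))) (m≤n*m k 2)
        slots : 3 * T * (T * G) ≤ b * words
        slots = Instance.slotBound d′ N T k₀ z (3 * T) Δ H 0<N (s≤s z≤n) h≤H H≤Δ ε ε-h ε-g {b} {words} A maintains
        -- The word length, of order T, absorbs one of the two factors T.
        TG≤ : T * G ≤ 36 * (κ * words)
        TG≤ = *-cancelˡ-≤ T (begin
          T * (T * G)              ≤⟨ *-monoˡ-≤ (T * G) (m≤n*m T 3) ⟩
          3 * T * (T * G)          ≤⟨ slots ⟩
          b * words                ≤⟨ b*words≤ ⟩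
          κ * logΔ * words           ≤⟨ *-monoˡ-≤ words (*-monoʳ-≤ κ λ≤36T) ⟩
          κ * (36 * T) * words     ≡⟨ eq κ T words ⟩
          T * (36 * (κ * words))   ∎)
          where
          eq : ∀ κ T s → κ * (36 * T) * s ≡ T * (36 * (κ * s))
          eq = solve-∀
        λG≤ : logΔ * G ≤ 1296 * (κ * words)
        λG≤ = begin
          logΔ * G                      ≤⟨ *-monoˡ-≤ G λ≤36T ⟩
          36 * T * G                  ≡⟨ *-assoc 36 T G ⟩
          36 * (T * G)                ≤⟨ *-monoʳ-≤ 36 TG≤ ⟩
          36 * (36 * (κ * words))     ≡⟨ *-assoc 36 36 (κ * words) ⟨
          1296 * (κ * words)          ∎

      -- Here `logΔ ≤ 24`, so `Y ^ 2 ≤ Δ` bounds `d * N` by a constant, and the block family bounds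
      -- `k`.
      small : t ≡ 0 → k * (24 * (d * N)) ^ d * logΔ ≤ 96 * (2 ^ 15) ^ d * (κ * words)
      small t≡0 = begin
        k * (24 * (d * N)) ^ d * logΔ            ≤⟨ *-mono-≤ (*-mono-≤ (m+n≤o⇒m≤o k k+z≤) (^-monoˡ-≤ d 24dN≤)) λ≤24 ⟩
        4 * κ * words * (2 ^ 15) ^ d * 24      ≡⟨ eq κ words ((2 ^ 15) ^ d) ⟩
        96 * (2 ^ 15) ^ d * (κ * words)        ∎
        where
        eq : ∀ κ s p → 4 * κ * s * p * 24 ≡ 96 * p * (κ * s)
        eq = solve-∀
        λ≤24 : logΔ ≤ 24
        λ≤24 = subst (λ t → logΔ ≤ 24 + t * 12) t≡0 λ≤24+12t
        Y≤ : Y ≤ 2 ^ 12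
        Y≤ = ^2-cancel-≤ (begin
          Y ^ 2           ≤⟨ Y²≤Δ ⟩
          Δ               ≤⟨ n≤2^⌈log₂n⌉ Δ ⟩
          2 ^ logΔ          ≤⟨ ^-monoʳ-≤ 2 λ≤24 ⟩
          2 ^ 24          ≡⟨ ^-*-assoc 2 12 2 ⟨
          (2 ^ 12) ^ 2    ∎)
        24dN≤ : 24 * (d * N) ≤ 2 ^ 15
        24dN≤ = begin
          24 * (d * N)           ≤⟨ *-monoˡ-≤ (d * N) (m≤m+n 24 8) ⟩
          32 * (d * N)           ≡⟨ eq′ (d * N) ⟩
          8 * (d * N * 4)        ≤⟨ *-monoʳ-≤ 8 (*-monoʳ-≤ (d * N) (≤-trans (*-monoʳ-≤ 2 2≤k) (m≤m+n (2 * k) z))) ⟩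
          8 * Y                  ≤⟨ *-monoʳ-≤ 8 Y≤ ⟩
          8 * 2 ^ 12             ≡⟨ ^-distribˡ-+-* 2 3 12 ⟨
          2 ^ 15                 ∎
          where
          eq′ : ∀ a → 32 * a ≡ 8 * (a * 4)
          eq′ = solve-∀

    spaceBound : k * (24 * (d * N)) ^ d * logΔ + z ≤ constant d * κ * words
    spaceBound = begin
      k * (24 * (d * N)) ^ d * logΔ + z           ≤⟨ +-mono-≤ (split t refl) (m+n≤o⇒n≤o k k+z≤) ⟩
      (c₁ + c₂) * (κ * words) + 4 * κ * words   ≡⟨ eq c₁ c₂ κ words ⟩
      (c₁ + c₂ + 4) * κ * words                 ∎
      where
      c₁ = 2592 * d * (24 * d) ^ d
      c₂ = 96 * (2 ^ 15) ^ d
      eq : ∀ c₁ c₂ κ s → (c₁ + c₂) * (κ * s) + 4 * κ * s ≡ (c₁ + c₂ + 4) * κ * s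
      eq = solve-∀
      split : ∀ t₀ → t ≡ t₀ → k * (24 * (d * N)) ^ d * logΔ ≤ (c₁ + c₂) * (κ * words)
      split zero     t≡ = ≤-trans (small t≡) (*-monoˡ-≤ (κ * words) (m≤n+m c₂ c₁))
      split (suc t′) t≡ = ≤-trans (large t′ t≡) (*-monoˡ-≤ (κ * words) (m≤m+n c₁ c₂))

-- From the real parameter ε to the integer bounds

open import Data.Integer using (+_)
open import Data.Rational using (_/_)

module _ (d′ N′ : ℕ) (ε : ℝ) where

  private
    dN = suc d′ * suc N′

    β-scaled : ∀ v → β d′ N′ ℚ.* ι (64 * (dN * v)) ≡ ι (9 * v)
    β-scaled v = begin
      i ℚ.* (+ 9 / 8) ℚ.* ι (64 * (dN * v))            ≡⟨ cong (λ n → i ℚ.* (+ 9 / 8) ℚ.* ι n) (eq dN v) ⟩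
      i ℚ.* (+ 9 / 8) ℚ.* ι (m * (8 * v))              ≡⟨ cong (i ℚ.* (+ 9 / 8) ℚ.*_) (trans (ι-* m (8 * v)) (cong (ι m ℚ.*_) (ι-* 8 v))) ⟩
      i ℚ.* (+ 9 / 8) ℚ.* (ι m ℚ.* (ι 8 ℚ.* ι v))      ≡⟨ solve 5 (λ i a M b v → i :* a :* (M :* (b :* v)) := M :* i :* (a :* b :* v)) refl i (+ 9 / 8) (ι m) (ι 8) (ι v) ⟩
      ι m ℚ.* i ℚ.* ((+ 9 / 8) ℚ.* ι 8 ℚ.* ι v)        ≡⟨ cong (ℚ._* ((+ 9 / 8) ℚ.* ι 8 ℚ.* ι v)) (ι*inv m) ⟩
      ℚ.1ℚ ℚ.* ((+ 9 / 8) ℚ.* ι 8 ℚ.* ι v)             ≡⟨ ℚ.*-identityˡ ((+ 9 / 8) ℚ.* ι 8 ℚ.* ι v) ⟩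
      ι 9 ℚ.* ι v                                      ≡⟨ sym (ι-* 9 v) ⟩
      ι (9 * v)                                        ∎
      where
      open ≡-Reasoning
      open +-*-Solver
      m = 8 * dN
      i = inv m
      eq : ∀ a v → 64 * (a * v) ≡ 8 * a * (8 * v)
      eq = solve-∀

    ⅛-scaled : ∀ X → (+ 1 / 8) ℚ.* ι (64 * X) ≡ ι (8 * X)
    ⅛-scaled X = begin
      (+ 1 / 8) ℚ.* ι (64 * X)            ≡⟨ cong (λ n → (+ 1 / 8) ℚ.* ι n) (ℕ.*-assoc 8 8 X) ⟩
      (+ 1 / 8) ℚ.* ι (8 * (8 * X))       ≡⟨ cong ((+ 1 / 8) ℚ.*_) (ι-* 8 (8 * X)) ⟩
      (+ 1 / 8) ℚ.* (ι 8 ℚ.* ι (8 * X))   ≡⟨ sym (ℚ.*-assoc (+ 1 / 8) (ι 8) (ι (8 * X))) ⟩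
      ℚ.1ℚ ℚ.* ι (8 * X)                  ≡⟨ ℚ.*-identityˡ (ι (8 * X)) ⟩
      ι (8 * X)                           ∎
      where open ≡-Reasoning

  ε-h : ε ∈[0, β d′ N′ ] → ∀ v opt → opt ∈[0, ι (64 * (dN * v)) ] → ε *ℝ opt ∈[0, ι (9 * v) ]
  ε-h ε∈ v opt opt∈ = subst (ε *ℝ opt ∈[0,_]) (β-scaled v)
    (*-∈[0,] {ε} {opt} {β d′ N′} {ι (64 * (dN * v))} ε∈ opt∈)

  -- opt* is at most 9 / 8 · 64 X = 72 X, and the enlargement adds at most 64 X / 8 = 8 X.
  ε-g : ε ∈[0, + 1 / 8 ] → ∀ v opt opt* → opt ∈[0, ι (64 * (dN * v)) ] → 0ℝ ≤ℝ opt* → opt* ≤ℝ (1ℝ +ℝ ε) *ℝ opt →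
    opt* ∈[0, ι (80 * (dN * v)) ] × opt* +ℝ ε *ℝ opt ∈[0, ι (80 * (dN * v)) ]
  ε-g ε∈ v opt opt* opt∈ 0≤opt* opt*≤ =
      weaken {opt*} {ι (72 * X)} {ι (80 * X)} (ι-mono-≤ (ℕ.*-monoˡ-≤ X (ℕ.m≤m+n 72 8))) opt*∈
    , subst (opt* +ℝ ε *ℝ opt ∈[0,_]) (trans (sym (ι-+ (72 * X) (8 * X))) (cong ι (sym (ℕ.*-distribʳ-+ X 72 8))))
        (+-∈[0,] {opt*} {ε *ℝ opt} {ι (72 * X)} {ι (8 * X)} opt*∈
          (subst (ε *ℝ opt ∈[0,_]) (⅛-scaled X) (*-∈[0,] {ε} {opt} {+ 1 / 8} {ι (64 * X)} ε∈ opt∈)))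
    where
    X = dN * v
    [1+⅛]≡ : (ℚ.1ℚ ℚ.+ (+ 1 / 8)) ℚ.* ι (64 * X) ≡ ι (72 * X)
    [1+⅛]≡ = begin
      (ℚ.1ℚ ℚ.+ (+ 1 / 8)) ℚ.* ι (64 * X)                  ≡⟨ ℚ.*-distribʳ-+ (ι (64 * X)) ℚ.1ℚ (+ 1 / 8) ⟩
      ℚ.1ℚ ℚ.* ι (64 * X) ℚ.+ (+ 1 / 8) ℚ.* ι (64 * X)     ≡⟨ cong₂ ℚ._+_ (ℚ.*-identityˡ (ι (64 * X))) (⅛-scaled X) ⟩
      ι (64 * X) ℚ.+ ι (8 * X)                             ≡⟨ sym (ι-+ (64 * X) (8 * X)) ⟩
      ι (64 * X + 8 * X)                                   ≡⟨ cong ι (sym (ℕ.*-distribʳ-+ X 64 8)) ⟩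
      ι (72 * X)                                           ∎
      where open ≡-Reasoning
    opt*∈ : opt* ∈[0, ι (72 * X) ]
    opt*∈ = 0≤opt* , ≤ℝ-trans {opt*} {(1ℝ +ℝ ε) *ℝ opt} {fromℚ (ι (72 * X))} opt*≤
      (proj₂ (subst ((1ℝ +ℝ ε) *ℝ opt ∈[0,_]) [1+⅛]≡
        (*-∈[0,] {1ℝ +ℝ ε} {opt} {ℚ.1ℚ ℚ.+ (+ 1 / 8)} {ι (64 * X)}
          (+-∈[0,] {1ℝ} {ε} {ℚ.1ℚ} {+ 1 / 8} (fromℚ-∈[0,] {ℚ.1ℚ} 0≤1) ε∈) opt∈)))

^-∈[0,] : ∀ {x n} d → x ∈[0, ι n ] → x ^ℝ d ∈[0, ι (n ^ d) ]
^-∈[0,] {x} {n} zero    x∈ = fromℚ-∈[0,] {ι 1} (0≤ι 1)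
^-∈[0,] {x} {n} (suc d) x∈ = subst (x ^ℝ suc d ∈[0,_]) (sym (ι-* n (n ^ d)))
  (*-∈[0,] {x} {x ^ℝ d} {ι n} {ι (n ^ d)} x∈ (^-∈[0,] {x} {n} d x∈))

fromℕ-∈[0,] : ∀ n → fromℕ n ∈[0, ι n ]
fromℕ-∈[0,] n = fromℚ-∈[0,] {ι n} (0≤ι n)

module _ (d′ κ : ℕ) where

  private
    d M : ℕ
    d = suc d′
    -- The successor keeps `inv M` defined for `κ = 0`.
    M = suc (constant d * κ)

  -- As 1 / ε is at most `24 * (d * N)`, the real expression is bounded by the integer `total`, to
  -- which `spaceBound` applies.
  lowerBound : ∀ k₀ k → k₀ + d * 2 ≡ k → (z Δ : ℕ) (ε ε⁻¹ : ℝ) →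
    0ℝ <ℝ ε → ε *ℝ ε⁻¹ ≃ℝ 1ℝ → ε ≤ℝ fromℚ (inv (8 * d)) →
    (fromℕ (2 * k + z) *ℝ (fromℚ (+ 1 / 4) *ℝ ε⁻¹ +ℝ fromℕ d)) ^ℝ 2 ≤ℝ fromℕ Δ →
    ∀ (b s : ℕ) → b ≤ κ * ⌈log₂ Δ ⌉ →
    (A : Algorithm d Δ b s) → MaintainsWeightRestrictedCoreset ε k z A →
    fromℚ (inv M) *ℝ (fromℕ k *ℝ ε⁻¹ ^ℝ d *ℝ fromℕ ⌈log₂ Δ ⌉ +ℝ fromℕ z) ≤ℝ fromℕ s
  lowerBound k₀ k refl z Δ ε ε⁻¹ 0<ε εε⁻¹≃1 ε≤ ≤Δ b s b≤ A maintains =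
    proj₂ (weaken {fromℚ (inv M) *ℝ lhs} {inv M ℚ.* ι total} {ι s} total≤
      (*-∈[0,] {fromℚ (inv M)} {lhs} {inv M} {ι total} (fromℚ-∈[0,] {inv M} (0≤inv M)) lhs∈))
    where
    N = suc (N′ d′ ε ε⁻¹ 0<ε εε⁻¹≃1 ε≤)
    Y = d * N * (2 * k + z)
    total = k * (24 * (d * N)) ^ d * ⌈log₂ Δ ⌉ + z
    lhs : ℝ
    lhs = fromℕ k *ℝ ε⁻¹ ^ℝ d *ℝ fromℕ ⌈log₂ Δ ⌉ +ℝ fromℕ z

    Y²≤Δ : Y ^ 2 ≤ Δ
    -- The real hypothesis yields the inequality only up to each positive rational `e`, which is
    -- enough between integers.
    Y²≤Δ = ι-cancel-≤ (≤+e⇒≤ ℚ.1ℚ 0≤1 λ e 0<e → eventually-const (eventually-map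
      (λ n (dN≤ , square≤) → begin
        ι (Y ^ 2)                       ≡⟨ trans (ι-* Y (Y * 1)) (cong (ι Y ℚ.*_) (ι-* Y 1)) ⟩
        ι Y ℚ.* (ι Y ℚ.* ι 1)           ≤⟨ square (ι Y) (A′ n) (0≤ι Y) (ι-Y≤ n dN≤) ⟩
        A′ n ℚ.* (A′ n ℚ.* ι 1)         ≤⟨ square≤ ⟩
        ι Δ ℚ.+ e                       ≡⟨ cong (ι Δ ℚ.+_) (sym (ℚ.*-identityˡ e)) ⟩
        ι Δ ℚ.+ ℚ.1ℚ ℚ.* e              ∎)
      (eventually-× (dN≤ d′ ε ε⁻¹ 0<ε εε⁻¹≃1 ε≤) (≤Δ e 0<e))))
      where
      open ℚ.≤-Reasoning
      B : ℕ → ℚ.ℚ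
      B n = (+ 1 / 4) ℚ.* seq ε⁻¹ n ℚ.+ ι d
      A′ : ℕ → ℚ.ℚ
      A′ n = ι (2 * k + z) ℚ.* B n
      ι-Y≤ : ∀ n → ι (d * N) ℚ.≤ B n → ι Y ℚ.≤ A′ n
      ι-Y≤ n le = begin
        ι Y                              ≡⟨ trans (ι-* (d * N) (2 * k + z)) (ℚ.*-comm (ι (d * N)) (ι (2 * k + z))) ⟩
        ι (2 * k + z) ℚ.* ι (d * N)      ≤⟨ ℚ.*-monoˡ-≤-nonNeg (ι (2 * k + z)) {{ℚ.nonNegative (0≤ι (2 * k + z))}} le ⟩
        ι (2 * k + z) ℚ.* B n            ∎
      square : ∀ p q → ℚ.0ℚ ℚ.≤ p → p ℚ.≤ q → p ℚ.* (p ℚ.* ι 1) ℚ.≤ q ℚ.* (q ℚ.* ι 1)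
      square p q 0≤p p≤q = subst₂ (λ a b → p ℚ.* a ℚ.≤ q ℚ.* b) (sym (ℚ.*-identityʳ p)) (sym (ℚ.*-identityʳ q))
        (*-mono-≤-nonNeg {p} {q} {p} {q} 0≤p (ℚ.≤-trans 0≤p p≤q) p≤q p≤q)

    0<Δ : 0 < Δ
    0<Δ = ℕ.≤-trans (^2-mono-≤ {1} {Y} (ℕ.*-mono-≤ {1} {d * N} (s≤s z≤n)
      (ℕ.≤-trans (ℕ.≤-trans {1} {d * 2} (s≤s z≤n) (ℕ.m≤n+m (d * 2) k₀)) (ℕ.≤-trans (ℕ.m≤m+n k (1 * k)) (ℕ.m≤m+n (2 * k) z))))) Y²≤Δ

    ε∈ = ε∈β d′ ε ε⁻¹ 0<ε εε⁻¹≃1 ε≤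

    space : total ≤ constant d * κ * s
    space = Bounds.spaceBound d′ κ k₀ z N Δ {{>-nonZero 0<Δ}} (s≤s z≤n) ε {β d′ (N′ d′ ε ε⁻¹ 0<ε εε⁻¹≃1 ε≤)} ε∈
      (ε-h d′ (N′ d′ ε ε⁻¹ 0<ε εε⁻¹≃1 ε≤) ε ε∈)
      (ε-g d′ (N′ d′ ε ε⁻¹ 0<ε εε⁻¹≃1 ε≤) ε (ε∈⅛ d′ ε ε⁻¹ 0<ε εε⁻¹≃1 ε≤))
      Y²≤Δ {b} {s} b≤ A maintains

    lhs∈ : lhs ∈[0, ι total ]
    lhs∈ = subst (lhs ∈[0,_]) eq
      (+-∈[0,] {fromℕ k *ℝ ε⁻¹ ^ℝ d *ℝ fromℕ ⌈log₂ Δ ⌉} {fromℕ z} {ι k ℚ.* ι p ℚ.* ι ⌈log₂ Δ ⌉} {ι z}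
        (*-∈[0,] {fromℕ k *ℝ ε⁻¹ ^ℝ d} {fromℕ ⌈log₂ Δ ⌉} {ι k ℚ.* ι p} {ι ⌈log₂ Δ ⌉}
          (*-∈[0,] {fromℕ k} {ε⁻¹ ^ℝ d} {ι k} {ι p} (fromℕ-∈[0,] k)
            (^-∈[0,] {ε⁻¹} {24 * (d * N)} d (x∈ d′ ε ε⁻¹ 0<ε εε⁻¹≃1 ε≤)))
          (fromℕ-∈[0,] ⌈log₂ Δ ⌉))
        (fromℕ-∈[0,] z))
      where
      p = (24 * (d * N)) ^ d
      eq : ι k ℚ.* ι p ℚ.* ι ⌈log₂ Δ ⌉ ℚ.+ ι z ≡ ι total
      eq = sym (trans (ι-+ (k * p * ⌈log₂ Δ ⌉) z) (cong (ℚ._+ ι z)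
        (trans (ι-* (k * p) ⌈log₂ Δ ⌉) (cong (ℚ._* ι ⌈log₂ Δ ⌉) (ι-* k p)))))

    total≤ : inv M ℚ.* ι total ℚ.≤ ι s
    total≤ = begin
      inv M ℚ.* ι total          ≤⟨ ℚ.*-monoˡ-≤-nonNeg (inv M) {{ℚ.nonNegative (0≤inv M)}}
                                     (ι-mono-≤ (ℕ.≤-trans space (ℕ.*-monoˡ-≤ s (ℕ.n≤1+n (constant d * κ))))) ⟩
      inv M ℚ.* ι (M * s)        ≡⟨ cong (inv M ℚ.*_) (ι-* M s) ⟩
      inv M ℚ.* (ι M ℚ.* ι s)    ≡⟨ sym (ℚ.*-assoc (inv M) (ι M) (ι s)) ⟩
      inv M ℚ.* ι M ℚ.* ι s      ≡⟨ cong (ℚ._* ι s) (trans (ℚ.*-comm (inv M) (ι M)) (ι*inv M)) ⟩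
      ℚ.1ℚ ℚ.* ι s               ≡⟨ ℚ.*-identityˡ (ι s) ⟩
      ι s                        ∎
      where open ℚ.≤-Reasoning

theorem28 : (d κ : ℕ) .{{_ : NonZero d}} →
    ∃[ c ] (0ℝ <ℝ c ×
    (∀ (k z Δ : ℕ) (ε ε⁻¹ : ℝ) →
    0ℝ <ℝ ε → ε *ℝ ε⁻¹ ≃ℝ 1ℝ →
    ε ≤ℝ fromℚ ((+ 1 / (8 * d)) {{m*n≢0 8 d}}) →
    2 * d ≤ k →
    (fromℕ (2 * k + z) *ℝ (fromℚ (+ 1 / 4) *ℝ ε⁻¹ +ℝ fromℕ d)) ^ℝ 2 ≤ℝ fromℕ Δ →
    ∀ (b s : ℕ) → b ≤ κ * ⌈log₂ Δ ⌉ →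
    (A : Algorithm d Δ b s) → MaintainsWeightRestrictedCoreset ε k z A →
    c *ℝ (fromℕ k *ℝ ε⁻¹ ^ℝ d *ℝ fromℕ ⌈log₂ Δ ⌉ +ℝ fromℕ z) ≤ℝ fromℕ s))
theorem28 zero     κ = ⊥-elim (≢-nonZero⁻¹ 0 refl)
theorem28 (suc d′) κ =
    fromℚ (inv M)
  , (inv M , 0<inv M , 0 , λ _ _ → ℚ.≤-reflexive (ℚ.+-identityˡ (inv M)))
  , λ k z Δ ε ε⁻¹ 0<ε εε⁻¹≃1 ε≤ 2d≤k →
      let k₀ , 2d+k₀≡k = ℕ.m≤n⇒∃[o]m+o≡n 2d≤k
      in lowerBound d′ κ k₀ k (trans (trans (ℕ.+-comm k₀ (suc d′ * 2)) (cong (_+ k₀) (ℕ.*-comm (suc d′) 2))) 2d+k₀≡k)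
           z Δ ε ε⁻¹ 0<ε εε⁻¹≃1 ε≤
  where
  M = suc (constant (suc d′) * κ)
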